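{- Let $f\in\mathbb{Z}[x]$ be irreducible over $\mathbb{Q}$, of degree $d\ge 2$. For $N\ge 1$ let $L_f(N):=\operatorname{lcm}\{f(n): n=1,\dots,N\}$. Then $\log L_f(N)\gg N\log N$ as $N\to\infty$; that is, there exist a constant $c>0$ and an integer $N_0$ (both allowed to depend on $f$) such that $$\log L_f(N)\ \ge\ c\,N\log N\qquad\text{for all integers } N\ge N_0 .$$
   Context: The least common multiple of a finite set of nonzero integers is taken to be the positive one (signs are ignored). Since $f$ is irreducible over $\mathbb{Q}$ of degree at least $2$, it has no rational zeros, so all values $f(n)$ are nonzero and $L_f(N)\geq 1$ is well defined. -}

module Defs where

open import Level using (Level)
open import Algebra.Bundles using (RawSemiring)
import Algebra.Definitions.RawSemiring as RawSemiringDefinitions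
open import Data.Nat as ℕ using (ℕ; zero; suc; NonZero)
import Data.Nat.Properties as ℕ
open import Data.Nat.Coprimality using (1-coprimeTo)
open import Data.Nat.LCM using (lcm)
open import Data.Integer as ℤ using (ℤ; +_; +[1+_])
import Data.Integer.Properties as ℤ
open import Data.List using (List; []; _∷_; map; foldr; applyUpTo)
open import Data.Product using (∃-syntax; _×_; _,_; proj₁; proj₂)
open import Data.Rational as ℚ using (ℚ; mkℚ; 0ℚ; 1ℚ; _/_; *≤*; *<*)
import Data.Rational.Properties as ℚ
open import Data.Rational.Unnormalised as ℚᵘ using (mkℚᵘ; *≡*)
import Data.Rational.Unnormalised.Properties as ℚᵘ
open import Data.Rational.Solver using (module +-*-Solver)
open import Data.Sum using (inj₁; inj₂)
open import Function using (_∘_)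
open import Relation.Binary.PropositionalEquality

------------------------------------------------------------------------
-- Polynomials

-- A polynomial is the list of its coefficients, constant term first.
-- Trailing zeros are allowed, so equality is _≈_, not _≡_ of lists.

module Polynomial {c ℓ : Level} (R : RawSemiring c ℓ) where
  private module R = RawSemiring R

  Poly : Set c
  Poly = List R.Carrier

  coeff : Poly → ℕ → R.Carrier
  coeff []      _       = R.0#
  coeff (a ∷ _) zero    = a
  coeff (_ ∷ p) (suc i) = coeff p i

  infix 4 _≈_
  _≈_ : Poly → Poly → Set ℓ
  p ≈ q = ∀ i → coeff p i R.≈ coeff q i

  infixl 6 _+_
  _+_ : Poly → Poly → Poly
  []      + q       = q
  (a ∷ p) + []      = a ∷ p
  (a ∷ p) + (b ∷ q) = (a R.+ b) ∷ (p + q)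

  infixl 7 _*_
  _*_ : Poly → Poly → Poly
  []      * q = []
  (a ∷ p) * q = map (a R.*_) q + (R.0# ∷ (p * q))

  eval : Poly → R.Carrier → R.Carrier
  eval p x = foldr (λ a v → a R.+ x R.* v) R.0# p

  HasDegree : Poly → ℕ → Set ℓ
  HasDegree p d = (coeff p d R.≉ R.0#) × (∀ i → d ℕ.< i → coeff p i R.≈ R.0#)

  rawSemiring : RawSemiring c ℓ
  rawSemiring = record
    { _≈_ = _≈_ ; _+_ = _+_ ; _*_ = _*_ ; 0# = [] ; 1# = R.1# ∷ [] }

module ℤ[x] = Polynomial ℤ.+-*-rawSemiring
module ℚ[x] = Polynomial ℚ.+-*-rawSemiring

IrreducibleOverℚ : ℤ[x].Poly → Set
IrreducibleOverℚ f =
  RawSemiringDefinitions.Irreducible ℚ[x].rawSemiring (map (_/ 1) f)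

-- lcm { f(n) : n = 1, …, N }, signs ignored.
L : ℤ[x].Poly → ℕ → ℕ
L f N = foldr lcm 1 (applyUpTo (λ i → ℤ.∣ ℤ[x].eval f (+ suc i) ∣) N)

------------------------------------------------------------------------
-- Real numbers, as Cauchy sequences of rationals

IsCauchy : (ℕ → ℚ) → Set
IsCauchy x = ∀ ε → 0ℚ ℚ.< ε →
  ∃[ K ] (∀ m n → K ℕ.≤ m → K ℕ.≤ n → ℚ.∣ x m ℚ.- x n ∣ ℚ.≤ ε)

record ℝ : Set where
  constructor mkℝ
  field
    seq      : ℕ → ℚ
    isCauchy : IsCauchy seq
open ℝ

infix 4 _≤ℝ_ _<ℝ_

_≤ℝ_ : ℝ → ℝ → Set
x ≤ℝ y = ∀ ε → 0ℚ ℚ.< ε → ∃[ K ] (∀ k → K ℕ.≤ k → seq x k ℚ.≤ seq y k ℚ.+ ε)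

_<ℝ_ : ℝ → ℝ → Set
x <ℝ y = ∃[ ε ] (0ℚ ℚ.< ε × (∃[ K ] (∀ k → K ℕ.≤ k → seq x k ℚ.+ ε ℚ.≤ seq y k)))

fromℚ : ℚ → ℝ
fromℚ q = mkℝ (λ _ → q) λ ε 0<ε → 0 , λ _ _ _ _ →
  subst (ℚ._≤ ε) (sym (cong ℚ.∣_∣ (ℚ.+-inverseʳ q))) (ℚ.<⇒≤ 0<ε)

fromℕ : ℕ → ℝ
fromℕ n = fromℚ (+ n / 1)

0ℝ : ℝ
0ℝ = fromℚ 0ℚ

private
  reciprocal-below : ∀ ε → 0ℚ ℚ.< ε → ∃[ K ] (+ 1 / suc K ℚ.≤ ε)
  reciprocal-below (mkℚ +[1+ n ] d c) _ = d ,
    subst (ℚ._≤ mkℚ +[1+ n ] d c) (sym (ℚ.normalize-coprime (1-coprimeTo (suc d))))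
      (*≤* (ℤ.*-monoʳ-≤-nonNeg (+ suc d) {+ 1} {+[1+ n ]} (ℤ.+≤+ (ℕ.s≤s ℕ.z≤n))))
  reciprocal-below (mkℚ (+ 0) d c) (*<* (ℤ.+<+ ()))
  reciprocal-below (mkℚ ℤ.-[1+ n ] d c) (*<* ())

  split : ∀ B → 0ℚ ℚ.≤ B → ∀ ε → 0ℚ ℚ.< ε →
          ∃[ δ ] (0ℚ ℚ.< δ × B ℚ.* δ ℚ.+ B ℚ.* δ ℚ.≤ ε)
  split B 0≤B ε 0<ε = δ , 0<δ , ℚ.≤-trans (ℚ.≤-reflexive eq₁) (ℚ.≤-trans
      (ℚ.*-monoʳ-≤-nonNeg δ {{ℚ.nonNegative (ℚ.<⇒≤ 0<δ)}} 2B≤D) (ℚ.≤-reflexive eq₂))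
    where
    D = 1ℚ ℚ.+ (B ℚ.+ B)
    2B≤D : B ℚ.+ B ℚ.≤ D
    2B≤D = subst (ℚ._≤ D) (ℚ.+-identityˡ (B ℚ.+ B))
      (ℚ.+-monoˡ-≤ (B ℚ.+ B) (ℚ.nonNegative⁻¹ 1ℚ))
    0<D : 0ℚ ℚ.< D
    0<D = ℚ.<-≤-trans (ℚ.positive⁻¹ 1ℚ) (subst (ℚ._≤ D) (ℚ.+-identityʳ 1ℚ)
      (ℚ.+-monoʳ-≤ 1ℚ (ℚ.+-mono-≤ 0≤B 0≤B)))
    instance
      D⁺ : ℚ.Positive D
      D⁺ = ℚ.positive 0<D
      D≠0 : ℚ.NonZero D
      D≠0 = ℚ.pos⇒nonZero D
      1/D⁺ : ℚ.Positive (ℚ.1/ D)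
      1/D⁺ = ℚ.1/pos⇒pos D
      ε⁺ : ℚ.Positive ε
      ε⁺ = ℚ.positive 0<ε
    δ = ε ℚ.* ℚ.1/ D
    0<δ : 0ℚ ℚ.< δ
    0<δ = ℚ.positive⁻¹ δ {{ℚ.pos*pos⇒pos ε (ℚ.1/ D)}}
    eq₁ : B ℚ.* δ ℚ.+ B ℚ.* δ ≡ (B ℚ.+ B) ℚ.* δ
    eq₁ = sym (ℚ.*-distribʳ-+ δ B B)
    eq₂ : D ℚ.* δ ≡ ε
    eq₂ = begin
      D ℚ.* (ε ℚ.* ℚ.1/ D)  ≡⟨ ℚ.*-comm D _ ⟩
      ε ℚ.* ℚ.1/ D ℚ.* D    ≡⟨ ℚ.*-assoc ε (ℚ.1/ D) D ⟩
      ε ℚ.* (ℚ.1/ D ℚ.* D)  ≡⟨ cong (ε ℚ.*_) (ℚ.*-inverseˡ D) ⟩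
      ε ℚ.* 1ℚ              ≡⟨ ℚ.*-identityʳ ε ⟩
      ε                     ∎
      where open ≡-Reasoning

  EventuallyBounded : ℝ → Set
  EventuallyBounded x =
    ∃[ B ] (0ℚ ℚ.≤ B × (∃[ K ] (∀ k → K ℕ.≤ k → ℚ.∣ seq x k ∣ ℚ.≤ B)))

  eventually-bounded : ∀ x → EventuallyBounded x
  eventually-bounded x with isCauchy x 1ℚ (ℚ.positive⁻¹ 1ℚ)
  ... | K , close = B , 0≤B , K , bound
    where
    B = 1ℚ ℚ.+ ℚ.∣ seq x K ∣
    0≤B : 0ℚ ℚ.≤ B
    0≤B = ℚ.+-mono-≤ (ℚ.nonNegative⁻¹ 1ℚ) (ℚ.0≤∣p∣ (seq x K))
    bound : ∀ k → K ℕ.≤ k → ℚ.∣ seq x k ∣ ℚ.≤ B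
    bound k K≤k = begin
      ℚ.∣ a ∣                      ≡⟨ cong ℚ.∣_∣ (solve 2 (λ a b → a := (a :- b) :+ b) refl a b) ⟩
      ℚ.∣ (a ℚ.- b) ℚ.+ b ∣        ≤⟨ ℚ.∣p+q∣≤∣p∣+∣q∣ (a ℚ.- b) b ⟩
      ℚ.∣ a ℚ.- b ∣ ℚ.+ ℚ.∣ b ∣    ≤⟨ ℚ.+-monoˡ-≤ ℚ.∣ b ∣ (close k K K≤k ℕ.≤-refl) ⟩
      B                            ∎
      where
      open ℚ.≤-Reasoning
      open +-*-Solver
      a = seq x k
      b = seq x K

  product-difference : ∀ a b c d →
    a ℚ.* b ℚ.- c ℚ.* d ≡ a ℚ.* (b ℚ.- d) ℚ.+ d ℚ.* (a ℚ.- c)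
  product-difference = solve 4 (λ a b c d →
    a :* b :- c :* d := a :* (b :- d) :+ d :* (a :- c)) refl
    where open +-*-Solver

  product-close : ∀ {a b c d B δ} → 0ℚ ℚ.≤ δ →
    ℚ.∣ a ∣ ℚ.≤ B → ℚ.∣ d ∣ ℚ.≤ B → ℚ.∣ a ℚ.- c ∣ ℚ.≤ δ → ℚ.∣ b ℚ.- d ∣ ℚ.≤ δ →
    ℚ.∣ a ℚ.* b ℚ.- c ℚ.* d ∣ ℚ.≤ B ℚ.* δ ℚ.+ B ℚ.* δ
  product-close {a} {b} {c} {d} {B} {δ} 0≤δ a≤ d≤ ac≤ bd≤ = begin
    ℚ.∣ a ℚ.* b ℚ.- c ℚ.* d ∣
      ≡⟨ cong ℚ.∣_∣ (product-difference a b c d) ⟩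
    ℚ.∣ a ℚ.* (b ℚ.- d) ℚ.+ d ℚ.* (a ℚ.- c) ∣
      ≤⟨ ℚ.∣p+q∣≤∣p∣+∣q∣ (a ℚ.* (b ℚ.- d)) (d ℚ.* (a ℚ.- c)) ⟩
    ℚ.∣ a ℚ.* (b ℚ.- d) ∣ ℚ.+ ℚ.∣ d ℚ.* (a ℚ.- c) ∣
      ≤⟨ ℚ.+-mono-≤ (bound a (b ℚ.- d) a≤ bd≤) (bound d (a ℚ.- c) d≤ ac≤) ⟩
    B ℚ.* δ ℚ.+ B ℚ.* δ ∎
    where
    open ℚ.≤-Reasoning
    bound : ∀ p q → ℚ.∣ p ∣ ℚ.≤ B → ℚ.∣ q ∣ ℚ.≤ δ → ℚ.∣ p ℚ.* q ∣ ℚ.≤ B ℚ.* δ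
    bound p q p≤ q≤ = begin
      ℚ.∣ p ℚ.* q ∣        ≡⟨ ℚ.∣p*q∣≡∣p∣*∣q∣ p q ⟩
      ℚ.∣ p ∣ ℚ.* ℚ.∣ q ∣  ≤⟨ ℚ.*-monoˡ-≤-nonNeg ℚ.∣ p ∣ {{ℚ.∣-∣-nonNeg p}} q≤ ⟩
      ℚ.∣ p ∣ ℚ.* δ        ≤⟨ ℚ.*-monoʳ-≤-nonNeg δ {{ℚ.nonNegative 0≤δ}} p≤ ⟩
      B ℚ.* δ              ∎

  product-cauchy : ∀ x y → IsCauchy (λ k → seq x k ℚ.* seq y k)
  product-cauchy x y ε 0<ε = from-bounds (eventually-bounded x) (eventually-bounded y)
    where
    from-bounds : EventuallyBounded x → EventuallyBounded y → ∃[ K ] (∀ m n → K ℕ.≤ m → K ℕ.≤ n →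
      ℚ.∣ seq x m ℚ.* seq y m ℚ.- seq x n ℚ.* seq y n ∣ ℚ.≤ ε)
    from-bounds (B₁ , 0≤B₁ , K₁ , x≤) (B₂ , 0≤B₂ , K₂ , y≤) =
      from-δ (split B (ℚ.+-mono-≤ 0≤B₁ 0≤B₂) ε 0<ε)
      where
      B = B₁ ℚ.+ B₂
      B₁≤B : B₁ ℚ.≤ B
      B₁≤B = subst (ℚ._≤ B) (ℚ.+-identityʳ B₁) (ℚ.+-monoʳ-≤ B₁ 0≤B₂)
      B₂≤B : B₂ ℚ.≤ B
      B₂≤B = subst (ℚ._≤ B) (ℚ.+-identityˡ B₂) (ℚ.+-monoˡ-≤ B₂ 0≤B₁)
      from-δ : ∃[ δ ] (0ℚ ℚ.< δ × B ℚ.* δ ℚ.+ B ℚ.* δ ℚ.≤ ε) → _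
      from-δ (δ , 0<δ , Bδ≤ε) =
        (K₁ ℕ.⊔ K₂) ℕ.⊔ (proj₁ dx ℕ.⊔ proj₁ dy) , λ m n K≤m K≤n →
        ℚ.≤-trans
          (product-close {seq x m} {seq y m} {seq x n} {seq y n} {B} {δ} (ℚ.<⇒≤ 0<δ)
            (ℚ.≤-trans (x≤ m (ℕ.m⊔n≤o⇒m≤o K₁ K₂ (left K≤m))) B₁≤B)
            (ℚ.≤-trans (y≤ n (ℕ.m⊔n≤o⇒n≤o K₁ K₂ (left K≤n))) B₂≤B)
            (proj₂ dx m n (ℕ.m⊔n≤o⇒m≤o (proj₁ dx) _ (right K≤m))
                          (ℕ.m⊔n≤o⇒m≤o (proj₁ dx) _ (right K≤n)))
            (proj₂ dy m n (ℕ.m⊔n≤o⇒n≤o (proj₁ dx) _ (right K≤m))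
                          (ℕ.m⊔n≤o⇒n≤o (proj₁ dx) _ (right K≤n))))
          Bδ≤ε
        where
        dx = isCauchy x δ 0<δ
        dy = isCauchy y δ 0<δ
        left : ∀ {i} → (K₁ ℕ.⊔ K₂) ℕ.⊔ (proj₁ dx ℕ.⊔ proj₁ dy) ℕ.≤ i → K₁ ℕ.⊔ K₂ ℕ.≤ i
        left = ℕ.m⊔n≤o⇒m≤o (K₁ ℕ.⊔ K₂) (proj₁ dx ℕ.⊔ proj₁ dy)
        right : ∀ {i} → (K₁ ℕ.⊔ K₂) ℕ.⊔ (proj₁ dx ℕ.⊔ proj₁ dy) ℕ.≤ i →
          proj₁ dx ℕ.⊔ proj₁ dy ℕ.≤ i
        right = ℕ.m⊔n≤o⇒n≤o (K₁ ℕ.⊔ K₂) (proj₁ dx ℕ.⊔ proj₁ dy)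

infixl 7 _*ℝ_

_*ℝ_ : ℝ → ℝ → ℝ
x *ℝ y = mkℝ (λ k → seq x k ℚ.* seq y k) (product-cauchy x y)

------------------------------------------------------------------------
-- The natural logarithm of a natural number

∑ : ℕ → (ℕ → ℚ) → ℚ
∑ zero    g = 0ℚ
∑ (suc n) g = ∑ n g ℚ.+ g n

-- The lower Riemann sum of ∫₁ⁿ dt/t for the mesh 1/m: the right endpoints
-- are 1 + (i+1)/m = (m+i+1)/m for i < (n-1)m, each contributing
-- (1/m) · m/(m+i+1).
riemannSum : ℕ → ℕ → ℚ
riemannSum n m = ∑ (ℕ.pred n ℕ.* m) (λ i → + 1 / suc (m ℕ.+ i))

private
  upperSum : ℕ → (m : ℕ) .{{_ : NonZero m}} → ℚ
  upperSum n m@(suc m-1) = ∑ (ℕ.pred n ℕ.* m) (λ i → + 1 / suc (m-1 ℕ.+ i))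

  ∑-mono : ∀ n {g h} → (∀ i → i ℕ.< n → g i ℚ.≤ h i) → ∑ n g ℚ.≤ ∑ n h
  ∑-mono zero    g≤h = ℚ.≤-refl
  ∑-mono (suc n) g≤h =
    ℚ.+-mono-≤ (∑-mono n λ i i<n → g≤h i (ℕ.m<n⇒m<1+n i<n)) (g≤h n ℕ.≤-refl)

  ∑-+ : ∀ a b g → ∑ (b ℕ.+ a) g ≡ ∑ a g ℚ.+ ∑ b (λ j → g (j ℕ.+ a))
  ∑-+ a zero    g = sym (ℚ.+-identityʳ _)
  ∑-+ a (suc b) g = trans (cong (ℚ._+ g (b ℕ.+ a)) (∑-+ a b g)) (ℚ.+-assoc (∑ a g) _ _)

  ∑-blocks : ∀ n b g → ∑ (n ℕ.* b) g ≡ ∑ n (λ i → ∑ b (λ j → g (j ℕ.+ i ℕ.* b)))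
  ∑-blocks zero    b g = refl
  ∑-blocks (suc n) b g = trans (∑-+ (n ℕ.* b) b g)
    (cong (ℚ._+ ∑ b (λ j → g (j ℕ.+ n ℕ.* b))) (∑-blocks n b g))

  toℚᵘ-/ : ∀ z d → ℚ.toℚᵘ (z / suc d) ℚᵘ.≃ mkℚᵘ z d
  toℚᵘ-/ z d = ℚ.toℚᵘ-fromℚᵘ (mkℚᵘ z d)

  suc-/1 : ∀ b → + b / 1 ℚ.+ 1ℚ ≡ + suc b / 1
  suc-/1 b = ℚ.toℚᵘ-injective (ℚᵘ.≃-trans (ℚ.toℚᵘ-homo-+ (+ b / 1) 1ℚ)
    (ℚᵘ.≃-trans (ℚᵘ.+-congˡ (mkℚᵘ (+ 1) 0) (toℚᵘ-/ (+ b) 0))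
    (ℚᵘ.≃-trans (*≡* eq) (ℚᵘ.≃-sym (toℚᵘ-/ (+ suc b) 0)))))
    where
    eq : (+ b ℤ.* + 1 ℤ.+ + 1 ℤ.* + 1) ℤ.* + 1 ≡ + suc b ℤ.* + 1
    eq = cong (ℤ._* + 1) (trans (cong (ℤ._+ + 1) (ℤ.*-identityʳ (+ b)))
           (cong +_ (ℕ.+-comm b 1)))

  ∑-const : ∀ b q → ∑ b (λ _ → q) ≡ (+ b / 1) ℚ.* q
  ∑-const zero    q = sym (ℚ.*-zeroˡ q)
  ∑-const (suc b) q = begin
    ∑ b (λ _ → q) ℚ.+ q               ≡⟨ cong₂ ℚ._+_ (∑-const b q) (sym (ℚ.*-identityˡ q)) ⟩
    (+ b / 1) ℚ.* q ℚ.+ 1ℚ ℚ.* q      ≡⟨ sym (ℚ.*-distribʳ-+ q (+ b / 1) 1ℚ) ⟩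
    (+ b / 1 ℚ.+ 1ℚ) ℚ.* q            ≡⟨ cong (ℚ._* q) (suc-/1 b) ⟩
    (+ suc b / 1) ℚ.* q               ∎
    where open ≡-Reasoning

  ∑-block : ∀ a b c → suc c ≡ suc a ℕ.* b → ∑ b (λ _ → + 1 / suc c) ≡ + 1 / suc a
  ∑-block a b c eq = trans (∑-const b (+ 1 / suc c)) (ℚ.toℚᵘ-injective
    (ℚᵘ.≃-trans (ℚ.toℚᵘ-homo-* (+ b / 1) (+ 1 / suc c))
    (ℚᵘ.≃-trans (ℚᵘ.*-cong (toℚᵘ-/ (+ b) 0) (toℚᵘ-/ (+ 1) c))
    (ℚᵘ.≃-trans (*≡* eq′) (ℚᵘ.≃-sym (toℚᵘ-/ (+ 1) a))))))
    where
    eq′ : (+ b ℤ.* + 1) ℤ.* + suc a ≡ + 1 ℤ.* + suc (c ℕ.+ 0)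
    eq′ = begin
      (+ b ℤ.* + 1) ℤ.* + suc a  ≡⟨ cong (ℤ._* + suc a) (ℤ.*-identityʳ (+ b)) ⟩
      + b ℤ.* + suc a            ≡⟨ ℤ.*-comm (+ b) (+ suc a) ⟩
      + suc a ℤ.* + b            ≡⟨ sym (ℤ.pos-* (suc a) b) ⟩
      + (suc a ℕ.* b)            ≡⟨ cong +_ (sym eq) ⟩
      + suc c                    ≡⟨ cong (+_ ∘ suc) (sym (ℕ.+-identityʳ c)) ⟩
      + suc (c ℕ.+ 0)            ≡⟨ sym (ℤ.*-identityˡ (+ suc (c ℕ.+ 0))) ⟩
      + 1 ℤ.* + suc (c ℕ.+ 0)    ∎
      where open ≡-Reasoning

  reciprocal-mono : ∀ {m n} → m ℕ.≤ n → + 1 / suc n ℚ.≤ + 1 / suc m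
  reciprocal-mono {m} {n} m≤n = subst₂ ℚ._≤_
    (sym (ℚ.normalize-coprime (1-coprimeTo (suc n))))
    (sym (ℚ.normalize-coprime (1-coprimeTo (suc m))))
    (*≤* (ℤ.*-monoˡ-≤-nonNeg (+ 1) (ℤ.+≤+ (ℕ.s≤s m≤n))))

  -- Refining the mesh increases lower sums.
  riemannSum-refine : ∀ n m b .{{_ : NonZero b}} → riemannSum n m ℚ.≤ riemannSum n (m ℕ.* b)
  riemannSum-refine n m b@(suc b-1) = begin
    ∑ N (λ i → + 1 / suc (m ℕ.+ i))
      ≤⟨ ∑-mono N (λ i _ → block i) ⟩
    ∑ N (λ i → ∑ b (λ j → + 1 / suc (m ℕ.* b ℕ.+ (j ℕ.+ i ℕ.* b))))
      ≡⟨ ∑-blocks N b (λ i → + 1 / suc (m ℕ.* b ℕ.+ i)) ⟨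
    ∑ (N ℕ.* b) (λ i → + 1 / suc (m ℕ.* b ℕ.+ i))
      ≡⟨ cong (λ k → ∑ k (λ i → + 1 / suc (m ℕ.* b ℕ.+ i))) (ℕ.*-assoc (ℕ.pred n) m b) ⟩
    riemannSum n (m ℕ.* b) ∎
    where
    open ℚ.≤-Reasoning
    N = ℕ.pred n ℕ.* m
    block : ∀ i → + 1 / suc (m ℕ.+ i) ℚ.≤
      ∑ b (λ j → + 1 / suc (m ℕ.* b ℕ.+ (j ℕ.+ i ℕ.* b)))
    block i = subst (ℚ._≤ ∑ b (λ j → + 1 / suc (m ℕ.* b ℕ.+ (j ℕ.+ i ℕ.* b)))) (∑-block (m ℕ.+ i) b (b-1 ℕ.+ (m ℕ.+ i) ℕ.* b) refl)
      (∑-mono b λ j j<b → reciprocal-mono {m ℕ.* b ℕ.+ (j ℕ.+ i ℕ.* b)} {b-1 ℕ.+ (m ℕ.+ i) ℕ.* b}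
        (index j (ℕ.s≤s⁻¹ j<b)))
      where
      index : ∀ j → j ℕ.≤ b-1 →
        m ℕ.* b ℕ.+ (j ℕ.+ i ℕ.* b) ℕ.≤ b-1 ℕ.+ (m ℕ.+ i) ℕ.* b
      index j j≤ = ℕ.≤-trans (ℕ.≤-reflexive (trans
          (sym (ℕ.+-assoc (m ℕ.* b) j _)) (trans (cong (ℕ._+ i ℕ.* b) (ℕ.+-comm (m ℕ.* b) j))
          (trans (ℕ.+-assoc j _ _) (cong (j ℕ.+_) (sym (ℕ.*-distribʳ-+ b m i)))))))
        (ℕ.+-monoˡ-≤ ((m ℕ.+ i) ℕ.* b) j≤)

  riemannSum≤upperSum : ∀ n m b .{{_ : NonZero m}} .{{_ : NonZero b}} →
    riemannSum n (m ℕ.* b) ℚ.≤ upperSum n m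
  riemannSum≤upperSum n m@(suc m-1) b@(suc b-1) = begin
    riemannSum n (m ℕ.* b)
      ≡⟨ cong (λ k → ∑ k (λ i → + 1 / suc (m ℕ.* b ℕ.+ i))) (ℕ.*-assoc (ℕ.pred n) m b) ⟨
    ∑ (N ℕ.* b) (λ i → + 1 / suc (m ℕ.* b ℕ.+ i))
      ≡⟨ ∑-blocks N b (λ i → + 1 / suc (m ℕ.* b ℕ.+ i)) ⟩
    ∑ N (λ i → ∑ b (λ j → + 1 / suc (m ℕ.* b ℕ.+ (j ℕ.+ i ℕ.* b))))
      ≤⟨ ∑-mono N (λ i _ → block i) ⟩
    upperSum n m ∎
    where
    open ℚ.≤-Reasoning
    N = ℕ.pred n ℕ.* m
    block : ∀ i → ∑ b (λ j → + 1 / suc (m ℕ.* b ℕ.+ (j ℕ.+ i ℕ.* b))) ℚ.≤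
      + 1 / suc (m-1 ℕ.+ i)
    block i = subst (∑ b (λ j → + 1 / suc (m ℕ.* b ℕ.+ (j ℕ.+ i ℕ.* b))) ℚ.≤_) (∑-block (m-1 ℕ.+ i) b (b-1 ℕ.+ (m-1 ℕ.+ i) ℕ.* b) refl)
      (∑-mono b λ j _ → reciprocal-mono {b-1 ℕ.+ (m-1 ℕ.+ i) ℕ.* b} {m ℕ.* b ℕ.+ (j ℕ.+ i ℕ.* b)}
        (index j))
      where
      index : ∀ j → b-1 ℕ.+ (m-1 ℕ.+ i) ℕ.* b ℕ.≤ m ℕ.* b ℕ.+ (j ℕ.+ i ℕ.* b)
      index j = ℕ.≤-trans (ℕ.n≤1+n _) (ℕ.≤-trans
        (ℕ.≤-reflexive (ℕ.*-distribʳ-+ b m i))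
        (ℕ.+-monoʳ-≤ (m ℕ.* b) (ℕ.m≤n+m (i ℕ.* b) j)))

  upperSum≤ : ∀ n m-1 → upperSum n (suc m-1) ℚ.≤ riemannSum n (suc m-1) ℚ.+ + 1 / suc m-1
  upperSum≤ n m-1 = begin
    U                                       ≡⟨ ℚ.+-identityʳ U ⟨
    U ℚ.+ 0ℚ                                ≤⟨ ℚ.+-monoʳ-≤ U (ℚ.nonNegative⁻¹ (+ 1 / suc (m-1 ℕ.+ N)) {{ℚ.normalize-nonNeg 1 (suc (m-1 ℕ.+ N))}}) ⟩
    U ℚ.+ + 1 / suc (m-1 ℕ.+ N)             ≡⟨ telescope N ⟩
    riemannSum n (suc m-1) ℚ.+ + 1 / suc m-1 ∎
    where
    open ℚ.≤-Reasoning
    N = ℕ.pred n ℕ.* suc m-1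
    U = upperSum n (suc m-1)
    telescope : ∀ N →
      ∑ N (λ i → + 1 / suc (m-1 ℕ.+ i)) ℚ.+ + 1 / suc (m-1 ℕ.+ N) ≡
      ∑ N (λ i → + 1 / suc (suc m-1 ℕ.+ i)) ℚ.+ + 1 / suc m-1
    telescope zero rewrite ℕ.+-identityʳ m-1 = refl
    telescope (suc N) rewrite telescope N | ℕ.+-suc m-1 N =
      swap (∑ N (λ i → + 1 / suc (suc m-1 ℕ.+ i))) (+ 1 / suc m-1)
        (+ 1 / suc (suc (m-1 ℕ.+ N)))
      where
      swap : ∀ a b c → (a ℚ.+ b) ℚ.+ c ≡ (a ℚ.+ c) ℚ.+ b
      swap = solve 3 (λ a b c → (a :+ b) :+ c := (a :+ c) :+ b) refl
        where open +-*-Solver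

  riemannSum-close : ∀ n k l →
    riemannSum n (suc k) ℚ.≤ riemannSum n (suc l) ℚ.+ + 1 / suc l
  riemannSum-close n k l = begin
    riemannSum n (suc k)                ≤⟨ riemannSum-refine n (suc k) (suc l) ⟩
    riemannSum n (suc k ℕ.* suc l)      ≡⟨ cong (riemannSum n) (ℕ.*-comm (suc k) (suc l)) ⟩
    riemannSum n (suc l ℕ.* suc k)      ≤⟨ riemannSum≤upperSum n (suc l) (suc k) ⟩
    upperSum n (suc l)                  ≤⟨ upperSum≤ n l ⟩
    riemannSum n (suc l) ℚ.+ + 1 / suc l ∎
    where open ℚ.≤-Reasoning

  abs-≤ : ∀ p q ε → p ℚ.≤ q ℚ.+ ε → q ℚ.≤ p ℚ.+ ε → ℚ.∣ p ℚ.- q ∣ ℚ.≤ ε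
  abs-≤ p q ε p≤ q≤ with ℚ.∣p∣≡p∨∣p∣≡-p (p ℚ.- q)
  ... | inj₁ eq = subst₂ ℚ._≤_ (sym eq)
    (solve 2 (λ q ε → (q :+ ε) :- q := ε) refl q ε) (ℚ.+-monoˡ-≤ (ℚ.- q) p≤)
    where open +-*-Solver
  ... | inj₂ eq = subst₂ ℚ._≤_
    (trans (solve 2 (λ p q → q :- p := :- (p :- q)) refl p q) (sym eq))
    (solve 2 (λ p ε → (p :+ ε) :- p := ε) refl p ε) (ℚ.+-monoˡ-≤ (ℚ.- p) q≤)
    where open +-*-Solver

-- log n = ∫₁ⁿ dt/t for n ≥ 1, the limit over the meshes 1/(k+1).
-- At n = 0 the value is 0, by convention.
log : ℕ → ℝ
log n = mkℝ (λ k → riemannSum n (suc k)) cauchy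
  where
  cauchy : IsCauchy (λ k → riemannSum n (suc k))
  cauchy ε 0<ε with reciprocal-below ε 0<ε
  ... | K , 1/K≤ε = K , λ k l K≤k K≤l →
    abs-≤ (riemannSum n (suc k)) (riemannSum n (suc l)) ε (close k l K≤l) (close l k K≤k)
    where
    close : ∀ k l → K ℕ.≤ l → riemannSum n (suc k) ℚ.≤ riemannSum n (suc l) ℚ.+ ε
    close k l K≤l = ℚ.≤-trans (riemannSum-close n k l)
      (ℚ.+-monoʳ-≤ (riemannSum n (suc l)) (ℚ.≤-trans (reciprocal-mono {K} {l} K≤l) 1/K≤ε))

{-# OPTIONS --safe #-}

-- Let Q = |f(1) ⋯ f(N)|, of size about N^(dN), and let v be the p-adic valuation.  Discarding,
-- for each root t of f mod p, the n ≡ t with v(f(n)) largest gives v(Q) ≤ d v(L) + ρ v(N!), where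
-- ρ is the number of roots of f mod p (for p not dividing a discriminant-like constant).  With
-- ρ ≤ d alone this only says Q ≤ L^d N!^d, so primes with ρ < d must carry a positive part of
-- log N!.  To see this, consider the binary form F(a,b) = b^d f(a/b) on the box |a|, |b| ≤ X with
-- X² = N: it does not vanish off the origin, and p divides it on the ρ lines a ≡ t b mod p.  Such
-- a line has about 4N/p points in the box for p ≤ Y < X and, by the pigeonhole principle, more
-- than N/p for all p.  So the product R of the values of F, of size about X^(4dN) = N^(2dN),
-- controls 4ρ v(N!) for p ≤ Y and ρ v(N!) for p > Y; for p > Y the missing 3ρ v(N!) is at most
-- 3d v(N! / Y!^(N/Y)).  Altogether Q⁴ divides L^(4d) R (N! / Y!^(N/Y))^(3d) up to a factor C^N,
-- and for Y = N^(2/5) the two known factors have size N^(2dN) and N^(9dN/5), whose product is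
-- N^(19dN/5) against N^(4dN) for Q⁴.
module Submission where

open import Defs
open import Level using (0ℓ)
open import Algebra.Bundles using (Semiring; CommutativeRing)
import Algebra.Definitions.RawSemiring as RawSemiringDefinitions
import Data.Integer as ℤ
import Data.Integer.Properties as ℤ
open import Data.Nat as ℕ using (ℕ; zero; suc; z≤n; s≤s)
import Data.Nat.Properties as ℕ
import Data.Rational as ℚ
import Data.Rational.Properties as ℚ
open import Data.Empty using (⊥; ⊥-elim)
open import Data.List using (List; []; _∷_; map; foldr; applyUpTo; length)
open import Data.Product using (∃-syntax; _×_; _,_; proj₁; proj₂)
open import Data.Sum using (_⊎_; inj₁; inj₂)
open import Function using (_∘_)
open import Relation.Binary using (tri<; tri≈; tri>)
open import Relation.Binary.PropositionalEquality
import Relation.Binary.Reasoning.Setoid as SetoidReasoning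
open import Relation.Nullary using (¬_; yes; no; Dec)

-- That ρ is below d on average is classically the prime ideal theorem; here no sum over primes is
-- ever estimated. All bounds are combined into one divisibility between explicit integers, proved
-- prime by prime, and only then are sizes compared, factor by factor.
--
-- The pigeonhole count is a quarter of the expected number of points on a line, because it produces
-- only differences of points of [0, X]², while the box has four times that area. Used at every
-- prime it would give ρ v(N!) ≤ v(R) with R of size N^(2dN), which is weaker than ρ ≤ d. Counting
-- row by row recovers the factor 4 but can lose a point in each of the 2X + 1 rows. For p ≤ Y this
-- loss is paid by a power of Y! with exponent of order X, whose logarithm is O(N) as long as Y log
-- N is at most X. Hence the split at Y.
--
-- Irreducibility serves twice: it gives a nonzero D such that f has only simple roots modulo primes
-- not dividing D, and it keeps the form from vanishing off the origin, so that divisibility by p of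
-- its values can be counted.

-- Coefficients and degrees of products

module Coefficients (R : Semiring 0ℓ 0ℓ) where
  private
    module R = Semiring R
  open Polynomial R.rawSemiring
  open SetoidReasoning R.setoid

  coeff-+ : ∀ p q i → coeff (p + q) i R.≈ coeff p i R.+ coeff q i
  coeff-+ []      q       i       = R.sym (R.+-identityˡ _)
  coeff-+ (a ∷ p) []      i       = R.sym (R.+-identityʳ _)
  coeff-+ (a ∷ p) (b ∷ q) zero    = R.refl
  coeff-+ (a ∷ p) (b ∷ q) (suc i) = coeff-+ p q i

  coeff-map : ∀ c p i → coeff (map (c R.*_) p) i R.≈ c R.* coeff p i
  coeff-map c []      i       = R.sym (R.zeroʳ c)
  coeff-map c (a ∷ p) zero    = R.refl
  coeff-map c (a ∷ p) (suc i) = coeff-map c p i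

  coeff-∷-* : ∀ a p q i → coeff ((a ∷ p) * q) i R.≈ a R.* coeff q i R.+ coeff (R.0# ∷ (p * q)) i
  coeff-∷-* a p q i = R.trans (coeff-+ (map (a R.*_) q) (R.0# ∷ (p * q)) i) (R.+-congʳ (coeff-map a q i))

  coeff-map-* : ∀ c p q i → coeff (map (c R.*_) p * q) i R.≈ c R.* coeff (p * q) i
  coeff-map-* c []      q i = R.sym (R.zeroʳ c)
  coeff-map-* c (a ∷ p) q i = begin
    coeff (map (c R.*_) (a ∷ p) * q) i
      ≈⟨ coeff-∷-* (c R.* a) (map (c R.*_) p) q i ⟩
    c R.* a R.* coeff q i R.+ coeff (R.0# ∷ (map (c R.*_) p * q)) i
      ≈⟨ R.+-cong (R.*-assoc c a (coeff q i)) (shifted i) ⟩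
    c R.* (a R.* coeff q i) R.+ c R.* coeff (R.0# ∷ (p * q)) i
      ≈⟨ R.distribˡ c _ _ ⟨
    c R.* (a R.* coeff q i R.+ coeff (R.0# ∷ (p * q)) i)
      ≈⟨ R.*-congˡ (coeff-∷-* a p q i) ⟨
    c R.* coeff ((a ∷ p) * q) i ∎
    where
    shifted : ∀ i → coeff (R.0# ∷ (map (c R.*_) p * q)) i R.≈ c R.* coeff (R.0# ∷ (p * q)) i
    shifted zero    = R.sym (R.zeroʳ c)
    shifted (suc i) = coeff-map-* c p q i

  ≈0-* : ∀ p q → p ≈ [] → p * q ≈ []
  ≈0-* []      q p≈0 i = R.refl
  ≈0-* (a ∷ p) q p≈0 i = begin
    coeff ((a ∷ p) * q) i                        ≈⟨ coeff-∷-* a p q i ⟩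
    a R.* coeff q i R.+ coeff (R.0# ∷ (p * q)) i ≈⟨ R.+-cong (R.trans (R.*-congʳ (p≈0 0)) (R.zeroˡ _)) (shifted i) ⟩
    R.0# R.+ R.0#                                ≈⟨ R.+-identityˡ _ ⟩
    R.0#                                         ∎
    where
    shifted : ∀ i → coeff (R.0# ∷ (p * q)) i R.≈ R.0#
    shifted zero    = R.refl
    shifted (suc i) = ≈0-* p q (p≈0 ∘ suc) i

  ≈0-or-degree : (∀ a → Dec (a R.≈ R.0#)) → ∀ p → p ≈ [] ⊎ (∃[ d ] HasDegree p d)
  ≈0-or-degree _≟0 []      = inj₁ λ _ → R.refl
  ≈0-or-degree _≟0 (a ∷ p) with ≈0-or-degree _≟0 p
  ... | inj₂ (d , top , high) = inj₂ (suc d , top , λ { (suc i) (s≤s d<i) → high i d<i })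
  ... | inj₁ p≈0 with a ≟0
  ...   | yes a≈0 = inj₁ λ { zero → a≈0 ; (suc i) → p≈0 i }
  ...   | no  a≉0 = inj₂ (0 , a≉0 , λ { (suc i) _ → p≈0 i })

  HasDegree-* : (∀ a b → a R.* b R.≈ R.0# → a R.≈ R.0# ⊎ b R.≈ R.0#) →
    ∀ p q {d e} → HasDegree p d → HasDegree q e → HasDegree (p * q) (d ℕ.+ e)
  HasDegree-* domain [] q (top , _) _ = ⊥-elim (top R.refl)
  HasDegree-* domain (a ∷ p) q {zero} {e} (a≉0 , high) (b≉0 , qhigh) = top , λ i e<i →
    R.trans (value i) (R.trans (R.*-congˡ (qhigh i e<i)) (R.zeroʳ a))
    where
    shifted : ∀ i → coeff (R.0# ∷ (p * q)) i R.≈ R.0#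
    shifted zero    = R.refl
    shifted (suc i) = ≈0-* p q (λ j → high (suc j) (s≤s z≤n)) i
    value : ∀ i → coeff ((a ∷ p) * q) i R.≈ a R.* coeff q i
    value i = R.trans (coeff-∷-* a p q i) (R.trans (R.+-congˡ (shifted i)) (R.+-identityʳ _))
    top : ¬ coeff ((a ∷ p) * q) e R.≈ R.0#
    top eq with domain a (coeff q e) (R.trans (R.sym (value e)) eq)
    ... | inj₁ a≈0 = a≉0 a≈0
    ... | inj₂ b≈0 = b≉0 b≈0
  HasDegree-* domain (a ∷ p) q {suc d} {e} (top , high) (b≉0 , qhigh) =
    (λ eq → proj₁ rec (R.trans (R.sym (value (suc d ℕ.+ e) (s≤s (ℕ.m≤n+m e d)))) eq)) ,
    λ { (suc i) (s≤s d+e<i) → R.trans (value (suc i) (ℕ.≤-<-trans (ℕ.m≤n+m e d) (ℕ.<-trans d+e<i ℕ.≤-refl)))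
          (proj₂ rec i d+e<i) }
    where
    rec = HasDegree-* domain p q {d} {e} (top , λ i d<i → high (suc i) (s≤s d<i)) (b≉0 , qhigh)
    value : ∀ i → e ℕ.< i → coeff ((a ∷ p) * q) i R.≈ coeff (R.0# ∷ (p * q)) i
    value i e<i = R.trans (coeff-∷-* a p q i) (R.trans
      (R.+-congʳ (R.trans (R.*-congˡ (qhigh i e<i)) (R.zeroʳ a))) (R.+-identityˡ _))

module Cℤ = Coefficients ℤ.+-*-semiring
module Cℚ = Coefficients (CommutativeRing.semiring ℚ.+-*-commutativeRing)

-- Integer polynomials: divided differences, derivatives, the binary form, growth

module Polynomials where
  open import Data.Integer using (ℤ; +_; ∣_∣; _+_; _*_; _-_; _^_)
  open import Data.Integer.Divisibility.Signed
  open import Data.Integer.Tactic.RingSolver using (solve-∀)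
  open ℤ[x] using (Poly; coeff; eval; HasDegree)

  eval-+ : ∀ p q x → eval (p ℤ[x].+ q) x ≡ eval p x + eval q x
  eval-+ []      q       x = sym (ℤ.+-identityˡ _)
  eval-+ (a ∷ p) []      x = sym (ℤ.+-identityʳ _)
  eval-+ (a ∷ p) (b ∷ q) x rewrite eval-+ p q x = lem a b x (eval p x) (eval q x)
    where
    lem : ∀ a b x u v → a + b + x * (u + v) ≡ a + x * u + (b + x * v)
    lem = solve-∀

  eval-scale : ∀ c p x → eval (map (c *_) p) x ≡ c * eval p x
  eval-scale c []      x = sym (ℤ.*-zeroʳ c)
  eval-scale c (a ∷ p) x rewrite eval-scale c p x = lem a c x (eval p x)
    where
    lem : ∀ a c x u → c * a + x * (c * u) ≡ c * (a + x * u)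
    lem = solve-∀

  eval-* : ∀ p q x → eval (p ℤ[x].* q) x ≡ eval p x * eval q x
  eval-* []      q x = refl
  eval-* (a ∷ p) q x
    rewrite eval-+ (map (a *_) q) (+ 0 ∷ (p ℤ[x].* q)) x | eval-scale a q x | eval-* p q x
    = lem a x (eval p x) (eval q x)
    where
    lem : ∀ a x u v → a * v + (+ 0 + x * (u * v)) ≡ (a + x * u) * v
    lem = solve-∀

  eval-≈ : ∀ p q x → p ℤ[x].≈ q → eval p x ≡ eval q x
  eval-≈ []      []      x eq = refl
  eval-≈ []      (b ∷ q) x eq rewrite sym (eq 0) | sym (eval-≈ [] q x (eq ∘ suc)) =
    sym (trans (ℤ.+-identityˡ _) (ℤ.*-zeroʳ x))
  eval-≈ (a ∷ p) []      x eq rewrite eq 0 | eval-≈ p [] x (eq ∘ suc) =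
    trans (ℤ.+-identityˡ _) (ℤ.*-zeroʳ x)
  eval-≈ (a ∷ p) (b ∷ q) x eq = cong₂ (λ u v → u + x * v) (eq 0) (eval-≈ p q x (eq ∘ suc))

  -- Pads as well as cuts, so that the number of coefficients is exactly n: the inductions below run
  -- on the length of the list, and `form` depends on it.
  truncate : ℕ → Poly → Poly
  truncate zero    p       = []
  truncate (suc n) []      = + 0 ∷ truncate n []
  truncate (suc n) (a ∷ p) = a ∷ truncate n p

  length-truncate : ∀ n p → length (truncate n p) ≡ n
  length-truncate zero    p       = refl
  length-truncate (suc n) []      = cong suc (length-truncate n [])
  length-truncate (suc n) (a ∷ p) = cong suc (length-truncate n p)

  truncate-≈ : ∀ n p → (∀ i → n ℕ.≤ i → coeff p i ≡ + 0) → p ℤ[x].≈ truncate n p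
  truncate-≈ zero    p       high i       = high i z≤n
  truncate-≈ (suc n) []      high zero    = refl
  truncate-≈ (suc n) []      high (suc i) = truncate-≈ n [] (λ _ _ → refl) i
  truncate-≈ (suc n) (a ∷ p) high zero    = refl
  truncate-≈ (suc n) (a ∷ p) high (suc i) = truncate-≈ n p (λ j n≤j → high (suc j) (s≤s n≤j)) i

  -- The quotient of p(x) - p(r) by x - r.
  divDiff : Poly → ℤ → Poly
  divDiff []          r = []
  divDiff (c ∷ [])    r = []
  divDiff (c ∷ p@(_ ∷ _)) r = eval p r ∷ divDiff p r

  length-divDiff : ∀ c p r → length (divDiff (c ∷ p) r) ≡ length p
  length-divDiff c []      r = refl
  length-divDiff c (b ∷ p) r = cong suc (length-divDiff b p r)

  eval-divDiff : ∀ p r x → eval p x ≡ eval p r + (x - r) * eval (divDiff p r) x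
  eval-divDiff []              r x = sym (trans (ℤ.+-identityˡ _) (ℤ.*-zeroʳ (x - r)))
  eval-divDiff (c ∷ [])        r x = lem c r x
    where
    lem : ∀ c r x → c + x * + 0 ≡ c + r * + 0 + (x - r) * + 0
    lem = solve-∀
  eval-divDiff (c ∷ p@(_ ∷ _)) r x = trans (cong (λ u → c + x * u) (eval-divDiff p r x))
    (lem c r x (eval p r) (eval (divDiff p r) x))
    where
    lem : ∀ c r x u v → c + x * (u + (x - r) * v) ≡ c + r * u + (x - r) * (u + x * v)
    lem = solve-∀

  -- Repeated division thus ends at the leading coefficient of the original polynomial, a constant
  -- that does not depend on the points chosen.
  leading-divDiff : ∀ ℓ p r → length p ≡ suc (suc ℓ) → coeff (divDiff p r) ℓ ≡ coeff p (suc ℓ)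
  leading-divDiff zero    (c ∷ b ∷ [])     r _  = trans (cong (λ u → b + u) (ℤ.*-zeroʳ r)) (ℤ.+-identityʳ b)
  leading-divDiff (suc ℓ) (c ∷ p@(_ ∷ _)) r eq = leading-divDiff ℓ p r (ℕ.suc-injective eq)

  -- The product rule for c + x p.
  derivative : Poly → Poly
  derivative []      = []
  derivative (c ∷ p) = p ℤ[x].+ (+ 0 ∷ derivative p)

  eval-derivative-∷ : ∀ c p x → eval (derivative (c ∷ p)) x ≡ eval p x + x * eval (derivative p) x
  eval-derivative-∷ c p x = trans (eval-+ p (+ 0 ∷ derivative p) x) (cong (λ u → eval p x + u) (ℤ.+-identityˡ _))

  -- The product rule for p(r) + (x - r) q, where q = `divDiff p r`.
  eval-derivative-divDiff : ∀ p r x → eval (derivative p) x ≡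
    eval (divDiff p r) x + (x - r) * eval (derivative (divDiff p r)) x
  eval-derivative-divDiff []              r x = sym (trans (ℤ.+-identityˡ _) (ℤ.*-zeroʳ (x - r)))
  eval-derivative-divDiff (c ∷ [])        r x = lem r x
    where
    lem : ∀ r x → + 0 + x * + 0 ≡ + 0 + (x - r) * + 0
    lem = solve-∀
  eval-derivative-divDiff (c ∷ p@(b ∷ _)) r x = begin
    eval (derivative (c ∷ p)) x
      ≡⟨ eval-derivative-∷ c p x ⟩
    eval p x + x * eval (derivative p) x
      ≡⟨ cong₂ (λ u v → u + x * v) (eval-divDiff p r x) (eval-derivative-divDiff p r x) ⟩
    eval p r + (x - r) * eval q x + x * (eval q x + (x - r) * eval (derivative q) x)
      ≡⟨ lem r x (eval p r) (eval q x) (eval (derivative q) x) ⟩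
    eval p r + x * eval q x + (x - r) * (eval q x + x * eval (derivative q) x)
      ≡⟨ cong (λ u → eval p r + x * eval q x + (x - r) * u) (sym (eval-derivative-∷ (eval p r) q x)) ⟩
    eval (eval p r ∷ q) x + (x - r) * eval (derivative (eval p r ∷ q)) x ∎
    where
    open ≡-Reasoning
    q = divDiff p r
    lem : ∀ r x u v w → u + (x - r) * v + x * (v + (x - r) * w) ≡ u + x * v + (x - r) * (v + x * w)
    lem = solve-∀

  coeff-derivative : ∀ p i → coeff (derivative p) i ≡ + suc i * coeff p (suc i)
  coeff-derivative []      i       = sym (ℤ.*-zeroʳ (+ suc i))
  coeff-derivative (c ∷ p) zero    = trans (Cℤ.coeff-+ p (+ 0 ∷ derivative p) 0) (trans (ℤ.+-identityʳ _) (sym (ℤ.*-identityˡ _)))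
  coeff-derivative (c ∷ p) (suc i) = trans (Cℤ.coeff-+ p (+ 0 ∷ derivative p) (suc i)) (trans
    (cong (λ u → coeff p (suc i) + u) (coeff-derivative p i)) (sym (ℤ.suc-* (+ suc i) (coeff p (suc i)))))

  HasDegree-derivative : ∀ p d → HasDegree p (suc d) → HasDegree (derivative p) d
  HasDegree-derivative p d (top , high) =
    (λ eq → top (ℤ.*-cancelˡ-≡ (+ suc d) _ _ (trans (sym (coeff-derivative p d))
      (trans eq (sym (ℤ.*-zeroʳ (+ suc d))))))) ,
    λ i d<i → trans (coeff-derivative p i) (trans (cong (+ suc i *_) (high (suc i) (s≤s d<i))) (ℤ.*-zeroʳ (+ suc i)))

  -- For a list of length d + 1, the binary form b^d p(a / b).
  form : Poly → ℤ → ℤ → ℤ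
  form []      a b = + 0
  form (c ∷ p) a b = c * b ^ length p + a * form p a b

  -- Modulo a - t b one may put a = t b, and F(t b, b) = b^d p(t). The extra factor b is there
  -- because `length p` is d + 1.
  form-root : ∀ p t a b → (a - t * b) ∣ b * form p a b - b ^ length p * eval p t
  form-root []      t a b = subst (a - t * b ∣_) (sym (lem b)) (divides (+ 0) refl)
    where
    lem : ∀ b → b * + 0 - + 1 * + 0 ≡ + 0
    lem = solve-∀
  form-root (c ∷ p) t a b = subst (a - t * b ∣_) (sym (lem a b c t (form p a b) (b ^ length p) (eval p t)))
    (∣m∣n⇒∣m+n (∣n⇒∣m*n a (form-root p t a b)) (∣m⇒∣m*n _ ∣-refl))
    where
    lem : ∀ a b c t h k e → b * (c * k + a * h) - (b * k) * (c + t * e) ≡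
      a * (b * h - k * e) + (a - t * b) * (k * e)
    lem = solve-∀

  form-eval : ∀ p t → form p t (+ 1) ≡ eval p t
  form-eval []      t = refl
  form-eval (c ∷ p) t = cong₂ (λ u w → u + t * w)
    (trans (cong (c *_) (ℤ.^-zeroˡ (length p))) (ℤ.*-identityʳ c)) (form-eval p t)

  -- At b = 0 only the leading term survives: F(a, 0) is the top coefficient times a^ℓ.
  form-b≡0 : ∀ ℓ p a → length p ≡ suc ℓ → coeff p ℓ ≢ + 0 → a ≢ + 0 → form p a (+ 0) ≢ + 0
  form-b≡0 zero    (c ∷ [])         a _  c≢0 a≢0 eq = c≢0 (trans (sym (lem c a)) eq)
    where
    lem : ∀ c a → c * + 1 + a * + 0 ≡ c
    lem = solve-∀
  form-b≡0 (suc ℓ) (c ∷ p@(_ ∷ _)) a eq top a≢0 f≡0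
    with ℤ.i*j≡0⇒i≡0∨j≡0 a (trans (sym (trans (cong (_+ a * form p a (+ 0)) (ℤ.*-zeroʳ c)) (ℤ.+-identityˡ _))) f≡0)
  ... | inj₁ a≡0 = a≢0 a≡0
  ... | inj₂ h≡0 = form-b≡0 ℓ p a (ℕ.suc-injective eq) top a≢0 h≡0

  ^-∣-^ : ∀ {m b} k → m ∣ b → m ^ k ∣ b ^ k
  ^-∣-^ zero    m∣b = ∣-refl
  ^-∣-^ {m} {b} (suc k) m∣b = ∣-trans (*-monoʳ-∣ m (^-∣-^ k m∣b)) (*-monoˡ-∣ (b ^ k) m∣b)

  -- Homogeneity of degree ℓ. It pays for the points with both coordinates divisible by p, which lie
  -- on all the lines at once.
  form-∣ : ∀ ℓ p {a b m} → length p ≡ suc ℓ → m ∣ a → m ∣ b → m ^ ℓ ∣ form p a b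
  form-∣ zero    p {a} {b}       eq m∣a m∣b = divides (form p a b) (sym (ℤ.*-identityʳ (form p a b)))
  form-∣ (suc ℓ) (c ∷ p@(_ ∷ _)) {a} {b} {m} eq m∣a m∣b = ∣m∣n⇒∣m+n
    (∣n⇒∣m*n c (subst (λ k → m ^ suc ℓ ∣ b ^ k) (sym (ℕ.suc-injective eq)) (^-∣-^ (suc ℓ) m∣b)))
    (∣-trans (*-monoʳ-∣ m (form-∣ ℓ p (ℕ.suc-injective eq) m∣a m∣b)) (*-monoˡ-∣ (form p a b) m∣a))

  height : Poly → ℕ
  height []      = 0
  height (c ∷ p) = ∣ c ∣ ℕ.+ height p

  ∣i^k∣ : ∀ i k → ∣ i ^ k ∣ ≡ ∣ i ∣ ℕ.^ k
  ∣i^k∣ i zero    = refl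
  ∣i^k∣ i (suc k) = trans (ℤ.abs-* i (i ^ k)) (cong (∣ i ∣ ℕ.*_) (∣i^k∣ i k))

  ∣form∣≤ : ∀ ℓ p a b X → length p ≡ suc ℓ → ∣ a ∣ ℕ.≤ X → ∣ b ∣ ℕ.≤ X →
            ∣ form p a b ∣ ℕ.≤ height p ℕ.* X ℕ.^ ℓ
  ∣form∣≤ ℓ (c ∷ p) a b X eq a≤ b≤ = begin
    ∣ c * b ^ length p + a * form p a b ∣
      ≤⟨ ℤ.∣i+j∣≤∣i∣+∣j∣ (c * b ^ length p) (a * form p a b) ⟩
    ∣ c * b ^ length p ∣ ℕ.+ ∣ a * form p a b ∣
      ≤⟨ ℕ.+-mono-≤ left (right ℓ p eq) ⟩
    ∣ c ∣ ℕ.* X ℕ.^ ℓ ℕ.+ height p ℕ.* X ℕ.^ ℓ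
      ≡⟨ ℕ.*-distribʳ-+ (X ℕ.^ ℓ) ∣ c ∣ (height p) ⟨
    (∣ c ∣ ℕ.+ height p) ℕ.* X ℕ.^ ℓ ∎
    where
    open ℕ.≤-Reasoning
    left : ∣ c * b ^ length p ∣ ℕ.≤ ∣ c ∣ ℕ.* X ℕ.^ ℓ
    left rewrite ℤ.abs-* c (b ^ length p) | ∣i^k∣ b (length p) | ℕ.suc-injective eq =
      ℕ.*-monoʳ-≤ ∣ c ∣ (ℕ.^-monoˡ-≤ ℓ b≤)
    right : ∀ ℓ p → length (c ∷ p) ≡ suc ℓ → ∣ a * form p a b ∣ ℕ.≤ height p ℕ.* X ℕ.^ ℓ
    right zero    []              _  rewrite ℤ.*-zeroʳ a = z≤n
    right (suc ℓ) p@(_ ∷ _) eq = begin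
      ∣ a * form p a b ∣                ≡⟨ ℤ.abs-* a (form p a b) ⟩
      ∣ a ∣ ℕ.* ∣ form p a b ∣          ≤⟨ ℕ.*-mono-≤ a≤ (∣form∣≤ ℓ p a b X (ℕ.suc-injective eq) a≤ b≤) ⟩
      X ℕ.* (height p ℕ.* X ℕ.^ ℓ)      ≡⟨ ℕ.*-assoc X (height p) (X ℕ.^ ℓ) ⟨
      X ℕ.* height p ℕ.* X ℕ.^ ℓ        ≡⟨ cong (ℕ._* X ℕ.^ ℓ) (ℕ.*-comm X (height p)) ⟩
      height p ℕ.* X ℕ.* X ℕ.^ ℓ        ≡⟨ ℕ.*-assoc (height p) X (X ℕ.^ ℓ) ⟩
      height p ℕ.* (X ℕ.* X ℕ.^ ℓ)      ∎

  -- For c + x p the bound for p gives n^(ℓ+1) ≤ K (|c + n p(n)| + |c|). Doubling K and taking n ≥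
  -- 2K|c| absorbs the term K|c| into half of the left side.
  eventually-growth : ∀ ℓ p → length p ≡ suc ℓ → coeff p ℓ ≢ + 0 →
    ∃[ K ] ∃[ n₀ ] (∀ n → n₀ ℕ.≤ n → n ℕ.^ ℓ ℕ.≤ K ℕ.* ∣ eval p (+ n) ∣)
  eventually-growth zero (c ∷ []) _ c≢0 = 1 , 0 , λ n _ → ℕ.≤-trans
    (ℕ.n≢0⇒n>0 λ eq → c≢0 (trans (sym (trans (cong (λ u → c + u) (ℤ.*-zeroʳ (+ n))) (ℤ.+-identityʳ c))) (ℤ.∣i∣≡0⇒i≡0 eq)))
    (ℕ.≤-reflexive (sym (ℕ.*-identityˡ _)))
  eventually-growth (suc ℓ) (c ∷ p@(_ ∷ _)) eq top with eventually-growth ℓ p (ℕ.suc-injective eq) top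
  ... | K , n₀ , grow = 2 ℕ.* K , suc (n₀ ℕ.+ 2 ℕ.* K ℕ.* ∣ c ∣) , bound
    where
    bound : ∀ n → suc (n₀ ℕ.+ 2 ℕ.* K ℕ.* ∣ c ∣) ℕ.≤ n → n ℕ.^ suc ℓ ℕ.≤ 2 ℕ.* K ℕ.* ∣ c + + n * eval p (+ n) ∣
    bound n@(suc _) n≥ = ℕ.+-cancelʳ-≤ (n ℕ.^ suc ℓ) _ _ (begin
      n ℕ.^ suc ℓ ℕ.+ n ℕ.^ suc ℓ
        ≤⟨ ℕ.+-mono-≤ step step ⟩
      K ℕ.* (F ℕ.+ ∣ c ∣) ℕ.+ K ℕ.* (F ℕ.+ ∣ c ∣)
        ≡⟨ lem K F ∣ c ∣ ⟩
      2 ℕ.* K ℕ.* F ℕ.+ 2 ℕ.* K ℕ.* ∣ c ∣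
        ≤⟨ ℕ.+-monoʳ-≤ (2 ℕ.* K ℕ.* F) small ⟩
      2 ℕ.* K ℕ.* F ℕ.+ n ℕ.^ suc ℓ ∎)
      where
      open ℕ.≤-Reasoning
      F = ∣ c + + n * eval p (+ n) ∣
      lem : ∀ K F c → K ℕ.* (F ℕ.+ c) ℕ.+ K ℕ.* (F ℕ.+ c) ≡ 2 ℕ.* K ℕ.* F ℕ.+ 2 ℕ.* K ℕ.* c
      lem K F c = trans (cong (λ u → K ℕ.* (F ℕ.+ c) ℕ.+ u) (sym (ℕ.+-identityʳ _)))
        (trans (sym (ℕ.*-assoc 2 K (F ℕ.+ c))) (ℕ.*-distribˡ-+ (2 ℕ.* K) F c))
      small : 2 ℕ.* K ℕ.* ∣ c ∣ ℕ.≤ n ℕ.^ suc ℓ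
      small = ℕ.≤-trans (ℕ.≤-trans (ℕ.m≤n+m _ (suc n₀)) n≥) (ℕ.m≤m*n n (n ℕ.^ ℓ) {{ℕ.m^n≢0 n ℓ}})
      tail≤ : n ℕ.* ∣ eval p (+ n) ∣ ℕ.≤ F ℕ.+ ∣ c ∣
      tail≤ = subst (ℕ._≤ F ℕ.+ ∣ c ∣) (trans (cong ∣_∣ (cancel c (+ n * eval p (+ n)))) (ℤ.abs-* (+ n) (eval p (+ n))))
        (ℤ.∣i-j∣≤∣i∣+∣j∣ (c + + n * eval p (+ n)) c)
        where
        cancel : ∀ c u → c + u - c ≡ u
        cancel = solve-∀
      step : n ℕ.^ suc ℓ ℕ.≤ K ℕ.* (F ℕ.+ ∣ c ∣)
      step = begin
        n ℕ.* n ℕ.^ ℓ                        ≤⟨ ℕ.*-monoʳ-≤ n (grow n (ℕ.≤-trans (ℕ.m≤m+n n₀ _) (ℕ.≤-trans (ℕ.n≤1+n _) n≥))) ⟩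
        n ℕ.* (K ℕ.* ∣ eval p (+ n) ∣)       ≡⟨ ℕ.*-assoc n K _ ⟨
        n ℕ.* K ℕ.* ∣ eval p (+ n) ∣         ≡⟨ cong (ℕ._* ∣ eval p (+ n) ∣) (ℕ.*-comm n K) ⟩
        K ℕ.* n ℕ.* ∣ eval p (+ n) ∣         ≡⟨ ℕ.*-assoc K n _ ⟩
        K ℕ.* (n ℕ.* ∣ eval p (+ n) ∣)       ≤⟨ ℕ.*-monoʳ-≤ K tail≤ ⟩
        K ℕ.* (F ℕ.+ ∣ c ∣)                  ∎

  -- Below the threshold n₀ the values are at least 1 in size, so adding n₀^ℓ to the constant covers
  -- these n.
  growth : ∀ ℓ p → length p ≡ suc ℓ → coeff p ℓ ≢ + 0 → (∀ n → eval p (+ suc n) ≢ + 0) →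
    ∃[ K ] (∀ n → suc n ℕ.^ ℓ ℕ.≤ K ℕ.* ∣ eval p (+ suc n) ∣)
  growth ℓ p eq top nz with eventually-growth ℓ p eq top
  ... | K , n₀ , grow = K ℕ.+ n₀ ℕ.^ ℓ , bound
    where
    bound : ∀ n → suc n ℕ.^ ℓ ℕ.≤ (K ℕ.+ n₀ ℕ.^ ℓ) ℕ.* ∣ eval p (+ suc n) ∣
    bound n with n₀ ℕ.≤? suc n
    ... | yes n₀≤ = ℕ.≤-trans (grow (suc n) n₀≤) (ℕ.*-monoˡ-≤ _ (ℕ.m≤m+n K (n₀ ℕ.^ ℓ)))
    ... | no  n₀≰ = ℕ.≤-trans (ℕ.^-monoˡ-≤ ℓ (ℕ.<⇒≤ (ℕ.≰⇒> n₀≰)))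
      (ℕ.≤-trans (ℕ.m≤n+m (n₀ ℕ.^ ℓ) K) (ℕ.m≤m*n (K ℕ.+ n₀ ℕ.^ ℓ) _ {{ℕ.≢-nonZero (nz n ∘ ℤ.∣i∣≡0⇒i≡0)}}))

-- Irreducibility over ℚ and resultants

module Resultants where
  open import Algebra.Definitions.RawMagma using (_,_)
  open import Data.Integer using (ℤ; +_; ∣_∣)
  open import Data.Integer.Divisibility.Signed
  open import Data.Integer.Tactic.RingSolver using (solve-∀)
  import Data.Nat.Divisibility as ℕ
  open import Data.Nat.Induction using (<-rec)
  open import Data.Rational using (ℚ; 0ℚ; 1ℚ; _/_)
  open import Data.Rational.Unnormalised as ℚᵘ using (mkℚᵘ; *≡*)
  import Data.Rational.Unnormalised.Properties as ℚᵘ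
  open Polynomials

  ι : ℤ → ℚ
  ι z = z / 1

  toℚᵘ-/ : ∀ z d → ℚ.toℚᵘ (z / suc d) ℚᵘ.≃ mkℚᵘ z d
  toℚᵘ-/ z d = ℚ.toℚᵘ-fromℚᵘ (mkℚᵘ z d)

  toℚᵘ-ι : ∀ z → ℚ.toℚᵘ (ι z) ℚᵘ.≃ mkℚᵘ z 0
  toℚᵘ-ι z = toℚᵘ-/ z 0

  ι-+ : ∀ a b → ι (a ℤ.+ b) ≡ ι a ℚ.+ ι b
  ι-+ a b = ℚ.toℚᵘ-injective (ℚᵘ.≃-trans (toℚᵘ-ι (a ℤ.+ b)) (ℚᵘ.≃-trans (*≡* (lem a b))
    (ℚᵘ.≃-sym (ℚᵘ.≃-trans (ℚ.toℚᵘ-homo-+ (ι a) (ι b)) (ℚᵘ.+-cong (toℚᵘ-ι a) (toℚᵘ-ι b))))))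
    where
    lem : ∀ a b → (a ℤ.+ b) ℤ.* + 1 ≡ (a ℤ.* + 1 ℤ.+ b ℤ.* + 1) ℤ.* + 1
    lem = solve-∀

  ι-* : ∀ a b → ι (a ℤ.* b) ≡ ι a ℚ.* ι b
  ι-* a b = ℚ.toℚᵘ-injective (ℚᵘ.≃-trans (toℚᵘ-ι (a ℤ.* b)) (ℚᵘ.≃-trans (*≡* refl)
    (ℚᵘ.≃-sym (ℚᵘ.≃-trans (ℚ.toℚᵘ-homo-* (ι a) (ι b)) (ℚᵘ.*-cong (toℚᵘ-ι a) (toℚᵘ-ι b))))))

  ι-injective : ∀ {a b} → ι a ≡ ι b → a ≡ b
  ι-injective {a} {b} eq with ℚᵘ.≃-trans (ℚᵘ.≃-sym (toℚᵘ-ι a)) (ℚᵘ.≃-trans (ℚᵘ.≃-reflexive (cong ℚ.toℚᵘ eq)) (toℚᵘ-ι b))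
  ... | *≡* e = trans (sym (ℤ.*-identityʳ a)) (trans e (ℤ.*-identityʳ b))

  coeff-ι : ∀ p i → ℚ[x].coeff (map ι p) i ≡ ι (ℤ[x].coeff p i)
  coeff-ι []      i       = refl
  coeff-ι (a ∷ p) zero    = refl
  coeff-ι (a ∷ p) (suc i) = coeff-ι p i

  coeff-ι-* : ∀ p q i → ℚ[x].coeff (map ι p ℚ[x].* map ι q) i ≡ ι (ℤ[x].coeff (p ℤ[x].* q) i)
  coeff-ι-* []      q i = refl
  coeff-ι-* (a ∷ p) q i = begin
    ℚ[x].coeff (map ι (a ∷ p) ℚ[x].* map ι q) i
      ≡⟨ Cℚ.coeff-∷-* (ι a) (map ι p) (map ι q) i ⟩
    ι a ℚ.* ℚ[x].coeff (map ι q) i ℚ.+ ℚ[x].coeff (0ℚ ∷ (map ι p ℚ[x].* map ι q)) i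
      ≡⟨ cong₂ ℚ._+_ (trans (cong (ι a ℚ.*_) (coeff-ι q i)) (sym (ι-* a _))) (shifted i) ⟩
    ι (a ℤ.* ℤ[x].coeff q i) ℚ.+ ι (ℤ[x].coeff (+ 0 ∷ (p ℤ[x].* q)) i)
      ≡⟨ ι-+ (a ℤ.* ℤ[x].coeff q i) _ ⟨
    ι (a ℤ.* ℤ[x].coeff q i ℤ.+ ℤ[x].coeff (+ 0 ∷ (p ℤ[x].* q)) i)
      ≡⟨ cong ι (sym (Cℤ.coeff-∷-* a p q i)) ⟩
    ι (ℤ[x].coeff ((a ∷ p) ℤ[x].* q) i) ∎
    where
    open ≡-Reasoning
    shifted : ∀ i → ℚ[x].coeff (0ℚ ∷ (map ι p ℚ[x].* map ι q)) i ≡ ι (ℤ[x].coeff (+ 0 ∷ (p ℤ[x].* q)) i)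
    shifted zero    = refl
    shifted (suc i) = coeff-ι-* p q i

  domainℚ : ∀ a b → a ℚ.* b ≡ 0ℚ → a ≡ 0ℚ ⊎ b ≡ 0ℚ
  domainℚ a b ab≡0 with a ℚ.≟ 0ℚ
  ... | yes a≡0 = inj₁ a≡0
  ... | no  a≢0 = inj₂ (begin
    b                     ≡⟨ ℚ.*-identityˡ b ⟨
    1ℚ ℚ.* b              ≡⟨ cong (ℚ._* b) (ℚ.*-inverseˡ a) ⟨
    ℚ.1/ a ℚ.* a ℚ.* b    ≡⟨ ℚ.*-assoc (ℚ.1/ a) a b ⟩
    ℚ.1/ a ℚ.* (a ℚ.* b)  ≡⟨ cong (ℚ.1/ a ℚ.*_) ab≡0 ⟩
    ℚ.1/ a ℚ.* 0ℚ         ≡⟨ ℚ.*-zeroʳ (ℚ.1/ a) ⟩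
    0ℚ                    ∎)
    where
    open ≡-Reasoning
    instance
      a-nonZero : ℚ.NonZero a
      a-nonZero = ℚ.≢-nonZero a≢0

  HasDegree-unique : ∀ p {d e} → ℚ[x].HasDegree p d → ℚ[x].HasDegree p e → d ≡ e
  HasDegree-unique p {d} {e} (dtop , dhigh) (etop , ehigh) with ℕ.<-cmp d e
  ... | tri< d<e _ _ = ⊥-elim (etop (dhigh e d<e))
  ... | tri≈ _ d≡e _ = d≡e
  ... | tri> _ _ e<d = ⊥-elim (dtop (ehigh d e<d))


  module ℚ[x]ᵈ = RawSemiringDefinitions ℚ[x].rawSemiring

  unit⇒degree≡0 : ∀ p {d} → ℚ[x].HasDegree p d → p ℚ[x]ᵈ.∣ (1ℚ ∷ []) → d ≡ 0
  unit⇒degree≡0 p {d} deg (w , w*p≈1) with Cℚ.≈0-or-degree (ℚ._≟ 0ℚ) w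
  ... | inj₁ w≈0 = ⊥-elim (1≢0 (trans (sym (w*p≈1 0)) (Cℚ.≈0-* w p w≈0 0)))
    where
    1≢0 : 1ℚ ≢ 0ℚ
    1≢0 ()
  ... | inj₂ (e , wdeg) = ℕ.m+n≡0⇒n≡0 e (ℕ.n≤0⇒n≡0 (ℕ.≮⇒≥ λ 0<e+d →
      proj₁ prod (trans (w*p≈1 (e ℕ.+ d)) (constant (e ℕ.+ d) 0<e+d))))
    where
    prod : ℚ[x].HasDegree (w ℚ[x].* p) (e ℕ.+ d)
    prod = Cℚ.HasDegree-* domainℚ w p wdeg deg
    constant : ∀ i → 0 ℕ.< i → ℚ[x].coeff (1ℚ ∷ []) i ≡ 0ℚ
    constant (suc i) _ = refl

  -- The factorisation clause of irreducibility, isolated because it passes to any list with the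
  -- same coefficients.
  SplitsTrivially : ℤ[x].Poly → Set
  SplitsTrivially f = ∀ {x y} → map ι f ℚ[x].≈ (x ℚ[x].* y) → x ℚ[x]ᵈ.∣ (1ℚ ∷ []) ⊎ y ℚ[x]ᵈ.∣ (1ℚ ∷ [])

  HasDegree-ι : ∀ p {d} → ℤ[x].HasDegree p d → ℚ[x].HasDegree (map ι p) d
  HasDegree-ι p (top , high) = (λ eq → top (ι-injective (trans (sym (coeff-ι p _)) eq))) ,
    λ i d<i → trans (coeff-ι p i) (cong ι (high i d<i))

  -- Over ℚ the relation c f = q g reads f = (q / c) g. A unit has degree 0, so neither factor is
  -- one: g has positive degree, and q / c must make up the difference to d.
  no-proper-factor : ∀ f d → ℤ[x].HasDegree f d → SplitsTrivially f →
    ∀ g e → ℤ[x].HasDegree g (suc e) → suc e ℕ.< d → ∀ c q → c ≢ + 0 →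
    ¬ (∀ i → c ℤ.* ℤ[x].coeff f i ≡ ℤ[x].coeff (q ℤ[x].* g) i)
  no-proper-factor f d fdeg split g e gdeg e<d c q c≢0 eq = absurd (Cℚ.≈0-or-degree (ℚ._≟ 0ℚ) x)
    where
    open ≡-Reasoning
    instance
      ιc-nonZero : ℚ.NonZero (ι c)
      ιc-nonZero = ℚ.≢-nonZero λ ιc≡0 → c≢0 (ι-injective ιc≡0)
    s = ℚ.1/ ι c
    x = map (s ℚ.*_) (map ι q)
    y = map ι g
    f≈xy : map ι f ℚ[x].≈ (x ℚ[x].* y)
    f≈xy i = begin
      ℚ[x].coeff (map ι f) i                         ≡⟨ coeff-ι f i ⟩
      ι (ℤ[x].coeff f i)                             ≡⟨ ℚ.*-identityˡ _ ⟨
      1ℚ ℚ.* ι (ℤ[x].coeff f i)                      ≡⟨ cong (ℚ._* ι (ℤ[x].coeff f i)) (ℚ.*-inverseˡ (ι c)) ⟨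
      s ℚ.* ι c ℚ.* ι (ℤ[x].coeff f i)               ≡⟨ ℚ.*-assoc s (ι c) _ ⟩
      s ℚ.* (ι c ℚ.* ι (ℤ[x].coeff f i))             ≡⟨ cong (s ℚ.*_) (trans (sym (ι-* c _)) (cong ι (eq i))) ⟩
      s ℚ.* ι (ℤ[x].coeff (q ℤ[x].* g) i)            ≡⟨ cong (s ℚ.*_) (coeff-ι-* q g i) ⟨
      s ℚ.* ℚ[x].coeff (map ι q ℚ[x].* y) i          ≡⟨ Cℚ.coeff-map-* s (map ι q) y i ⟨
      ℚ[x].coeff (x ℚ[x].* y) i                      ∎
    ydeg : ℚ[x].HasDegree y (suc e)
    ydeg = HasDegree-ι g gdeg
    absurd : x ℚ[x].≈ [] ⊎ (∃[ k ] ℚ[x].HasDegree x k) → ⊥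
    absurd (inj₁ x≈0) = proj₁ (HasDegree-ι f fdeg) (trans (f≈xy d) (Cℚ.≈0-* x y x≈0 d))
    absurd (inj₂ (k , xdeg)) with split f≈xy
    ... | inj₁ x∣1 = ℕ.<⇒≢ e<d (sym (trans degrees (cong (ℕ._+ suc e) (unit⇒degree≡0 x xdeg x∣1))))
      where
      fℚdeg : ℚ[x].HasDegree (x ℚ[x].* y) d
      fℚdeg = (λ z → proj₁ (HasDegree-ι f fdeg) (trans (f≈xy d) z)) ,
              λ i d<i → trans (sym (f≈xy i)) (proj₂ (HasDegree-ι f fdeg) i d<i)
      degrees : d ≡ k ℕ.+ suc e
      degrees = HasDegree-unique (x ℚ[x].* y) fℚdeg (Cℚ.HasDegree-* domainℚ x y xdeg ydeg)
    ... | inj₂ y∣1 = ℕ.1+n≢0 (unit⇒degree≡0 y ydeg y∣1)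

  -- As in Horner's scheme, the coefficients of the dividend are taken from the top down. From c p =
  -- q g + h follows c (a + x p) = x q g + (c a + x h), where c a + x h may reach the degree of g.
  -- Scaling by the leading coefficient b of g and subtracting t g, with t the coefficient of c a +
  -- x h in that degree, restores the bound.
  pseudoDivide : ∀ p g e → ℤ[x].HasDegree g (suc e) →
    ∃[ c ] ∃[ q ] ∃[ h ] (c ≢ + 0 × (∀ i → suc e ℕ.≤ i → ℤ[x].coeff h i ≡ + 0) ×
      (∀ i → c ℤ.* ℤ[x].coeff p i ≡ ℤ[x].coeff (q ℤ[x].* g) i ℤ.+ ℤ[x].coeff h i))
  pseudoDivide []      g e gdeg = + 1 , [] , [] , (λ ()) , (λ _ _ → refl) , λ _ → refl
  pseudoDivide (a ∷ p) g e (top , ghigh) with pseudoDivide p g e (top , ghigh)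
  ... | c , q , h , c≢0 , hhigh , eq = b ℤ.* c , q′ , h′ , b*c≢0 , h′high , eq′
    where
    open ≡-Reasoning
    b = ℤ[x].coeff g (suc e)
    t = ℤ[x].coeff h e
    q′ = t ∷ map (b ℤ.*_) q
    h₀ = (c ℤ.* a) ∷ h
    h′ = map (b ℤ.*_) h₀ ℤ[x].+ map ((ℤ.- t) ℤ.*_) g
    b*c≢0 : b ℤ.* c ≢ + 0
    b*c≢0 bc≡0 with ℤ.i*j≡0⇒i≡0∨j≡0 b bc≡0
    ... | inj₁ b≡0 = top b≡0
    ... | inj₂ c≡0 = c≢0 c≡0
    coeff-h′ : ∀ i → ℤ[x].coeff h′ i ≡ b ℤ.* ℤ[x].coeff h₀ i ℤ.+ (ℤ.- t) ℤ.* ℤ[x].coeff g i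
    coeff-h′ i = trans (Cℤ.coeff-+ (map (b ℤ.*_) h₀) (map ((ℤ.- t) ℤ.*_) g) i) (cong₂ ℤ._+_ (Cℤ.coeff-map b h₀ i) (Cℤ.coeff-map (ℤ.- t) g i))
    h′high : ∀ i → suc e ℕ.≤ i → ℤ[x].coeff h′ i ≡ + 0
    h′high (suc i) e≤i with ℕ.m≤n⇒m<n∨m≡n (ℕ.s≤s⁻¹ e≤i)
    ... | inj₂ refl = trans (coeff-h′ (suc e)) (lem b t)
      where
      lem : ∀ b t → b ℤ.* t ℤ.+ (ℤ.- t) ℤ.* b ≡ + 0
      lem = solve-∀
    ... | inj₁ e<i = trans (coeff-h′ (suc i)) (trans (cong₂ (λ u w → b ℤ.* u ℤ.+ (ℤ.- t) ℤ.* w)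
        (hhigh i e<i) (ghigh (suc i) (s≤s e<i))) (lem b t))
      where
      lem : ∀ b t → b ℤ.* + 0 ℤ.+ (ℤ.- t) ℤ.* + 0 ≡ + 0
      lem = solve-∀
    eq′ : ∀ i → b ℤ.* c ℤ.* ℤ[x].coeff (a ∷ p) i ≡ ℤ[x].coeff (q′ ℤ[x].* g) i ℤ.+ ℤ[x].coeff h′ i
    eq′ i = begin
      b ℤ.* c ℤ.* ℤ[x].coeff (a ∷ p) i
        ≡⟨ main i ⟩
      t ℤ.* ℤ[x].coeff g i ℤ.+ ℤ[x].coeff (+ 0 ∷ (map (b ℤ.*_) q ℤ[x].* g)) i ℤ.+
        (b ℤ.* ℤ[x].coeff h₀ i ℤ.+ (ℤ.- t) ℤ.* ℤ[x].coeff g i)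
        ≡⟨ cong₂ ℤ._+_ (sym (Cℤ.coeff-∷-* t (map (b ℤ.*_) q) g i)) (sym (coeff-h′ i)) ⟩
      ℤ[x].coeff (q′ ℤ[x].* g) i ℤ.+ ℤ[x].coeff h′ i ∎
      where
      main : ∀ i → b ℤ.* c ℤ.* ℤ[x].coeff (a ∷ p) i ≡
        t ℤ.* ℤ[x].coeff g i ℤ.+ ℤ[x].coeff (+ 0 ∷ (map (b ℤ.*_) q ℤ[x].* g)) i ℤ.+
        (b ℤ.* ℤ[x].coeff h₀ i ℤ.+ (ℤ.- t) ℤ.* ℤ[x].coeff g i)
      main zero = lem a b c t (ℤ[x].coeff g 0)
        where
        lem : ∀ a b c t u → b ℤ.* c ℤ.* a ≡ t ℤ.* u ℤ.+ + 0 ℤ.+ (b ℤ.* (c ℤ.* a) ℤ.+ (ℤ.- t) ℤ.* u)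
        lem = solve-∀
      main (suc i) = begin
        b ℤ.* c ℤ.* ℤ[x].coeff p i     ≡⟨ ℤ.*-assoc b c _ ⟩
        b ℤ.* (c ℤ.* ℤ[x].coeff p i)   ≡⟨ cong (b ℤ.*_) (eq i) ⟩
        b ℤ.* (w ℤ.+ v)                ≡⟨ lem b t w v (ℤ[x].coeff g (suc i)) ⟩
        t ℤ.* ℤ[x].coeff g (suc i) ℤ.+ b ℤ.* w ℤ.+ (b ℤ.* v ℤ.+ (ℤ.- t) ℤ.* ℤ[x].coeff g (suc i))
          ≡⟨ cong (λ u → t ℤ.* ℤ[x].coeff g (suc i) ℤ.+ u ℤ.+ (b ℤ.* v ℤ.+ (ℤ.- t) ℤ.* ℤ[x].coeff g (suc i)))
               (sym (Cℤ.coeff-map-* b q g i)) ⟩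
        _ ∎
        where
        w = ℤ[x].coeff (q ℤ[x].* g) i
        v = ℤ[x].coeff h i
        lem : ∀ b t w v u → b ℤ.* (w ℤ.+ v) ≡ t ℤ.* u ℤ.+ b ℤ.* w ℤ.+ (b ℤ.* v ℤ.+ (ℤ.- t) ℤ.* u)
        lem = solve-∀

  -- Euclid's algorithm with pseudo-division; a zero remainder would give a proper factor of f.
  resultant : ∀ f d → ℤ[x].HasDegree f d → SplitsTrivially f →
    ∀ e g → ℤ[x].HasDegree g e → e ℕ.< d →
    ∃[ D ] (D ≢ + 0 × (∀ m r → m ∣ ℤ[x].eval f r → m ∣ ℤ[x].eval g r → m ∣ D))
  resultant f d fdeg split = <-rec _ step
    where
    Claim : ℕ → Set
    Claim e = ∀ g → ℤ[x].HasDegree g e → e ℕ.< d →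
      ∃[ D ] (D ≢ + 0 × (∀ m r → m ∣ ℤ[x].eval f r → m ∣ ℤ[x].eval g r → m ∣ D))
    step : ∀ e → (∀ {e′} → e′ ℕ.< e → Claim e′) → Claim e
    step zero    rec g (top , high) _ = ℤ[x].coeff g 0 , top , λ m r _ m∣g → subst (m ∣_)
      (trans (eval-≈ g (truncate 1 g) r (truncate-≈ 1 g high)) (constant g r)) m∣g
      where
      constant : ∀ g r → ℤ[x].eval (truncate 1 g) r ≡ ℤ[x].coeff g 0
      constant []      r = trans (ℤ.+-identityˡ _) (ℤ.*-zeroʳ r)
      constant (a ∷ g) r = trans (cong (λ u → a ℤ.+ u) (ℤ.*-zeroʳ r)) (ℤ.+-identityʳ a)
    step (suc e) rec g gdeg e<d with pseudoDivide f g e gdeg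
    ... | c , q , h , c≢0 , hhigh , eq with Cℤ.≈0-or-degree (ℤ._≟ + 0) h
    ...   | inj₁ h≈0 = ⊥-elim (no-proper-factor f d fdeg split g e gdeg e<d c q c≢0 λ i →
              trans (eq i) (trans (cong (λ u → ℤ[x].coeff (q ℤ[x].* g) i ℤ.+ u) (h≈0 i)) (ℤ.+-identityʳ _)))
    ...   | inj₂ (e′ , hdeg) = proj₁ IH , proj₁ (proj₂ IH) , λ m r m∣f m∣g →
              proj₂ (proj₂ IH) m r m∣f (∣m+n∣m⇒∣n (subst (m ∣_) (value r) (∣n⇒∣m*n c m∣f))
                (subst (m ∣_) (sym (eval-* q g r)) (∣n⇒∣m*n (ℤ[x].eval q r) m∣g)))
      where
      e′<e : e′ ℕ.< suc e
      e′<e = ℕ.≰⇒> λ e<e′ → proj₁ hdeg (hhigh e′ e<e′)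
      IH = rec e′<e h hdeg (ℕ.<-trans e′<e e<d)
      value : ∀ r → c ℤ.* ℤ[x].eval f r ≡ ℤ[x].eval (q ℤ[x].* g) r ℤ.+ ℤ[x].eval h r
      value r = trans (sym (eval-scale c f r)) (trans
        (eval-≈ (map (c ℤ.*_) f) ((q ℤ[x].* g) ℤ[x].+ h) r λ i →
          trans (Cℤ.coeff-map c f i) (trans (eq i) (sym (Cℤ.coeff-+ (q ℤ[x].* g) h i))))
        (eval-+ (q ℤ[x].* g) h r))

  separability : ∀ f d → ℤ[x].HasDegree f d → 1 ℕ.≤ d → SplitsTrivially f →
    ∃[ D ] (D ≢ + 0 × (∀ m r → m ∣ ℤ[x].eval f r → m ∣ ℤ[x].eval (derivative f) r → m ∣ D))
  separability f (suc d) fdeg _ split =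
    resultant f (suc d) fdeg split d (derivative f) (HasDegree-derivative f d fdeg) ℕ.≤-refl

  -- A zero with b ≠ 0 makes a / b a root of f. Since d ≥ 2, `resultant` applies to f and a - b x
  -- and bounds every modulus at which both vanish at a common integer; but a / b yields such an
  -- integer for every modulus prime to b.
  form-nonzero : ∀ f d → ℤ[x].HasDegree f d → 2 ℕ.≤ d → SplitsTrivially f → length f ≡ suc d →
    ∀ a b → a ≢ + 0 ⊎ b ≢ + 0 → form f a b ≢ + 0
  form-nonzero f d fdeg 2≤d split len a b nz F≡0 with b ℤ.≟ + 0
  ... | yes refl with nz
  ...   | inj₁ a≢0 = form-b≡0 d f a len (proj₁ fdeg) a≢0 F≡0
  ...   | inj₂ b≢0 = b≢0 refl
  form-nonzero f d fdeg 2≤d split len a b nz F≡0 | no b≢0 = contradiction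
    where
    g : ℤ[x].Poly
    g = a ∷ (ℤ.- b) ∷ []
    gdeg : ℤ[x].HasDegree g 1
    gdeg = (λ -b≡0 → b≢0 (ℤ.neg-injective -b≡0)) , λ { (suc (suc i)) _ → refl ; (suc zero) (s≤s ()) }
    res = resultant f d fdeg split 1 g gdeg 2≤d
    D = proj₁ res
    -- A modulus coprime to b and larger than D; mod m, the root a / b of f is r.
    s = + ∣ D ∣ ℤ.* b
    m = + 1 ℤ.+ s ℤ.* b
    r = (ℤ.- s) ℤ.* a
    m∣a-rb : m ∣ a ℤ.- r ℤ.* b
    m∣a-rb = subst (m ∣_) (lem a b s) (∣n⇒∣m*n a ∣-refl)
      where
      lem : ∀ a b s → a ℤ.* (+ 1 ℤ.+ s ℤ.* b) ≡ a ℤ.- (ℤ.- s) ℤ.* a ℤ.* b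
      lem = solve-∀
    -- Modulo m = 1 + s b the inverse of b is -s.
    cancel-b : ∀ k x → m ∣ b ℤ.^ k ℤ.* x → m ∣ x
    cancel-b zero    x m∣ = subst (m ∣_) (ℤ.*-identityˡ x) m∣
    cancel-b (suc k) x m∣ = cancel-b k x (subst (m ∣_) (lem b s (b ℤ.^ k) x)
      (∣m∣n⇒∣m-n (∣m⇒∣m*n (b ℤ.^ k ℤ.* x) (∣-refl {m})) (∣n⇒∣m*n s m∣)))
      where
      lem : ∀ b s u x → (+ 1 ℤ.+ s ℤ.* b) ℤ.* (u ℤ.* x) ℤ.- s ℤ.* (b ℤ.* u ℤ.* x) ≡ u ℤ.* x
      lem = solve-∀
    m∣f : m ∣ ℤ[x].eval f r
    m∣f = cancel-b (length f) _ (subst (m ∣_) (lem (b ℤ.^ length f ℤ.* ℤ[x].eval f r))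
      (∣m⇒∣-m (subst (λ u → m ∣ u ℤ.- b ℤ.^ length f ℤ.* ℤ[x].eval f r)
        (trans (cong (b ℤ.*_) F≡0) (ℤ.*-zeroʳ b)) (∣-trans m∣a-rb (form-root f r a b)))))
      where
      lem : ∀ u → ℤ.- (+ 0 ℤ.- u) ≡ u
      lem = solve-∀
    m∣g : m ∣ ℤ[x].eval g r
    m∣g = subst (m ∣_) (lem a b r) m∣a-rb
      where
      lem : ∀ a b r → a ℤ.- r ℤ.* b ≡ a ℤ.+ r ℤ.* ((ℤ.- b) ℤ.+ r ℤ.* + 0)
      lem = solve-∀
    m∣D : ∣ m ∣ ℕ.∣ ∣ D ∣
    m∣D = ∣⇒∣ᵤ (proj₂ (proj₂ res) m r m∣f m∣g)
    ∣m∣ : ∣ m ∣ ≡ suc (∣ D ∣ ℕ.* (∣ b ∣ ℕ.* ∣ b ∣))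
    ∣m∣ = cong ∣_∣ (trans (cong (λ u → + 1 ℤ.+ u) (trans (ℤ.*-assoc (+ ∣ D ∣) b b) (trans (cong (+ ∣ D ∣ ℤ.*_) (square b)) (sym (ℤ.pos-* ∣ D ∣ (∣ b ∣ ℕ.* ∣ b ∣))))))
      refl)
      where
      square : ∀ b → b ℤ.* b ≡ + (∣ b ∣ ℕ.* ∣ b ∣)
      square (+ n)      = sym (ℤ.pos-* n n)
      square ℤ.-[1+ n ] = refl
    contradiction : ⊥
    contradiction = ℕ.<⇒≱ {∣ D ∣} {∣ m ∣} (subst (∣ D ∣ ℕ.<_) (sym ∣m∣) (s≤s (ℕ.m≤m*n ∣ D ∣ (∣ b ∣ ℕ.* ∣ b ∣) {{b²≢0}})))
      (ℕ.∣⇒≤ {{D≢0}} m∣D)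
      where
      D≢0 : ℕ.NonZero ∣ D ∣
      D≢0 = ℕ.≢-nonZero λ eq → proj₁ (proj₂ res) (ℤ.∣i∣≡0⇒i≡0 eq)
      ∣b∣≢0 : ℕ.NonZero ∣ b ∣
      ∣b∣≢0 = ℕ.≢-nonZero λ eq → b≢0 (ℤ.∣i∣≡0⇒i≡0 eq)
      b²≢0 : ℕ.NonZero (∣ b ∣ ℕ.* ∣ b ∣)
      b²≢0 = ℕ.m*n≢0 ∣ b ∣ ∣ b ∣ {{∣b∣≢0}} {{∣b∣≢0}}

-- Dyadic bounds for the logarithm

module Logarithms where
  open import Data.Integer using (+_)
  open import Data.Nat.Tactic.RingSolver using (solve-∀)
  open import Data.Rational using (ℚ; 0ℚ; 1ℚ; ½; _/_)
  open import Data.Rational.Solver using (module +-*-Solver)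
  open import Data.Rational.Unnormalised as ℚᵘ using (mkℚᵘ; *≡*; *≤*)
  import Data.Rational.Unnormalised.Properties as ℚᵘ
  open Resultants using (ι; ι-+; ι-*; toℚᵘ-/)

  /-mono-≤ : ∀ a b c d → mkℚᵘ a c ℚᵘ.≤ mkℚᵘ b d → a / suc c ℚ.≤ b / suc d
  /-mono-≤ a b c d le = ℚ.toℚᵘ-cancel-≤ (ℚᵘ.≤-respˡ-≃ (ℚᵘ.≃-sym (toℚᵘ-/ a c)) (ℚᵘ.≤-respʳ-≃ (ℚᵘ.≃-sym (toℚᵘ-/ b d)) le))

  ιₙ : ℕ → ℚ
  ιₙ n = ι (+ n)

  ιₙ-mono : ∀ {m n} → m ℕ.≤ n → ιₙ m ℚ.≤ ιₙ n
  ιₙ-mono {m} {n} m≤n = /-mono-≤ (+ m) (+ n) 0 0 (*≤* (ℤ.*-monoʳ-≤-nonNeg (+ 1) (ℤ.+≤+ m≤n)))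

  0≤ιₙ : ∀ n → 0ℚ ℚ.≤ ιₙ n
  0≤ιₙ n = ιₙ-mono {0} {n} z≤n

  ιₙ-* : ∀ m n → ιₙ (m ℕ.* n) ≡ ιₙ m ℚ.* ιₙ n
  ιₙ-* m n = trans (cong ι (ℤ.pos-* m n)) (ι-* (+ m) (+ n))

  ιₙ-suc : ∀ n → ιₙ (suc n) ≡ ιₙ n ℚ.+ 1ℚ
  ιₙ-suc n = trans (cong ιₙ (ℕ.+-comm 1 n)) (ι-+ (+ n) (+ 1))

  reciprocal-antimono : ∀ {m n} → m ℕ.≤ n → + 1 / suc n ℚ.≤ + 1 / suc m
  reciprocal-antimono {m} {n} m≤n = /-mono-≤ (+ 1) (+ 1) n m (*≤* (ℤ.*-monoˡ-≤-nonNeg (+ 1) (ℤ.+≤+ (s≤s m≤n))))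

  0≤reciprocal : ∀ n → 0ℚ ℚ.≤ + 1 / suc n
  0≤reciprocal n = /-mono-≤ (+ 0) (+ 1) 0 n (*≤* (ℤ.+≤+ z≤n))

  ιₙ-reciprocal : ∀ n → ιₙ (suc n) ℚ.* (+ 1 / suc n) ≡ 1ℚ
  ιₙ-reciprocal n = ℚ.toℚᵘ-injective (ℚᵘ.≃-trans (ℚ.toℚᵘ-homo-* (ιₙ (suc n)) (+ 1 / suc n))
    (ℚᵘ.≃-trans (ℚᵘ.*-cong (toℚᵘ-/ (+ suc n) 0) (toℚᵘ-/ (+ 1) n)) (*≡* eq)))
    where
    eq : (+ suc n ℤ.* + 1) ℤ.* + 1 ≡ + 1 ℤ.* + suc (n ℕ.+ 0)
    eq = cong (+_ ∘ suc) (trans (cong (ℕ._* 1) (ℕ.*-identityʳ n)) (trans (ℕ.*-identityʳ n) (sym (trans (ℕ.+-identityʳ _) (ℕ.+-identityʳ n)))))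

  ∑-mono-≤ : ∀ n {g h} → (∀ i → i ℕ.< n → g i ℚ.≤ h i) → ∑ n g ℚ.≤ ∑ n h
  ∑-mono-≤ zero    g≤h = ℚ.≤-refl
  ∑-mono-≤ (suc n) g≤h = ℚ.+-mono-≤ (∑-mono-≤ n λ i i<n → g≤h i (ℕ.m<n⇒m<1+n i<n)) (g≤h n ℕ.≤-refl)

  ∑-split : ∀ m n g → ∑ (m ℕ.+ n) g ≡ ∑ m g ℚ.+ ∑ n (λ i → g (m ℕ.+ i))
  ∑-split m zero    g = trans (cong (λ k → ∑ k g) (ℕ.+-identityʳ m)) (sym (ℚ.+-identityʳ _))
  ∑-split m (suc n) g = trans (cong (λ k → ∑ k g) (ℕ.+-suc m n))
    (trans (cong (ℚ._+ g (m ℕ.+ n)) (∑-split m n g)) (ℚ.+-assoc (∑ m g) _ _))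

  ∑-constant : ∀ n q → ∑ n (λ _ → q) ≡ ιₙ n ℚ.* q
  ∑-constant zero    q = sym (ℚ.*-zeroˡ q)
  ∑-constant (suc n) q = trans (cong (ℚ._+ q) (∑-constant n q))
    (sym (trans (cong (ℚ._* q) (ιₙ-suc n)) (trans (ℚ.*-distribʳ-+ q (ιₙ n) 1ℚ) (cong (ιₙ n ℚ.* q ℚ.+_) (ℚ.*-identityˡ q)))))

  0≤∑ : ∀ n {g} → (∀ i → 0ℚ ℚ.≤ g i) → 0ℚ ℚ.≤ ∑ n g
  0≤∑ n {g} nonneg = ℚ.≤-trans (ℚ.≤-reflexive (sym (trans (∑-constant n 0ℚ) (ℚ.*-zeroʳ (ιₙ n))))) (∑-mono-≤ n λ i _ → nonneg i)

  riemannSum-mono : ∀ {n n′} m → n ℕ.≤ n′ → riemannSum n m ℚ.≤ riemannSum n′ m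
  riemannSum-mono {n} {n′} m n≤n′ = begin
    ∑ a g                                         ≡⟨ ℚ.+-identityʳ _ ⟨
    ∑ a g ℚ.+ 0ℚ                                  ≤⟨ ℚ.+-monoʳ-≤ (∑ a g) (0≤∑ (b ℕ.∸ a) λ i → 0≤reciprocal (m ℕ.+ (a ℕ.+ i))) ⟩
    ∑ a g ℚ.+ ∑ (b ℕ.∸ a) (λ i → g (a ℕ.+ i))     ≡⟨ ∑-split a (b ℕ.∸ a) g ⟨
    ∑ (a ℕ.+ (b ℕ.∸ a)) g                         ≡⟨ cong (λ k → ∑ k g) (ℕ.m+[n∸m]≡n (ℕ.*-monoˡ-≤ m (ℕ.pred-mono-≤ n≤n′))) ⟩
    ∑ b g                                         ∎
    where
    open ℚ.≤-Reasoning
    a = ℕ.pred n ℕ.* m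
    b = ℕ.pred n′ ℕ.* m
    g : ℕ → ℚ
    g i = + 1 / suc (m ℕ.+ i)

  -- The part of the sum over [B/m, 2B/m], where B = 2^s m.
  dyadicBlock : ℕ → ℚ
  dyadicBlock B = ∑ B (λ i → + 1 / suc (B ℕ.+ i))

  dyadicBlock≤1 : ∀ b → dyadicBlock (suc b) ℚ.≤ 1ℚ
  dyadicBlock≤1 b = begin
    dyadicBlock (suc b)                ≤⟨ ∑-mono-≤ (suc b) (λ i _ → reciprocal-antimono {b} {suc b ℕ.+ i} (ℕ.≤-trans (ℕ.n≤1+n b) (ℕ.m≤m+n (suc b) i))) ⟩
    ∑ (suc b) (λ _ → + 1 / suc b)      ≡⟨ ∑-constant (suc b) (+ 1 / suc b) ⟩
    ιₙ (suc b) ℚ.* (+ 1 / suc b)       ≡⟨ ιₙ-reciprocal b ⟩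
    1ℚ                                 ∎
    where open ℚ.≤-Reasoning

  ½≤dyadicBlock : ∀ b → ½ ℚ.≤ dyadicBlock (suc b)
  ½≤dyadicBlock b = begin
    ½                                            ≡⟨ ℚ.*-identityʳ ½ ⟨
    ½ ℚ.* 1ℚ                                     ≡⟨ cong (½ ℚ.*_) (ιₙ-reciprocal (b ℕ.+ suc b)) ⟨
    ½ ℚ.* (ιₙ (suc b ℕ.+ suc b) ℚ.* r)           ≡⟨ cong (λ u → ½ ℚ.* (u ℚ.* r)) (ι-+ (+ suc b) (+ suc b)) ⟩
    ½ ℚ.* ((ιₙ (suc b) ℚ.+ ιₙ (suc b)) ℚ.* r)    ≡⟨ lem (ιₙ (suc b)) r ⟩
    ιₙ (suc b) ℚ.* r                             ≡⟨ ∑-constant (suc b) r ⟨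
    ∑ (suc b) (λ _ → r)                          ≤⟨ ∑-mono-≤ (suc b) (λ i i<B → reciprocal-antimono {suc b ℕ.+ i} {b ℕ.+ suc b}
                                                      (ℕ.≤-trans (ℕ.≤-reflexive (sym (ℕ.+-suc b i))) (ℕ.+-monoʳ-≤ b i<B))) ⟩
    dyadicBlock (suc b)                          ∎
    where
    open ℚ.≤-Reasoning
    r = + 1 / suc (b ℕ.+ suc b)
    lem : ∀ x r → ½ ℚ.* ((x ℚ.+ x) ℚ.* r) ≡ x ℚ.* r
    lem = solve 2 (λ x r → con ½ :* ((x :+ x) :* r) := x :* r) refl
      where open +-*-Solver

  riemannSum-2^suc : ∀ s m-1 → let m = suc m-1 in
    riemannSum (2 ℕ.^ suc s) m ≡ riemannSum (2 ℕ.^ s) m ℚ.+ dyadicBlock (2 ℕ.^ s ℕ.* m)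
  riemannSum-2^suc s m-1 = begin
    ∑ (ℕ.pred (2 ℕ.^ suc s) ℕ.* m) g
      ≡⟨ cong (λ k → ∑ k g) size ⟩
    ∑ (ℕ.pred (2 ℕ.^ s) ℕ.* m ℕ.+ B) g
      ≡⟨ ∑-split (ℕ.pred (2 ℕ.^ s) ℕ.* m) B g ⟩
    riemannSum (2 ℕ.^ s) m ℚ.+ ∑ B (λ i → g (ℕ.pred (2 ℕ.^ s) ℕ.* m ℕ.+ i))
      ≡⟨ cong (riemannSum (2 ℕ.^ s) m ℚ.+_) (∑-cong B λ i → cong (λ k → + 1 / suc k) (index i)) ⟩
    riemannSum (2 ℕ.^ s) m ℚ.+ dyadicBlock B ∎
    where
    open ≡-Reasoning
    m = suc m-1
    B = 2 ℕ.^ s ℕ.* m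
    g : ℕ → ℚ
    g i = + 1 / suc (m ℕ.+ i)
    ∑-cong : ∀ n {g h} → (∀ i → g i ≡ h i) → ∑ n g ≡ ∑ n h
    ∑-cong zero    eq = refl
    ∑-cong (suc n) eq = cong₂ ℚ._+_ (∑-cong n eq) (eq n)
    suc-pred : suc (ℕ.pred (2 ℕ.^ s)) ≡ 2 ℕ.^ s
    suc-pred = ℕ.suc-pred (2 ℕ.^ s) {{ℕ.m^n≢0 2 s}}
    size : ℕ.pred (2 ℕ.^ suc s) ℕ.* m ≡ ℕ.pred (2 ℕ.^ s) ℕ.* m ℕ.+ B
    size = trans (cong (λ k → ℕ.pred (2 ℕ.* k) ℕ.* m) (sym suc-pred))
      (trans (lem (ℕ.pred (2 ℕ.^ s)) m) (cong (λ k → ℕ.pred (2 ℕ.^ s) ℕ.* m ℕ.+ k ℕ.* m) suc-pred))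
      where
      lem : ∀ a m → (a ℕ.+ suc (a ℕ.+ 0)) ℕ.* m ≡ a ℕ.* m ℕ.+ suc a ℕ.* m
      lem = solve-∀
    index : ∀ i → m ℕ.+ (ℕ.pred (2 ℕ.^ s) ℕ.* m ℕ.+ i) ≡ B ℕ.+ i
    index i = trans (sym (ℕ.+-assoc m _ i)) (cong (λ k → k ℕ.* m ℕ.+ i) suc-pred)

  dyadicBlock-bounds : ∀ s m-1 → ½ ℚ.≤ dyadicBlock (2 ℕ.^ s ℕ.* suc m-1) × dyadicBlock (2 ℕ.^ s ℕ.* suc m-1) ℚ.≤ 1ℚ
  dyadicBlock-bounds s m-1 = subst (λ B → ½ ℚ.≤ dyadicBlock B × dyadicBlock B ℚ.≤ 1ℚ)
    (ℕ.suc-pred (2 ℕ.^ s ℕ.* suc m-1) {{ℕ.m*n≢0 (2 ℕ.^ s) (suc m-1) {{ℕ.m^n≢0 2 s}}}})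
    (½≤dyadicBlock (ℕ.pred B) , dyadicBlock≤1 (ℕ.pred B))
    where B = 2 ℕ.^ s ℕ.* suc m-1

  -- Doubling the argument adds one block of size between 1/2 and 1, so at every mesh the sum for
  -- 2^s lies between s / 2 and s. The loss against s log 2 only affects c.
  riemannSum-2^≤ : ∀ s m-1 → riemannSum (2 ℕ.^ s) (suc m-1) ℚ.≤ ιₙ s
  riemannSum-2^≤ zero    m-1 = ℚ.≤-refl
  riemannSum-2^≤ (suc s) m-1 = ℚ.≤-trans (ℚ.≤-reflexive (riemannSum-2^suc s m-1))
    (ℚ.≤-trans (ℚ.+-mono-≤ (riemannSum-2^≤ s m-1) (proj₂ (dyadicBlock-bounds s m-1))) (ℚ.≤-reflexive (sym (ιₙ-suc s))))

  riemannSum-2^≥ : ∀ s m-1 → ιₙ s ℚ.* ½ ℚ.≤ riemannSum (2 ℕ.^ s) (suc m-1)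
  riemannSum-2^≥ zero    m-1 = ℚ.≤-refl
  riemannSum-2^≥ (suc s) m-1 = ℚ.≤-trans
    (ℚ.≤-reflexive (trans (cong (ℚ._* ½) (ιₙ-suc s)) (ℚ.*-distribʳ-+ ½ (ιₙ s) 1ℚ)))
    (ℚ.≤-trans (ℚ.+-mono-≤ (riemannSum-2^≥ s m-1) (proj₁ (dyadicBlock-bounds s m-1))) (ℚ.≤-reflexive (sym (riemannSum-2^suc s m-1))))

  unitFraction : ℕ → ℝ
  unitFraction P = fromℚ (+ 1 / suc P)

  -- If N < 2^t and 2^s ≤ L, then N log N ≤ N t and log L ≥ s / 2.
  log-comparison : ∀ P N L s t → 2 ℕ.^ s ℕ.≤ L → N ℕ.≤ 2 ℕ.^ t → N ℕ.* t ℕ.* 2 ℕ.≤ suc P ℕ.* s →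
    unitFraction P *ℝ fromℕ N *ℝ log N ≤ℝ log L
  log-comparison P N L s t 2^s≤L N≤2^t Nt≤ ε 0<ε = 0 , λ k _ → begin
    c ℚ.* ιₙ N ℚ.* riemannSum N (suc k)
      ≤⟨ ℚ.*-monoˡ-≤-nonNeg (c ℚ.* ιₙ N) {{c*N≥0}} (ℚ.≤-trans (riemannSum-mono (suc k) N≤2^t) (riemannSum-2^≤ t k)) ⟩
    c ℚ.* ιₙ N ℚ.* ιₙ t
      ≡⟨ lem₁ c (ιₙ N) (ιₙ t) ⟩
    c ℚ.* (ιₙ N ℚ.* ιₙ t ℚ.* ιₙ 2) ℚ.* ½
      ≡⟨ cong (λ u → c ℚ.* u ℚ.* ½) (sym (trans (ιₙ-* (N ℕ.* t) 2) (cong (ℚ._* ιₙ 2) (ιₙ-* N t)))) ⟩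
    c ℚ.* ιₙ (N ℕ.* t ℕ.* 2) ℚ.* ½
      ≤⟨ ℚ.*-monoʳ-≤-nonNeg ½ (ℚ.*-monoˡ-≤-nonNeg c {{ℚ.nonNegative (0≤reciprocal P)}} (ιₙ-mono {N ℕ.* t ℕ.* 2} {suc P ℕ.* s} Nt≤)) ⟩
    c ℚ.* ιₙ (suc P ℕ.* s) ℚ.* ½
      ≡⟨ cong (λ u → c ℚ.* u ℚ.* ½) (ιₙ-* (suc P) s) ⟩
    c ℚ.* (ιₙ (suc P) ℚ.* ιₙ s) ℚ.* ½
      ≡⟨ lem₂ c (ιₙ (suc P)) (ιₙ s) ⟩
    ιₙ (suc P) ℚ.* c ℚ.* (ιₙ s ℚ.* ½)
      ≡⟨ trans (cong (ℚ._* (ιₙ s ℚ.* ½)) (ιₙ-reciprocal P)) (ℚ.*-identityˡ _) ⟩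
    ιₙ s ℚ.* ½
      ≤⟨ ℚ.≤-trans (riemannSum-2^≥ s k) (riemannSum-mono (suc k) 2^s≤L) ⟩
    riemannSum L (suc k)
      ≡⟨ ℚ.+-identityʳ _ ⟨
    riemannSum L (suc k) ℚ.+ 0ℚ
      ≤⟨ ℚ.+-monoʳ-≤ (riemannSum L (suc k)) (ℚ.<⇒≤ 0<ε) ⟩
    riemannSum L (suc k) ℚ.+ ε ∎
    where
    open ℚ.≤-Reasoning
    c = + 1 / suc P
    c*N≥0 : ℚ.NonNegative (c ℚ.* ιₙ N)
    c*N≥0 = ℚ.nonNegative (subst (ℚ._≤ c ℚ.* ιₙ N) (ℚ.*-zeroʳ c)
      (ℚ.*-monoˡ-≤-nonNeg c {{ℚ.nonNegative (0≤reciprocal P)}} (0≤ιₙ N)))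
    lem₁ : ∀ c n t → c ℚ.* n ℚ.* t ≡ c ℚ.* (n ℚ.* t ℚ.* ιₙ 2) ℚ.* ½
    lem₁ = solve 3 (λ c n t → c :* n :* t := c :* (n :* t :* con (ιₙ 2)) :* con ½) refl
      where open +-*-Solver
    lem₂ : ∀ c p s → c ℚ.* (p ℚ.* s) ℚ.* ½ ≡ p ℚ.* c ℚ.* (s ℚ.* ½)
    lem₂ = solve 3 (λ c p s → c :* (p :* s) :* con ½ := p :* c :* (s :* con ½)) refl
      where open +-*-Solver

  0<reciprocal : ∀ P → 0ℝ <ℝ unitFraction P
  0<reciprocal P = c , ℚ.positive⁻¹ c {{ℚ.normalize-pos 1 (suc P)}} , 0 , λ _ _ → ℚ.≤-reflexive (ℚ.+-identityˡ c)
    where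
    c = + 1 / suc P

open import Data.Bool using (Bool; true; false; if_then_else_)
import Data.Integer.DivMod as ℤ
import Data.Integer.Divisibility.Signed as ℤ
import Data.Integer.Tactic.RingSolver as ℤ-Solver
open import Data.List.Relation.Unary.All as All using (All; []; _∷_)
open import Data.List.Relation.Unary.AllPairs using (AllPairs; []; _∷_)
open import Data.Nat
open import Data.Nat.Combinatorics using (k![n∸k]!∣n!)
open import Data.Nat.Divisibility
open import Data.Nat.DivMod
open import Data.Nat.GCD using (gcd)
open import Data.Nat.Induction using (<-rec)
open import Data.Nat.LCM using (lcm; m∣lcm[m,n]; n∣lcm[m,n]; gcd*lcm)
open import Data.Nat.ListAction using (sum; product)
open import Data.Nat.Primality using (Prime; euclidsLemma; prime⇒nonZero; prime⇒nonTrivial; productOfPrimes≢0)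
open import Data.Nat.Primality.Factorisation using (factorise; module PrimeFactorisation)
open import Data.Nat.Properties
open import Data.Nat.Tactic.RingSolver using (solve-∀)
open Polynomials
open Resultants using (ι; coeff-ι; SplitsTrivially; separability; form-nonzero)
open Logarithms
open ℤ[x] using (Poly; coeff; eval)

-- The p-adic valuation

n<2^n : ∀ n → n < 2 ^ n
n<2^n zero    = s≤s z≤n
n<2^n (suc n) = begin-strict
  suc n          <⟨ s≤s (n<2^n n) ⟩
  1 + 2 ^ n      ≤⟨ +-monoˡ-≤ (2 ^ n) (m^n>0 2 n) ⟩
  2 ^ n + 2 ^ n  ≡⟨ cong (2 ^ n +_) (sym (+-identityʳ (2 ^ n))) ⟩
  2 ^ suc n      ∎
  where open ≤-Reasoning

module Valuation (p : ℕ) (p-prime : Prime p) where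

  instance
    p≢0 : NonZero p
    p≢0 = prime⇒nonZero p-prime

  2≤p : 2 ≤ p
  2≤p = nonTrivial⇒n>1 p {{prime⇒nonTrivial p-prime}}

  p∤1 : ¬ p ∣ 1
  p∤1 p∣1 = <⇒≱ 2≤p (∣⇒≤ p∣1)

  -- The valuation truncated at K, so that it is meaningful at 0, too.
  vₖ : ℕ → ℕ → ℕ
  vₖ zero    n = 0
  vₖ (suc K) n with p ∣? n
  ... | yes (divides q _) = suc (vₖ K q)
  ... | no  _             = 0

  vₖ≤K : ∀ K n → vₖ K n ≤ K
  vₖ≤K zero    n = z≤n
  vₖ≤K (suc K) n with p ∣? n
  ... | yes (divides q _) = s≤s (vₖ≤K K q)
  ... | no  _             = z≤n

  p^vₖ∣n : ∀ K n → p ^ vₖ K n ∣ n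
  p^vₖ∣n zero    n = 1∣ n
  p^vₖ∣n (suc K) n with p ∣? n
  ... | yes (divides q refl) = subst (_∣ q * p) (*-comm (p ^ vₖ K q) p) (*-monoˡ-∣ p (p^vₖ∣n K q))
  ... | no  _                = 1∣ n

  vₖ-max : ∀ {K k n} → k ≤ K → p ^ k ∣ n → k ≤ vₖ K n
  vₖ-max {K} {zero} _ _ = z≤n
  vₖ-max {suc K} {suc k} {n} (s≤s k≤K) d with p ∣? n
  ... | yes (divides q refl) = s≤s (vₖ-max k≤K (*-cancelˡ-∣ p (subst (p ^ suc k ∣_) (*-comm q p) d)))
  ... | no  p∤n              = ⊥-elim (p∤n (∣-trans (m∣m*n (p ^ k)) d))

  p^k∣m*n-split : ∀ k m n → p ^ k ∣ m * n → ∃[ i ] ∃[ j ] (i + j ≡ k × p ^ i ∣ m × p ^ j ∣ n)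
  p^k∣m*n-split zero    m n _ = 0 , 0 , refl , 1∣ m , 1∣ n
  p^k∣m*n-split (suc k) m n d with euclidsLemma m n p-prime (∣-trans (m∣m*n (p ^ k)) d)
  ... | inj₁ (divides q refl) with p^k∣m*n-split k q n (*-cancelˡ-∣ p (subst (p ^ suc k ∣_)
            (trans (cong (_* n) (*-comm q p)) (*-assoc p q n)) d))
  ...   | i , j , refl , a , b = suc i , j , refl , subst (p ^ suc i ∣_) (*-comm p q) (*-monoʳ-∣ p a) , b
  p^k∣m*n-split (suc k) m n d | inj₂ (divides q refl) with p^k∣m*n-split k m q (*-cancelˡ-∣ p (subst (p ^ suc k ∣_)
            (trans (cong (m *_) (*-comm q p)) (trans (sym (*-assoc m p q)) (trans (cong (_* q) (*-comm m p)) (*-assoc p m q)))) d))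
  ...   | i , j , refl , a , b = i , suc j , +-suc i j , a , subst (p ^ suc j ∣_) (*-comm p q) (*-monoʳ-∣ p b)

  -- Truncation spoils equality, but the exponent dividing m n splits between m and n, and neither
  -- part exceeds K.
  vₖ-* : ∀ K m n → vₖ K (m * n) ≤ vₖ K m + vₖ K n
  vₖ-* K m n with p^k∣m*n-split (vₖ K (m * n)) m n (p^vₖ∣n K (m * n))
  ... | i , j , eq , a , b = subst (_≤ vₖ K m + vₖ K n) eq (+-mono-≤
        (vₖ-max (≤-trans (m≤m+n i j) (≤-trans (≤-reflexive eq) (vₖ≤K K (m * n)))) a)
        (vₖ-max (≤-trans (m≤n+m j i) (≤-trans (≤-reflexive eq) (vₖ≤K K (m * n)))) b))

  p^-mono-∣ : ∀ {i j} → i ≤ j → p ^ i ∣ p ^ j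
  p^-mono-∣ {i} {j} i≤j = divides (p ^ (j ∸ i))
    (trans (cong (p ^_) (sym (m∸n+n≡m i≤j))) (^-distribˡ-+-* p (j ∸ i) i))

  -- Truncating at n itself loses nothing for n ≠ 0, since p^k ∣ n gives k < p^k ≤ n. At 0 the value
  -- is 0.
  v : ℕ → ℕ
  v n = vₖ n n

  k<p^k : ∀ k → k < p ^ k
  k<p^k k = <-≤-trans (n<2^n k) (^-monoˡ-≤ k 2≤p)

  v-max : ∀ {k n} .{{_ : NonZero n}} → p ^ k ∣ n → k ≤ v n
  v-max {k} d = vₖ-max (≤-trans (<⇒≤ (k<p^k k)) (∣⇒≤ d)) d

  p^v∣n : ∀ n → p ^ v n ∣ n
  p^v∣n n = p^vₖ∣n n n

  vₖ≤v : ∀ K n .{{_ : NonZero n}} → vₖ K n ≤ v n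
  vₖ≤v K n = v-max (p^vₖ∣n K n)

  v≤vₖ : ∀ K n → v n ≤ K → v n ≤ vₖ K n
  v≤vₖ K n le = vₖ-max le (p^v∣n n)

  v-mono : ∀ {m n} .{{_ : NonZero n}} → m ∣ n → v m ≤ v n
  v-mono {m} m∣n = v-max (∣-trans (p^v∣n m) m∣n)

  v≤n : ∀ n → v n ≤ n
  v≤n n = vₖ≤K n n

  v-* : ∀ m n .{{m≢0 : NonZero m}} .{{n≢0 : NonZero n}} → v (m * n) ≡ v m + v n
  v-* m n = ≤-antisym upper
    (v-max {{m*n≢0 m n}} (subst (_∣ m * n) (sym (^-distribˡ-+-* p (v m) (v n))) (*-pres-∣ (p^v∣n m) (p^v∣n n))))
    where
    upper : v (m * n) ≤ v m + v n
    upper = ≤-trans (vₖ-* (m * n) m n) (+-mono-≤ (vₖ≤v (m * n) m) (vₖ≤v (m * n) n))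

  p∤⇒v≡0 : ∀ {n} → ¬ p ∣ n → v n ≡ 0
  p∤⇒v≡0 {zero}  _   = refl
  p∤⇒v≡0 {suc n} p∤n with p ∣? suc n
  ... | yes p∣n = ⊥-elim (p∤n p∣n)
  ... | no  _   = refl

  p∣⇒1≤v : ∀ {n} .{{_ : NonZero n}} → p ∣ n → 1 ≤ v n
  p∣⇒1≤v {n} p∣n = v-max (subst (_∣ n) (sym (*-identityʳ p)) p∣n)

  v1≡0 : v 1 ≡ 0
  v1≡0 = p∤⇒v≡0 p∤1

  v-^ : ∀ m k .{{_ : NonZero m}} → v (m ^ k) ≡ k * v m
  v-^ m zero    = v1≡0
  v-^ m (suc k) = trans (v-* m (m ^ k) {{n≢0 = m^n≢0 m k}}) (cong (v m +_) (v-^ m k))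

  vp≡1 : v p ≡ 1
  vp≡1 = ≤-antisym (s≤s⁻¹ (≰⇒> 2≰v)) (p∣⇒1≤v ∣-refl)
    where
    2≰v : ¬ 2 ≤ v p
    2≰v 2≤v = p∤1 (*-cancelˡ-∣ p (subst₂ _∣_ (cong (p *_) (*-identityʳ p)) (sym (*-identityʳ p))
      (∣-trans (p^-mono-∣ 2≤v) (p^v∣n p))))

  v[suc]! : ∀ n → v (suc n !) ≡ v (suc n) + v (n !)
  v[suc]! n = v-* (suc n) (n !) {{n≢0 = n !≢0}}

  -- Binomial coefficients are integers.
  v-!-+ : ∀ m n → v (m !) + v (n !) ≤ v ((m + n) !)
  v-!-+ m n = subst (_≤ v ((m + n) !)) (v-* (m !) (n !) {{m !≢0}} {{n !≢0}})
    (v-mono {{(m + n) !≢0}} (subst (λ k → m ! * k ! ∣ (m + n) !) (m+n∸m≡n m n) (k![n∸k]!∣n! (m≤m+n m n))))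

  p≰n⇒v[n!]≡0 : ∀ n → n < p → v (n !) ≡ 0
  p≰n⇒v[n!]≡0 zero    _   = v1≡0
  p≰n⇒v[n!]≡0 (suc n) n<p = trans (v[suc]! n)
    (cong₂ _+_ (p∤⇒v≡0 (>⇒∤ n<p)) (p≰n⇒v[n!]≡0 n (<-trans (n<1+n n) n<p)))

  -- One step of Legendre's formula: the multiples of p up to n are p, 2p, ..., ⌊n/p⌋ p, which
  -- contribute ⌊n/p⌋ through the factors p and v(⌊n/p⌋!) through the cofactors.
  legendre : ∀ n → v (n !) ≤ n / p + v ((n / p) !)
  legendre zero    = subst (_≤ 0 / p + v ((0 / p) !)) (sym v1≡0) z≤n
  legendre (suc n) with p ∣? suc n
  ... | no p∤ = begin
        v (suc n !)              ≡⟨ trans (v[suc]! n) (cong (_+ v (n !)) (p∤⇒v≡0 p∤)) ⟩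
        v (n !)                  ≤⟨ legendre n ⟩
        n / p + v ((n / p) !)    ≤⟨ +-mono-≤ le (v-mono {{(suc n / p) !≢0}} (m≤n⇒m!∣n! le)) ⟩
        suc n / p + v ((suc n / p) !) ∎
        where
        open ≤-Reasoning
        le : n / p ≤ suc n / p
        le = /-monoˡ-≤ p (n≤1+n n)
  ... | yes (divides (suc q) eq) = begin
        v (suc n !)                                 ≡⟨ v[suc]! n ⟩
        v (suc n) + v (n !)                         ≡⟨ cong (_+ v (n !)) (trans (cong v eq) (trans (v-* (suc q) p) (cong (v (suc q) +_) vp≡1))) ⟩
        v (suc q) + 1 + v (n !)                     ≤⟨ +-monoʳ-≤ (v (suc q) + 1) (legendre n) ⟩
        v (suc q) + 1 + (n / p + v ((n / p) !))     ≡⟨ cong (λ k → v (suc q) + 1 + (k + v (k !))) n/p≡q ⟩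
        v (suc q) + 1 + (q + v (q !))               ≡⟨ rearrange (v (suc q)) q (v (q !)) ⟩
        suc q + (v (suc q) + v (q !))               ≡⟨ cong (suc q +_) (sym (v[suc]! q)) ⟩
        suc q + v (suc q !)                         ≡⟨ cong (λ k → k + v (k !)) (sym [n+1]/p≡q+1) ⟩
        suc n / p + v ((suc n / p) !)               ∎
        where
        open ≤-Reasoning
        [n+1]/p≡q+1 : suc n / p ≡ suc q
        [n+1]/p≡q+1 = trans (cong (_/ p) eq) (m*n/n≡m (suc q) p)
        n/p≡q : n / p ≡ q
        n/p≡q = ≤-antisym
          (s≤s⁻¹ (m<n*o⇒m/o<n (subst (n <_) eq (n<1+n n))))
          (subst (_≤ n / p) (m*n/n≡m q p) (/-monoˡ-≤ p (s≤s⁻¹ (subst (suc (q * p) ≤_) (sym eq) (+-monoˡ-≤ (q * p) (<⇒≤ 2≤p))))))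
        rearrange : ∀ a b c → a + 1 + (b + c) ≡ suc b + (a + c)
        rearrange a b c = trans (cong (_+ (b + c)) (+-comm a 1)) (cong suc (trans (sym (+-assoc a b c))
          (trans (cong (_+ c) (+-comm a b)) (+-assoc b a c))))

  v[n!]≤n : ∀ n → v (n !) ≤ n
  v[n!]≤n = <-rec _ bound
    where
    open ≤-Reasoning
    bound : ∀ n → (∀ {m} → m < n → v (m !) ≤ m) → v (n !) ≤ n
    bound zero    _   = ≤-reflexive v1≡0
    bound (suc n) rec = let m = suc n / p in begin
      v (suc n !)  ≤⟨ legendre (suc n) ⟩
      m + v (m !)  ≤⟨ +-monoʳ-≤ m (rec (m/n<m (suc n) p 2≤p)) ⟩
      m + m        ≡⟨ cong (m +_) (sym (+-identityʳ m)) ⟩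
      2 * m        ≤⟨ *-monoˡ-≤ m 2≤p ⟩
      p * m        ≡⟨ *-comm p m ⟩
      m * p        ≤⟨ m/n*n≤m (suc n) p ⟩
      suc n        ∎

-- The primes of m are stripped off one at a time: the inequality at q shows q ∣ n, and cancelling q
-- on both sides preserves the inequalities at all primes.
all-v≤⇒∣ : ∀ m n .{{_ : NonZero m}} .{{_ : NonZero n}} →
           (∀ p (pr : Prime p) → Valuation.v p pr m ≤ Valuation.v p pr n) → m ∣ n
all-v≤⇒∣ m n h = subst (_∣ n) (sym isFactorisation)
  (go factors factorsPrime n λ p pr → subst (λ k → v p pr k ≤ v p pr n) isFactorisation (h p pr))
  where
  open Valuation
  open PrimeFactorisation (factorise m)
  go : ∀ ps → All Prime ps → ∀ n .{{_ : NonZero n}} →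
       (∀ p (pr : Prime p) → v p pr (product ps) ≤ v p pr n) → product ps ∣ n
  go []       _          n _ = 1∣ n
  go (q ∷ ps) (qp ∷ psp) n h = go′ (∣-trans q∣ (p^v∣n q qp n))
    where
    instance
      q≢0 : NonZero q
      q≢0 = prime⇒nonZero qp
      P≢0 : NonZero (product ps)
      P≢0 = productOfPrimes≢0 psp
    1≤v : 1 ≤ v q qp n
    1≤v = ≤-trans (p∣⇒1≤v q qp {{m*n≢0 q (product ps)}} (m∣m*n (product ps))) (h q qp)
    q∣ : q ∣ q ^ v q qp n
    q∣ = divides (q ^ (v q qp n ∸ 1)) (trans (cong (q ^_) (sym (m∸n+n≡m 1≤v)))
      (trans (^-distribˡ-+-* q (v q qp n ∸ 1) 1) (cong (q ^ (v q qp n ∸ 1) *_) (*-identityʳ q))))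
    go′ : q ∣ n → q * product ps ∣ n
    go′ (divides n′ refl) = subst (q * product ps ∣_) (*-comm q n′) (*-monoʳ-∣ q (go ps psp n′ {{n′≢0}} λ p pr →
      +-cancelˡ-≤ (v p pr q) _ _ (subst₂ _≤_ (v-* p pr q (product ps))
        (trans (cong (v p pr) (*-comm n′ q)) (v-* p pr q n′ {{n≢0 = n′≢0}})) (h p pr))))
      where
      n′≢0 : NonZero n′
      n′≢0 = m*n≢0⇒m≢0 n′

-- Valuations of the values of a polynomial

open import Data.Integer using (ℤ; ∣_∣)

∑< : ℕ → (ℕ → ℕ) → ℕ
∑< zero    w = 0
∑< (suc n) w = ∑< n w + w n

∑<-mono : ∀ n {w u} → (∀ i → i < n → w i ≤ u i) → ∑< n w ≤ ∑< n u
∑<-mono zero    w≤u = z≤n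
∑<-mono (suc n) w≤u = +-mono-≤ (∑<-mono n λ i i<n → w≤u i (m<n⇒m<1+n i<n)) (w≤u n ≤-refl)

∑<-cong : ∀ n {w u} → (∀ i → i < n → w i ≡ u i) → ∑< n w ≡ ∑< n u
∑<-cong zero    eq = refl
∑<-cong (suc n) eq = cong₂ _+_ (∑<-cong n λ i i<n → eq i (m<n⇒m<1+n i<n)) (eq n ≤-refl)

+-interchange : ∀ a b c d → (a + b) + (c + d) ≡ (a + c) + (b + d)
+-interchange a b c d = trans (+-assoc a b (c + d)) (trans (cong (a +_)
  (trans (sym (+-assoc b c d)) (trans (cong (_+ d) (+-comm b c)) (+-assoc c b d)))) (sym (+-assoc a c (b + d))))

∑<-distrib-+ : ∀ n w u → ∑< n (λ i → w i + u i) ≡ ∑< n w + ∑< n u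
∑<-distrib-+ zero    w u = refl
∑<-distrib-+ (suc n) w u = trans (cong (_+ (w n + u n)) (∑<-distrib-+ n w u)) (+-interchange (∑< n w) (∑< n u) (w n) (u n))

∑<-const : ∀ n c → ∑< n (λ _ → c) ≡ n * c
∑<-const zero    c = refl
∑<-const (suc n) c = trans (cong (_+ c) (∑<-const n c)) (+-comm (n * c) c)

∑<-split : ∀ m n w → ∑< (m + n) w ≡ ∑< m w + ∑< n (λ i → w (m + i))
∑<-split m zero    w = trans (cong (λ k → ∑< k w) (+-identityʳ m)) (sym (+-identityʳ _))
∑<-split m (suc n) w = trans (cong (λ k → ∑< k w) (+-suc m n))
  (trans (cong (_+ w (m + n)) (∑<-split m n w)) (+-assoc (∑< m w) _ _))

δ : ℕ → ℕ → ℕ → ℕ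
δ m c i with i ≟ m
... | yes _ = c
... | no  _ = 0

∑<-δ : ∀ n m c → ∑< n (δ m c) ≤ c
∑<-δ n m c = go n
  where
  below : ∀ n → n ≤ m → ∑< n (δ m c) ≤ 0
  below zero    _   = z≤n
  below (suc n) n<m with n ≟ m
  ... | yes n≡m = ⊥-elim (<⇒≢ n<m n≡m)
  ... | no  _   = subst (_≤ 0) (sym (+-identityʳ _)) (below n (<⇒≤ n<m))
  go : ∀ n → ∑< n (δ m c) ≤ c
  go zero    = z≤n
  go (suc n) with n ≟ m
  ... | yes n≡m = +-monoˡ-≤ c (below n (≤-reflexive n≡m))
  ... | no  _   = subst (_≤ c) (sym (+-identityʳ _)) (go n)

mask : (ℕ → Bool) → (ℕ → ℕ) → ℕ → ℕ
mask χ w i = if χ i then w i else 0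

remove : ℕ → (ℕ → Bool) → ℕ → Bool
remove m χ i with i ≟ m
... | yes _ = false
... | no  _ = χ i

remove-true : ∀ m χ i → remove m χ i ≡ true → χ i ≡ true × i ≢ m
remove-true m χ i eq with i ≟ m
remove-true m χ i () | yes _
remove-true m χ i eq | no i≢m = eq , i≢m

mask-remove : ∀ n m χ w → ∑< n (mask χ w) ≤ w m + ∑< n (mask (remove m χ) w)
mask-remove n m χ w = begin
  ∑< n (mask χ w)
    ≤⟨ ∑<-mono n (λ i _ → pointwise i) ⟩
  ∑< n (λ i → δ m (w m) i + mask (remove m χ) w i)
    ≡⟨ ∑<-distrib-+ n (δ m (w m)) _ ⟩
  ∑< n (δ m (w m)) + ∑< n (mask (remove m χ) w)
    ≤⟨ +-monoˡ-≤ _ (∑<-δ n m (w m)) ⟩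
  w m + ∑< n (mask (remove m χ) w) ∎
  where
  open ≤-Reasoning
  pointwise : ∀ i → mask χ w i ≤ δ m (w m) i + mask (remove m χ) w i
  pointwise i with i ≟ m
  ... | no _ = ≤-refl
  ... | yes refl with χ i
  ...   | true  = ≤-reflexive (sym (+-identityʳ _))
  ...   | false = z≤n

-- The maximum is wanted only when it is positive, so that every argument selected by it is a root
-- modulo p.
argmax : ∀ n (χ : ℕ → Bool) (w : ℕ → ℕ) →
  (∀ i → i < n → χ i ≡ true → w i ≡ 0) ⊎
  (∃[ m ] (m < n × χ m ≡ true × 1 ≤ w m × (∀ i → i < n → χ i ≡ true → w i ≤ w m)))
argmax zero    χ w = inj₁ λ _ ()
argmax (suc n) χ w with χ n in χn | w n in wn | argmax n χ w
... | false | _ | inj₁ zeros = inj₁ λ i i≤n χi → case i i≤n χi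
  where
  case : ∀ i → i < suc n → χ i ≡ true → w i ≡ 0
  case i i≤n χi with m≤n⇒m<n∨m≡n (s≤s⁻¹ i≤n)
  ... | inj₁ i<n  = zeros i i<n χi
  ... | inj₂ refl with () ← trans (sym χn) χi
... | false | _ | inj₂ (m , m<n , χm , 1≤ , max) = inj₂ (m , m<n⇒m<1+n m<n , χm , 1≤ , case)
  where
  case : ∀ i → i < suc n → χ i ≡ true → w i ≤ w m
  case i i≤n χi with m≤n⇒m<n∨m≡n (s≤s⁻¹ i≤n)
  ... | inj₁ i<n  = max i i<n χi
  ... | inj₂ refl with () ← trans (sym χn) χi
... | true | zero | inj₁ zeros = inj₁ case
  where
  case : ∀ i → i < suc n → χ i ≡ true → w i ≡ 0
  case i i≤n χi with m≤n⇒m<n∨m≡n (s≤s⁻¹ i≤n)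
  ... | inj₁ i<n  = zeros i i<n χi
  ... | inj₂ refl = wn
... | true | suc k | inj₁ zeros = inj₂ (n , ≤-refl , χn , subst (1 ≤_) (sym wn) (s≤s z≤n) , case)
  where
  case : ∀ i → i < suc n → χ i ≡ true → w i ≤ w n
  case i i≤n χi with m≤n⇒m<n∨m≡n (s≤s⁻¹ i≤n)
  ... | inj₁ i<n  = subst (_≤ w n) (sym (zeros i i<n χi)) z≤n
  ... | inj₂ refl = ≤-refl
... | true | k | inj₂ (m , m<n , χm , 1≤ , max) with w n ≤? w m
...   | yes le = inj₂ (m , m<n⇒m<1+n m<n , χm , 1≤ , case)
  where
  case : ∀ i → i < suc n → χ i ≡ true → w i ≤ w m
  case i i≤n χi with m≤n⇒m<n∨m≡n (s≤s⁻¹ i≤n)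
  ... | inj₁ i<n  = max i i<n χi
  ... | inj₂ refl = le
...   | no nle = inj₂ (n , ≤-refl , χn , ≤-trans 1≤ (<⇒≤ (≰⇒> nle)) , case)
  where
  case : ∀ i → i < suc n → χ i ≡ true → w i ≤ w n
  case i i≤n χi with m≤n⇒m<n∨m≡n (s≤s⁻¹ i≤n)
  ... | inj₁ i<n  = ≤-trans (max i i<n χi) (<⇒≤ (≰⇒> nle))
  ... | inj₂ refl = ≤-refl

-- The arguments 1, …, N of f are indexed from 0.
arg : ℕ → ℤ
arg i = ℤ.+ suc i

module Greedy (p : ℕ) (p-prime : Prime p) where
  open Valuation p p-prime

  -- At i = m the difference is 0 and its truncated valuation would be K; that index is removed by
  -- the selection and must count nothing.
  vdist : ℕ → ℕ → ℕ → ℕ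
  vdist K m i with i ≟ m
  ... | yes _ = 0
  ... | no  _ = vₖ K ∣ arg i ℤ.- arg m ∣

  vdist-≢ : ∀ K m i → i ≢ m → vdist K m i ≡ vₖ K ∣ arg i ℤ.- arg m ∣
  vdist-≢ K m i i≢m with i ≟ m
  ... | yes i≡m = ⊥-elim (i≢m i≡m)
  ... | no  _   = refl

  ∑<-v : ∀ n → ∑< n (λ i → v (suc i)) ≡ v (n !)
  ∑<-v zero    = sym v1≡0
  ∑<-v (suc n) = trans (cong (_+ v (suc n)) (∑<-v n)) (trans (+-comm (v (n !)) _) (sym (v[suc]! n)))

  ∑<-v-reverse : ∀ n → ∑< n (λ i → v (n ∸ i)) ≡ v (n !)
  ∑<-v-reverse zero    = sym v1≡0
  ∑<-v-reverse (suc n) = trans (∑<-split 1 n (λ i → v (suc n ∸ i)))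
    (trans (cong (v (suc n) +_) (∑<-v-reverse n)) (sym (v[suc]! n)))

  vdist-dist : ∀ K m i j .{{_ : NonZero j}} → ∣ arg i ℤ.- arg m ∣ ≡ j → vdist K m i ≤ v j
  vdist-dist K m i j eq with i ≟ m
  ... | yes _ = z≤n
  ... | no  _ = subst (λ k → vₖ K k ≤ v j) (sym eq) (vₖ≤v K j)

  -- The distances from m to the other indices below n are 1, ..., m and 1, ..., n - 1 - m, and m!
  -- (n - 1 - m)! divides (n - 1)!.
  ∑<-vdist : ∀ K m n → m < n → ∑< n (vdist K m) ≤ v (n !)
  ∑<-vdist K m n m<n = subst (λ n → ∑< n (vdist K m) ≤ v (n !)) (m+[n∸m]≡n m<n) (bound (n ∸ suc m))
    where
    open ≤-Reasoning
    at-m : vdist K m m ≡ 0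
    at-m with m ≟ m
    ... | yes _   = refl
    ... | no  m≢m = ⊥-elim (m≢m refl)
    left : ∀ i → i < m → vdist K m i ≤ v (m ∸ i)
    left i i<m = vdist-dist K m i (m ∸ i) {{>-nonZero (m<n⇒0<n∸m i<m)}}
      (trans (cong ∣_∣ (ℤ.m-n≡m⊖n (suc i) (suc m))) (ℤ.∣⊖∣-≤ (s≤s (<⇒≤ i<m))))
    right : ∀ k i → i < k → vdist K m (suc m + i) ≤ v (suc i)
    right k i _ = vdist-dist K m (suc m + i) (suc i) (begin-equality
      ∣ arg (suc m + i) ℤ.- arg m ∣     ≡⟨ cong ∣_∣ (ℤ.m-n≡m⊖n (suc (suc m + i)) (suc m)) ⟩
      ∣ suc (suc m + i) ℤ.⊖ suc m ∣     ≡⟨ ℤ.∣m⊖n∣≡∣n⊖m∣ (suc (suc m + i)) (suc m) ⟩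
      ∣ suc m ℤ.⊖ suc (suc m + i) ∣     ≡⟨ ℤ.∣⊖∣-≤ (s≤s (≤-trans (n≤1+n m) (m≤m+n (suc m) i))) ⟩
      suc m + i ∸ m                     ≡⟨ cong (_∸ m) (sym (+-suc m i)) ⟩
      m + suc i ∸ m                     ≡⟨ m+n∸m≡n m (suc i) ⟩
      suc i                             ∎)
    bound : ∀ k → ∑< (suc m + k) (vdist K m) ≤ v ((suc m + k) !)
    bound k = begin
      ∑< (suc m + k) (vdist K m)
        ≡⟨ ∑<-split (suc m) k (vdist K m) ⟩
      ∑< m (vdist K m) + vdist K m m + ∑< k (λ i → vdist K m (suc m + i))
        ≡⟨ cong (_+ ∑< k (λ i → vdist K m (suc m + i))) (trans (cong (∑< m (vdist K m) +_) at-m) (+-identityʳ _)) ⟩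
      ∑< m (vdist K m) + ∑< k (λ i → vdist K m (suc m + i))
        ≤⟨ +-mono-≤ (∑<-mono m left) (∑<-mono k (right k)) ⟩
      ∑< m (λ i → v (m ∸ i)) + ∑< k (λ i → v (suc i))
        ≡⟨ cong₂ _+_ (∑<-v-reverse m) (∑<-v k) ⟩
      v (m !) + v (k !)
        ≤⟨ v-!-+ m k ⟩
      v ((m + k) !)
        ≤⟨ ≤-trans (m≤n+m (v ((m + k) !)) (v (suc m + k))) (≤-reflexive (sym (v[suc]! (m + k)))) ⟩
      v ((suc m + k) !) ∎

  Separable : Poly → Set
  Separable g = ∀ r → ℤ.+ p ℤ.∣ eval g r → ¬ ℤ.+ p ℤ.∣ eval (derivative g) r

  -- A double root of the quotient would be a double root of g.
  Separable-divDiff : ∀ g r → ℤ.+ p ℤ.∣ eval g r → Separable g → Separable (divDiff g r)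
  Separable-divDiff g r p∣gr sep s p∣q p∣q′ = sep s
    (subst (ℤ.+ p ℤ.∣_) (sym (eval-divDiff g r s)) (ℤ.∣m∣n⇒∣m+n p∣gr (ℤ.∣n⇒∣m*n (s ℤ.- r) p∣q)))
    (subst (ℤ.+ p ℤ.∣_) (sym (eval-derivative-divDiff g r s)) (ℤ.∣m∣n⇒∣m+n p∣q (ℤ.∣n⇒∣m*n (s ℤ.- r) p∣q′)))

  eval-cong-∣ : ∀ g r s → ℤ.+ p ℤ.∣ r ℤ.- s → ℤ.+ p ℤ.∣ eval g s → ℤ.+ p ℤ.∣ eval g r
  eval-cong-∣ g r s p∣r-s p∣gs = subst (ℤ.+ p ℤ.∣_) (sym (eval-divDiff g s r))
    (ℤ.∣m∣n⇒∣m+n p∣gs (ℤ.∣m⇒∣m*n (eval (divDiff g s) r) p∣r-s))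

  -- Two roots of g congruent mod p would give a common root of g and its derivative.
  roots-distinct : ∀ g r s → Separable g → ℤ.+ p ℤ.∣ eval g r → ℤ.+ p ℤ.∣ eval (divDiff g r) s → ¬ ℤ.+ p ℤ.∣ r ℤ.- s
  roots-distinct g r s sep p∣gr p∣qs p∣r-s = sep r p∣gr (subst (ℤ.+ p ℤ.∣_)
    (sym (trans (eval-derivative-divDiff g r r) (lem r (eval (divDiff g r) r) (eval (derivative (divDiff g r)) r))))
    (eval-cong-∣ (divDiff g r) r s p∣r-s p∣qs))
    where
    lem : ∀ r u w → u ℤ.+ (r ℤ.- r) ℤ.* w ≡ u
    lem = ℤ-Solver.solve-∀

  Roots : Poly → List ℕ → Set
  Roots g T = All (λ t → ℤ.+ p ℤ.∣ eval g (arg t)) T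

  Distinct : List ℕ → Set
  Distinct = AllPairs (λ s t → ¬ ℤ.+ p ℤ.∣ arg s ℤ.- arg t)

  module _ (K N : ℕ) where

    w : Poly → ℕ → ℕ
    w g i = vₖ K ∣ eval g (arg i) ∣

    -- The recursion passes from g to a divided difference, so the splitting of sums is stated for
    -- every weight u and can afterwards be read with the valuations of g itself. The last bound
    -- charges v(N!) once per selected argument: it is `length T`, rather than ℓ, that plays the
    -- part of ρ.
    Selection : Poly → ℕ → ℤ → (ℕ → Bool) → Set
    Selection g ℓ a χ = ∃[ T ] ∃[ χ′ ]
      ( length T ≤ ℓ × All (_< N) T × Roots g T × (Separable g → Distinct T)
      × (∀ i → χ′ i ≡ true → χ i ≡ true)
      × (∀ u → ∑< N (mask χ u) ≤ sum (map u T) + ∑< N (mask χ′ u))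
      × ∑< N (mask χ′ (w g)) ≤ length T * v (N !) + N * vₖ K ∣ a ∣)

    empty : ∀ g ℓ a χ → ∑< N (mask χ (w g)) ≤ N * vₖ K ∣ a ∣ → Selection g ℓ a χ
    empty g ℓ a χ le = [] , χ , z≤n , [] , [] , (λ _ → []) , (λ _ χi → χi) , (λ _ → ≤-refl) , le

    -- If p^k divides both g(n) and g(m), it divides (n - m) (divDiff g m)(n); so a point m
    -- at which the valuation of g is maximal can be traded for a factor n - m.
    select : ∀ ℓ g χ → length g ≡ suc ℓ → Selection g ℓ (coeff g ℓ) χ
    select zero (a ∷ []) χ _ = empty (a ∷ []) 0 a χ (begin
      ∑< N (mask χ (w (a ∷ [])))  ≤⟨ ∑<-mono N (λ i _ → pointwise i) ⟩
      ∑< N (λ _ → vₖ K ∣ a ∣)     ≡⟨ ∑<-const N _ ⟩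
      N * vₖ K ∣ a ∣              ∎)
      where
      open ≤-Reasoning
      pointwise : ∀ i → mask χ (w (a ∷ [])) i ≤ vₖ K ∣ a ∣
      pointwise i with χ i
      ... | true  = ≤-reflexive (cong (vₖ K ∘ ∣_∣) (trans (cong (λ z → a ℤ.+ z) (ℤ.*-zeroʳ (arg i))) (ℤ.+-identityʳ a)))
      ... | false = z≤n
    select (suc ℓ) g@(_ ∷ g₋) χ len with argmax N χ (w g)
    -- No root modulo p is left among the arguments. Stopping here keeps the coefficient of v(N!)
    -- from growing to ℓ.
    ... | inj₁ zeros = empty g (suc ℓ) (coeff g (suc ℓ)) χ (≤-trans (∑<-mono N pointwise)
            (≤-trans (≤-reflexive (trans (∑<-const N 0) (*-zeroʳ N))) z≤n))
      where
      pointwise : ∀ i → i < N → mask χ (w g) i ≤ 0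
      pointwise i i<N with χ i in χi
      ... | true  = ≤-reflexive (zeros i i<N χi)
      ... | false = z≤n
    ... | inj₂ (m , m<N , χm , 1≤wm , max) = extend (select ℓ q (remove m χ) (trans (length-divDiff _ g₋ (arg m)) (suc-injective len)))
      where
      q = divDiff g (arg m)
      p∣gm : ℤ.+ p ℤ.∣ eval g (arg m)
      p∣gm = ℤ.∣ᵤ⇒∣ (∣-trans (p∣p^ 1≤wm) (p^vₖ∣n K ∣ eval g (arg m) ∣))
        where
        p∣p^ : ∀ {k} → 1 ≤ k → p ∣ p ^ k
        p∣p^ {suc k} _ = m∣m*n (p ^ k)
      trade : ∀ i → i < N → χ i ≡ true → w g i ≤ vₖ K ∣ arg i ℤ.- arg m ∣ + w q i
      trade i i<N χi = ≤-trans (vₖ-max (vₖ≤K K ∣ eval g (arg i) ∣) (subst (p ^ w g i ∣_) (ℤ.abs-* (arg i ℤ.- arg m) (eval q (arg i)))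
          (ℤ.∣⇒∣ᵤ divides-product))) (vₖ-* K ∣ arg i ℤ.- arg m ∣ ∣ eval q (arg i) ∣)
        where
        at-i : ℤ.+ (p ^ w g i) ℤ.∣ eval g (arg i)
        at-i = ℤ.∣ᵤ⇒∣ (p^vₖ∣n K ∣ eval g (arg i) ∣)
        at-m : ℤ.+ (p ^ w g i) ℤ.∣ eval g (arg m)
        at-m = ℤ.∣ᵤ⇒∣ (∣-trans (p^-mono-∣ (max i i<N χi)) (p^vₖ∣n K ∣ eval g (arg m) ∣))
        divides-product : ℤ.+ (p ^ w g i) ℤ.∣ (arg i ℤ.- arg m) ℤ.* eval q (arg i)
        divides-product = ℤ.∣m+n∣m⇒∣n (subst (ℤ.+ (p ^ w g i) ℤ.∣_) (eval-divDiff g (arg m) (arg i)) at-i) at-m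
      extend : Selection q ℓ (coeff q ℓ) (remove m χ) → Selection g (suc ℓ) (coeff g (suc ℓ)) χ
      extend (T , χ′ , T≤ℓ , T<N , roots , distinct , χ′⊆ , sums , rest) =
        m ∷ T , χ′ , s≤s T≤ℓ , m<N ∷ T<N , p∣gm ∷ All.map (λ {t} → root-of-g {t}) roots ,
        (λ sep → All.map (λ {t} → roots-distinct g (arg m) (arg t) sep p∣gm) roots ∷ distinct (Separable-divDiff g (arg m) p∣gm sep)) ,
        (λ i χ′i → proj₁ (remove-true m χ i (χ′⊆ i χ′i))) , sums′ , rest′
        where
        open ≤-Reasoning
        root-of-g : ∀ {t} → ℤ.+ p ℤ.∣ eval q (arg t) → ℤ.+ p ℤ.∣ eval g (arg t)
        root-of-g {t} p∣qt = subst (ℤ.+ p ℤ.∣_) (sym (eval-divDiff g (arg m) (arg t)))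
          (ℤ.∣m∣n⇒∣m+n p∣gm (ℤ.∣n⇒∣m*n (arg t ℤ.- arg m) p∣qt))
        sums′ : ∀ u → ∑< N (mask χ u) ≤ u m + sum (map u T) + ∑< N (mask χ′ u)
        sums′ u = begin
          ∑< N (mask χ u)                              ≤⟨ mask-remove N m χ u ⟩
          u m + ∑< N (mask (remove m χ) u)             ≤⟨ +-monoʳ-≤ (u m) (sums u) ⟩
          u m + (sum (map u T) + ∑< N (mask χ′ u))     ≡⟨ +-assoc (u m) _ _ ⟨
          u m + sum (map u T) + ∑< N (mask χ′ u)       ∎
        pointwise : ∀ i → i < N → mask χ′ (w g) i ≤ vdist K m i + mask χ′ (w q) i
        pointwise i i<N with χ′ i in χ′i
        ... | false = z≤n
        ... | true  with remove-true m χ i (χ′⊆ i χ′i)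
        ...   | χi , i≢m = subst (λ k → w g i ≤ k + w q i) (sym (vdist-≢ K m i i≢m)) (trade i i<N χi)
        rest′ : ∑< N (mask χ′ (w g)) ≤ v (N !) + length T * v (N !) + N * vₖ K ∣ coeff g (suc ℓ) ∣
        rest′ = begin
          ∑< N (mask χ′ (w g))
            ≤⟨ ∑<-mono N pointwise ⟩
          ∑< N (λ i → vdist K m i + mask χ′ (w q) i)
            ≡⟨ ∑<-distrib-+ N (vdist K m) _ ⟩
          ∑< N (vdist K m) + ∑< N (mask χ′ (w q))
            ≤⟨ +-mono-≤ (∑<-vdist K m N m<N) rest ⟩
          v (N !) + (length T * v (N !) + N * vₖ K ∣ coeff q ℓ ∣)
            ≡⟨ cong (λ z → v (N !) + (length T * v (N !) + N * vₖ K ∣ z ∣)) (leading-divDiff ℓ g (arg m) len) ⟩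
          v (N !) + (length T * v (N !) + N * vₖ K ∣ coeff g (suc ℓ) ∣)
            ≡⟨ +-assoc (v (N !)) _ _ ⟨
          v (N !) + length T * v (N !) + N * vₖ K ∣ coeff g (suc ℓ) ∣ ∎

-- Counting points of a box on the lines a ≡ t b mod p

∏< : ℕ → (ℕ → ℕ) → ℕ
∏< zero    w = 1
∏< (suc n) w = ∏< n w * w n

∏<≢0 : ∀ n {w} → (∀ i → NonZero (w i)) → NonZero (∏< n w)
∏<≢0 zero        nz = _
∏<≢0 (suc n) {w} nz = m*n≢0 (∏< n w) (w n) {{∏<≢0 n nz}} {{nz n}}

∑<-term : ∀ n w i → i < n → w i ≤ ∑< n w
∑<-term (suc n) w i i≤n with m≤n⇒m<n∨m≡n (s≤s⁻¹ i≤n)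
... | inj₁ i<n  = ≤-trans (∑<-term n w i i<n) (m≤m+n _ _)
... | inj₂ refl = m≤n+m (w n) (∑< n w)

∑<-swap : ∀ m n (w : ℕ → ℕ → ℕ) → ∑< m (λ i → ∑< n (w i)) ≡ ∑< n (λ j → ∑< m (λ i → w i j))
∑<-swap zero    n w = sym (trans (∑<-const n 0) (*-zeroʳ n))
∑<-swap (suc m) n w = trans (cong (_+ ∑< n (w m)) (∑<-swap m n w)) (sym (∑<-distrib-+ n _ (w m)))

∑<-sum : ∀ n (T : List ℕ) (w : ℕ → ℕ → ℕ) →
  ∑< n (λ i → sum (map (w i) T)) ≡ sum (map (λ t → ∑< n (λ i → w i t)) T)
∑<-sum n []      w = trans (∑<-const n 0) (*-zeroʳ n)
∑<-sum n (t ∷ T) w = trans (∑<-distrib-+ n (λ i → w i t) _) (cong (∑< n (λ i → w i t) +_) (∑<-sum n T w))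

∑<-shift : ∀ s n k w → s + n ≤ k → ∑< n (λ i → w (s + i)) ≤ ∑< k w
∑<-shift s n k w le = begin
  ∑< n (λ i → w (s + i))                             ≤⟨ m≤n+m _ (∑< s w) ⟩
  ∑< s w + ∑< n (λ i → w (s + i))                    ≡⟨ ∑<-split s n w ⟨
  ∑< (s + n) w                                       ≤⟨ m≤m+n _ _ ⟩
  ∑< (s + n) w + ∑< (k ∸ (s + n)) (λ i → w (s + n + i)) ≡⟨ ∑<-split (s + n) _ w ⟨
  ∑< (s + n + (k ∸ (s + n))) w                       ≡⟨ cong (λ k → ∑< k w) (m+[n∸m]≡n le) ⟩
  ∑< k w                                             ∎
  where open ≤-Reasoning

bounded-or-exceeds : ∀ n (w : ℕ → ℕ) B → (∀ i → i < n → w i ≤ B) ⊎ (∃[ i ] (i < n × B < w i))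
bounded-or-exceeds zero    w B = inj₁ λ _ ()
bounded-or-exceeds (suc n) w B with bounded-or-exceeds n w B | w n ≤? B
... | inj₂ (i , i<n , ex) | _      = inj₂ (i , m<n⇒m<1+n i<n , ex)
... | inj₁ _              | no wn≰ = inj₂ (n , ≤-refl , ≰⇒> wn≰)
... | inj₁ below          | yes le = inj₁ case
  where
  case : ∀ i → i < suc n → w i ≤ B
  case i i≤n with m≤n⇒m<n∨m≡n (s≤s⁻¹ i≤n)
  ... | inj₁ i<n  = below i i<n
  ... | inj₂ refl = le

exceeds : ∀ n (w : ℕ → ℕ) B → n * B < ∑< n w → ∃[ i ] (i < n × B < w i)
exceeds n w B lt with bounded-or-exceeds n w B
... | inj₂ ex    = ex
... | inj₁ below = ⊥-elim (<⇒≱ lt (≤-trans (∑<-mono n below) (≤-reflexive (∑<-const n B))))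

positive-term : ∀ n (w : ℕ → ℕ) → 0 < ∑< n w → ∃[ i ] (i < n × 0 < w i)
positive-term n w lt = exceeds n w 0 (subst (_< ∑< n w) (sym (*-zeroʳ n)) lt)

sum-≥ : ∀ (T : List ℕ) (w : ℕ → ℕ) B → (∀ t → B ≤ w t) → length T * B ≤ sum (map w T)
sum-≥ []      w B le = z≤n
sum-≥ (t ∷ T) w B le = +-mono-≤ (le t) (sum-≥ T w B le)

sum-≤ : ∀ (T : List ℕ) (w : ℕ → ℕ) B → All (λ t → w t ≤ B) T → sum (map w T) ≤ length T * B
sum-≤ []      w B _          = z≤n
sum-≤ (t ∷ T) w B (le ∷ les) = +-mono-≤ le (sum-≤ T w B les)

-- The coordinates -X, …, X, indexed from 0 to 2X.
width : ℕ → ℕ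
width X = suc (X + X)

coord : ℕ → ℕ → ℤ
coord X i = ℤ.+ i ℤ.- ℤ.+ X

-- The factor at the origin, where the form vanishes, is replaced by 1.
boxProduct : Poly → ℕ → ℕ
boxProduct g X = ∏< (width X) λ j → ∏< (width X) λ i → ∣ form g (coord X i) (coord X j) ∣ ⊔ 1

⊔1≢0 : ∀ n → NonZero (n ⊔ 1)
⊔1≢0 n = >-nonZero (m≤n⊔m n 1)

coord≡0 : ∀ X i → coord X i ≡ ℤ.+ 0 → i ≡ X
coord≡0 X i eq = ℤ.+-injective (ℤ.i-j≡0⇒i≡j (ℤ.+ i) (ℤ.+ X) eq)

module BoxCount (p : ℕ) (p-prime : Prime p) where
  open Valuation p p-prime
  open Greedy p p-prime

  v-∏< : ∀ n w → (∀ i → NonZero (w i)) → v (∏< n w) ≡ ∑< n (v ∘ w)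
  v-∏< zero    w nz = v1≡0
  v-∏< (suc n) w nz = trans (v-* (∏< n w) (w n) {{∏<≢0 n nz}} {{nz n}}) (cong (_+ v (w n)) (v-∏< n w nz))

  𝟙 : ℤ → ℕ
  𝟙 z with ℤ.+ p ℤ.∣? z
  ... | yes _ = 1
  ... | no  _ = 0

  𝟙≤1 : ∀ z → 𝟙 z ≤ 1
  𝟙≤1 z with ℤ.+ p ℤ.∣? z
  ... | yes _ = ≤-refl
  ... | no  _ = z≤n

  𝟙-∣ : ∀ z → ℤ.+ p ℤ.∣ z → 1 ≤ 𝟙 z
  𝟙-∣ z d with ℤ.+ p ℤ.∣? z
  ... | yes _ = ≤-refl
  ... | no ∤z = ⊥-elim (∤z d)

  𝟙-∤ : ∀ z → ¬ ℤ.+ p ℤ.∣ z → 𝟙 z ≡ 0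
  𝟙-∤ z ∤z with ℤ.+ p ℤ.∣? z
  ... | yes d = ⊥-elim (∤z d)
  ... | no  _ = refl

  𝟙-pos : ∀ z → 0 < 𝟙 z → ℤ.+ p ℤ.∣ z
  𝟙-pos z lt with ℤ.+ p ℤ.∣? z
  ... | yes d = d
  𝟙-pos z () | no _

  𝟙-mono : ∀ y z → (ℤ.+ p ℤ.∣ y → ℤ.+ p ℤ.∣ z) → 𝟙 y ≤ 𝟙 z
  𝟙-mono y z y⇒z with ℤ.+ p ℤ.∣? y
  ... | yes d = 𝟙-∣ z (y⇒z d)
  ... | no  _ = z≤n

  euclid : ∀ y z → ℤ.+ p ℤ.∣ y ℤ.* z → ℤ.+ p ℤ.∣ y ⊎ ℤ.+ p ℤ.∣ z
  euclid y z d with euclidsLemma ∣ y ∣ ∣ z ∣ p-prime (subst (p ∣_) (ℤ.abs-* y z) (ℤ.∣⇒∣ᵤ d))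
  ... | inj₁ p∣y = inj₁ (ℤ.∣ᵤ⇒∣ p∣y)
  ... | inj₂ p∣z = inj₂ (ℤ.∣ᵤ⇒∣ p∣z)

  hit : ℤ → ℤ → ℕ → ℕ
  hit a b t = 𝟙 (a ℤ.- arg t ℤ.* b)

  -- The equations of two lines differ by (t - s) b, so two different lines can meet only where p ∣
  -- b.
  same-line : ∀ a b s t → ¬ ℤ.+ p ℤ.∣ b → ¬ ℤ.+ p ℤ.∣ arg t ℤ.- arg s →
    ℤ.+ p ℤ.∣ a ℤ.- arg t ℤ.* b → hit a b s ≡ 0
  same-line a b s t p∤b distinct p∣t = 𝟙-∤ _ λ p∣s → case
    (euclid (arg t ℤ.- arg s) b (subst (ℤ.+ p ℤ.∣_) (lem a b (arg s) (arg t)) (ℤ.∣m∣n⇒∣m-n p∣s p∣t)))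
    where
    lem : ∀ a b s t → (a ℤ.- s ℤ.* b) ℤ.- (a ℤ.- t ℤ.* b) ≡ (t ℤ.- s) ℤ.* b
    lem = ℤ-Solver.solve-∀
    case : ℤ.+ p ℤ.∣ arg t ℤ.- arg s ⊎ ℤ.+ p ℤ.∣ b → ⊥
    case (inj₁ p∣t-s) = distinct p∣t-s
    case (inj₂ p∣b)   = p∤b p∣b

  -- Where p ∤ b the lines are disjoint. On the line of t, `form-root` gives b F(a, b) ≡ b^(d+1)
  -- g(t) ≡ 0, and b can be cancelled.
  hits-≤1 : ∀ g a b → ¬ ℤ.+ p ℤ.∣ b → ∀ T → Roots g T → Distinct T →
    sum (map (hit a b) T) ≡ 0 ⊎ (sum (map (hit a b) T) ≤ 1 × ℤ.+ p ℤ.∣ form g a b)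
  hits-≤1 g a b p∤b []      _              _               = inj₁ refl
  hits-≤1 g a b p∤b (t ∷ T) (p∣gt ∷ roots) (t≢T ∷ distinct) with ℤ.+ p ℤ.∣? (a ℤ.- arg t ℤ.* b)
  ... | no  _   = hits-≤1 g a b p∤b T roots distinct
  ... | yes p∣t = inj₂ (subst (λ k → 1 + k ≤ 1) (sym (zeros T t≢T)) ≤-refl , p∣form)
    where
    zeros : ∀ T → All (λ s → ¬ ℤ.+ p ℤ.∣ arg t ℤ.- arg s) T → sum (map (hit a b) T) ≡ 0
    zeros []      []         = refl
    zeros (s ∷ T) (nd ∷ nds) = cong₂ _+_ (same-line a b s t p∤b nd p∣t) (zeros T nds)
    p∣form : ℤ.+ p ℤ.∣ form g a b
    p∣form with euclid b (form g a b) (subst (ℤ.+ p ℤ.∣_) (lem _ _)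
                 (ℤ.∣m∣n⇒∣m+n (ℤ.∣-trans p∣t (form-root g (arg t) a b)) (ℤ.∣n⇒∣m*n (b ℤ.^ length g) p∣gt)))
      where
      lem : ∀ u w → u ℤ.- w ℤ.+ w ≡ u
      lem = ℤ-Solver.solve-∀
    ... | inj₁ p∣b = ⊥-elim (p∤b p∣b)
    ... | inj₂ d   = d

  -- If p ∤ b there is at most one line through the point; if p divides b but not a there is none;
  -- if p divides both, all lines pass through it, but then p^ℓ divides F(a, b).
  hits≤v : ∀ ℓ g a b T → length g ≡ suc ℓ → length T ≤ ℓ → Roots g T → Distinct T →
    form g a b ≢ ℤ.+ 0 → sum (map (hit a b) T) ≤ v ∣ form g a b ∣
  hits≤v ℓ g a b T len T≤ℓ roots distinct nz with ℤ.+ p ℤ.∣? b | ℤ.+ p ℤ.∣? a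
  ... | no p∤b  | _       = case (hits-≤1 g a b p∤b T roots distinct)
    where
    case : _ → sum (map (hit a b) T) ≤ v ∣ form g a b ∣
    case (inj₁ eq)       = subst (_≤ v ∣ form g a b ∣) (sym eq) z≤n
    case (inj₂ (≤1 , d)) = ≤-trans ≤1 (p∣⇒1≤v {{≢-nonZero (nz ∘ ℤ.∣i∣≡0⇒i≡0)}} (ℤ.∣⇒∣ᵤ d))
  ... | yes p∣b | no p∤a  = ≤-trans (sum-≤ T (hit a b) 0 (All.universal zeros T)) (≤-trans (≤-reflexive (*-zeroʳ (length T))) z≤n)
    where
    lem : ∀ a b t → a ℤ.- t ℤ.* b ℤ.+ t ℤ.* b ≡ a
    lem = ℤ-Solver.solve-∀
    zeros : ∀ t → hit a b t ≤ 0
    zeros t = ≤-reflexive (𝟙-∤ _ λ d → p∤a (subst (ℤ.+ p ℤ.∣_) (lem a b (arg t)) (ℤ.∣m∣n⇒∣m+n d (ℤ.∣n⇒∣m*n (arg t) p∣b))))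
  ... | yes p∣b | yes p∣a = begin
    sum (map (hit a b) T)  ≤⟨ sum-≤ T (hit a b) 1 (All.universal (λ t → 𝟙≤1 _) T) ⟩
    length T * 1           ≡⟨ *-identityʳ (length T) ⟩
    length T               ≤⟨ T≤ℓ ⟩
    ℓ                      ≤⟨ v-max {{≢-nonZero (nz ∘ ℤ.∣i∣≡0⇒i≡0)}} (subst (_∣ ∣ form g a b ∣) (∣i^k∣ (ℤ.+ p) ℓ) (ℤ.∣⇒∣ᵤ (form-∣ ℓ g len p∣a p∣b))) ⟩
    v ∣ form g a b ∣       ∎
    where open ≤-Reasoning

  hitCount : ℕ → ℕ → ℕ
  hitCount X t = ∑< (width X) λ j → ∑< (width X) λ i → hit (coord X i) (coord X j) t

  -- The origin lies on every line but has the factor 1 in the box product; this accounts for the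
  -- extra `length T`.
  hitCounts≤ : ∀ ℓ g X T → length g ≡ suc ℓ → length T ≤ ℓ → Roots g T → Distinct T →
    (∀ a b → a ≢ ℤ.+ 0 ⊎ b ≢ ℤ.+ 0 → form g a b ≢ ℤ.+ 0) →
    sum (map (hitCount X) T) ≤ v (boxProduct g X) + length T
  hitCounts≤ ℓ g X T len T≤ℓ roots distinct nz = begin
    sum (map (hitCount X) T)
      ≡⟨ trans (∑<-cong W (λ j _ → ∑<-sum W T (λ i → hit (coord X i) (coord X j))))
               (∑<-sum W T (λ j t → ∑< W (λ i → hit (coord X i) (coord X j) t))) ⟨
    ∑< W (λ j → ∑< W (λ i → sum (map (hit (coord X i) (coord X j)) T)))
      ≤⟨ ∑<-mono W (λ j _ → row j) ⟩
    ∑< W (λ j → ∑< W (λ i → v (F j i)) + δ X (length T) j)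
      ≡⟨ ∑<-distrib-+ W _ (δ X (length T)) ⟩
    ∑< W (λ j → ∑< W (λ i → v (F j i))) + ∑< W (δ X (length T))
      ≤⟨ +-monoʳ-≤ _ (∑<-δ W X (length T)) ⟩
    ∑< W (λ j → ∑< W (λ i → v (F j i))) + length T
      ≡⟨ cong (_+ length T) (trans (v-∏< W (λ j → ∏< W (F j)) (λ j → ∏<≢0 W (F≢0 j)))
            (∑<-cong W (λ j _ → v-∏< W (F j) (F≢0 j)))) ⟨
    v (boxProduct g X) + length T ∎
    where
    open ≤-Reasoning
    W = width X
    F : ℕ → ℕ → ℕ
    F j i = ∣ form g (coord X i) (coord X j) ∣ ⊔ 1
    F≢0 : ∀ j i → NonZero (F j i)
    F≢0 j i = ⊔1≢0 _
    off-origin : ∀ j i → coord X i ≢ ℤ.+ 0 ⊎ coord X j ≢ ℤ.+ 0 →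
      sum (map (hit (coord X i) (coord X j)) T) ≤ v (F j i)
    off-origin j i ≢0 = subst (λ k → sum (map (hit (coord X i) (coord X j)) T) ≤ v k)
      (sym (m≥n⇒m⊔n≡m (n≢0⇒n>0 (nz _ _ ≢0 ∘ ℤ.∣i∣≡0⇒i≡0))))
      (hits≤v ℓ g (coord X i) (coord X j) T len T≤ℓ roots distinct (nz _ _ ≢0))
    row : ∀ j → ∑< W (λ i → sum (map (hit (coord X i) (coord X j)) T)) ≤ ∑< W (λ i → v (F j i)) + δ X (length T) j
    row j with j ≟ X
    ... | no j≢X = ≤-trans (∑<-mono W (λ i _ → off-origin j i (inj₂ (j≢X ∘ coord≡0 X j)))) (m≤m+n _ 0)
    ... | yes refl = begin
      ∑< W (λ i → sum (map (hit (coord X i) (coord X X)) T))  ≤⟨ ∑<-mono W (λ i _ → cell i) ⟩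
      ∑< W (λ i → v (F X i) + δ X (length T) i)               ≡⟨ ∑<-distrib-+ W (λ i → v (F X i)) _ ⟩
      ∑< W (λ i → v (F X i)) + ∑< W (δ X (length T))          ≤⟨ +-monoʳ-≤ _ (∑<-δ W X (length T)) ⟩
      ∑< W (λ i → v (F X i)) + length T                       ∎
      where
      cell : ∀ i → sum (map (hit (coord X i) (coord X X)) T) ≤ v (F X i) + δ X (length T) i
      cell i with i ≟ X
      ... | no i≢X = ≤-trans (off-origin X i (inj₁ (i≢X ∘ coord≡0 X i))) (m≤m+n _ 0)
      ... | yes _  = ≤-trans (sum-≤ T (hit (coord X i) (coord X X)) 1 (All.universal (λ t → 𝟙≤1 _) T))
                       (≤-trans (≤-reflexive (*-identityʳ (length T))) (m≤n+m _ _))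

  -- The surplus 1 in `suc B`, once for each line, cancels the cost of the origin. This is why the
  -- counts must strictly exceed B.
  scaled-hitCounts≤ : ∀ ℓ g X T B E → length g ≡ suc ℓ → length T ≤ ℓ → Roots g T → Distinct T →
    (∀ a b → a ≢ ℤ.+ 0 ⊎ b ≢ ℤ.+ 0 → form g a b ≢ ℤ.+ 0) →
    (∀ t → suc B ≤ hitCount X t + E) → length T * B ≤ v (boxProduct g X) + length T * E
  scaled-hitCounts≤ ℓ g X T B E len T≤ℓ roots distinct nz many = +-cancelˡ-≤ (length T) _ _ (begin
    length T + length T * B                     ≡⟨ *-suc (length T) B ⟨
    length T * suc B                            ≤⟨ sum-≥ T _ (suc B) many ⟩
    sum (map (λ t → hitCount X t + E) T)        ≡⟨ split T ⟩
    sum (map (hitCount X) T) + length T * E     ≤⟨ +-monoˡ-≤ _ (hitCounts≤ ℓ g X T len T≤ℓ roots distinct nz) ⟩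
    v (boxProduct g X) + length T + length T * E ≡⟨ cong (_+ length T * E) (+-comm (v (boxProduct g X)) (length T)) ⟩
    length T + v (boxProduct g X) + length T * E ≡⟨ +-assoc (length T) _ _ ⟩
    length T + (v (boxProduct g X) + length T * E) ∎)
    where
    open ≤-Reasoning
    split : ∀ T → sum (map (λ t → hitCount X t + E) T) ≡ sum (map (hitCount X) T) + length T * E
    split []      = refl
    split (t ∷ T) = trans (cong (hitCount X t + E +_) (split T)) (+-interchange (hitCount X t) E _ _)

  residue-hit : ∀ z → 1 ≤ ∑< p (λ i → 𝟙 (ℤ.+ i ℤ.+ z))
  residue-hit z = ≤-trans (𝟙-∣ (ℤ.+ i ℤ.+ z) (ℤ.divides (ℤ.- q) eq)) (∑<-term p _ i (ℤ.n%ℕd<d (ℤ.- z) p))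
    where
    i = (ℤ.- z) ℤ.%ℕ p
    q = (ℤ.- z) ℤ./ℕ p
    lem : ∀ i z → i ℤ.+ z ≡ i ℤ.- (ℤ.- z)
    lem = ℤ-Solver.solve-∀
    lem′ : ∀ i q p → i ℤ.- (i ℤ.+ q ℤ.* p) ≡ (ℤ.- q) ℤ.* p
    lem′ = ℤ-Solver.solve-∀
    eq : ℤ.+ i ℤ.+ z ≡ (ℤ.- q) ℤ.* ℤ.+ p
    eq = trans (lem (ℤ.+ i) z) (trans (cong (λ u → ℤ.+ i ℤ.- u) (ℤ.a≡a%ℕn+[a/ℕn]*n (ℤ.- z) p)) (lem′ (ℤ.+ i) q (ℤ.+ p)))

  residue-hits : ∀ n z → n / p ≤ ∑< n (λ i → 𝟙 (ℤ.+ i ℤ.+ z))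
  residue-hits n z = begin
    n / p                                              ≤⟨ blocks (n / p) z ⟩
    ∑< (n / p * p) (λ i → 𝟙 (ℤ.+ i ℤ.+ z))             ≤⟨ ∑<-shift 0 (n / p * p) n _ (m/n*n≤m n p) ⟩
    ∑< n (λ i → 𝟙 (ℤ.+ i ℤ.+ z))                       ∎
    where
    open ≤-Reasoning
    blocks : ∀ k z → k ≤ ∑< (k * p) (λ i → 𝟙 (ℤ.+ i ℤ.+ z))
    blocks zero    z = z≤n
    blocks (suc k) z = begin
      1 + k
        ≤⟨ +-mono-≤ (residue-hit z) (blocks k (ℤ.+ p ℤ.+ z)) ⟩
      ∑< p (λ i → 𝟙 (ℤ.+ i ℤ.+ z)) + ∑< (k * p) (λ i → 𝟙 (ℤ.+ i ℤ.+ (ℤ.+ p ℤ.+ z)))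
        ≡⟨ cong (∑< p (λ i → 𝟙 (ℤ.+ i ℤ.+ z)) +_) (∑<-cong (k * p) (λ i _ → cong 𝟙 (lem (ℤ.+ i) (ℤ.+ p) z))) ⟩
      ∑< p (λ i → 𝟙 (ℤ.+ i ℤ.+ z)) + ∑< (k * p) (λ i → 𝟙 (ℤ.+ (p + i) ℤ.+ z))
        ≡⟨ ∑<-split p (k * p) _ ⟨
      ∑< (p + k * p) (λ i → 𝟙 (ℤ.+ i ℤ.+ z)) ∎
      where
      lem : ∀ i p z → i ℤ.+ (p ℤ.+ z) ≡ p ℤ.+ i ℤ.+ z
      lem = ℤ-Solver.solve-∀

  -- For each b the admissible a form a residue class, met once in every full period of length p.
  -- The incomplete period can cost one point per row.
  small-prime-count : ∀ X t → width X * (width X / p) ≤ hitCount X t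
  small-prime-count X t = ≤-trans (≤-reflexive (sym (∑<-const (width X) _))) (∑<-mono (width X) λ j _ → column j)
    where
    lem : ∀ i x c → i ℤ.+ (ℤ.- x ℤ.- c) ≡ i ℤ.- x ℤ.- c
    lem = ℤ-Solver.solve-∀
    column : ∀ j → width X / p ≤ ∑< (width X) (λ i → hit (coord X i) (coord X j) t)
    column j = ≤-trans (residue-hits (width X) (ℤ.- (ℤ.+ X) ℤ.- arg t ℤ.* coord X j))
      (≤-reflexive (∑<-cong (width X) λ i _ → cong 𝟙 (lem (ℤ.+ i) (ℤ.+ X) (arg t ℤ.* coord X j))))

  onLine : ℕ → ℕ → ℕ → ℕ → ℤ
  onLine t s j i = ℤ.+ i ℤ.- arg t ℤ.* ℤ.+ j ℤ.- ℤ.+ s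

  -- Pigeonhole: among the (X+1)² points with coordinates in [0, X], more than X²/p lie on
  -- one line a ≡ t b + s mod p; their differences with a fixed one of them lie in the box.
  large-prime-count : ∀ X t → suc (X * X / p) ≤ hitCount X t
  large-prime-count X t with exceeds p class (X * X / p) total
    where
    point : ℕ → ℕ → ℕ → ℤ
    point = onLine t
    class : ℕ → ℕ
    class s = ∑< (suc X) λ j → ∑< (suc X) λ i → 𝟙 (point s j i)
    open ≤-Reasoning
    some-class : ∀ j i → 1 ≤ ∑< p (λ s → 𝟙 (point s j i))
    some-class j i = ≤-trans (residue-hit (ℤ.- (ℤ.+ i ℤ.- arg t ℤ.* ℤ.+ j))) (∑<-mono p λ s _ →
      𝟙-mono _ _ (λ d → subst (ℤ.+ p ℤ.∣_) (lem (ℤ.+ s) (ℤ.+ i ℤ.- arg t ℤ.* ℤ.+ j)) (ℤ.∣m⇒∣-m d)))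
      where
      lem : ∀ s u → ℤ.- (s ℤ.+ (ℤ.- u)) ≡ u ℤ.- s
      lem = ℤ-Solver.solve-∀
    total : p * (X * X / p) < ∑< p class
    total = begin-strict
      p * (X * X / p)    ≡⟨ *-comm p _ ⟩
      X * X / p * p      ≤⟨ m/n*n≤m (X * X) p ⟩
      X * X              <⟨ *-mono-< (n<1+n X) (n<1+n X) ⟩
      suc X * suc X      ≡⟨ trans (∑<-const (suc X) _) (cong (suc X *_) (trans (∑<-const (suc X) 1) (*-identityʳ (suc X)))) ⟨
      ∑< (suc X) (λ j → ∑< (suc X) (λ i → 1))
                         ≤⟨ ∑<-mono (suc X) (λ j _ → ∑<-mono (suc X) (λ i _ → some-class j i)) ⟩
      ∑< (suc X) (λ j → ∑< (suc X) (λ i → ∑< p (λ s → 𝟙 (point s j i))))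
                         ≡⟨ ∑<-cong (suc X) (λ j _ → ∑<-swap (suc X) p (λ i s → 𝟙 (point s j i))) ⟩
      ∑< (suc X) (λ j → ∑< p (λ s → ∑< (suc X) (λ i → 𝟙 (point s j i))))
                         ≡⟨ ∑<-swap (suc X) p (λ j s → ∑< (suc X) (λ i → 𝟙 (point s j i))) ⟩
      ∑< p class         ∎
  ... | s , _ , many with positive-term (suc X) (λ j → ∑< (suc X) λ i → 𝟙 (onLine t s j i)) (≤-<-trans z≤n many)
  ...   | j₀ , j₀≤X , some with positive-term (suc X) (λ i → 𝟙 (onLine t s j₀ i)) some
  ...     | i₀ , i₀≤X , hit₀ = ≤-trans many (begin
      ∑< (suc X) (λ j → ∑< (suc X) (λ i → 𝟙 (onLine t s j i)))
        ≤⟨ ∑<-mono (suc X) (λ j _ → ∑<-mono (suc X) (λ i _ → 𝟙-mono _ _ (difference j i))) ⟩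
      ∑< (suc X) (λ j → ∑< (suc X) (λ i → hit (coord X ((X ∸ i₀) + i)) (coord X ((X ∸ j₀) + j)) t))
        ≤⟨ ∑<-mono (suc X) (λ j _ → ∑<-shift (X ∸ i₀) (suc X) (width X)
             (λ i → hit (coord X i) (coord X ((X ∸ j₀) + j)) t) (fits i₀)) ⟩
      ∑< (suc X) (λ j → ∑< (width X) (λ i → hit (coord X i) (coord X ((X ∸ j₀) + j)) t))
        ≤⟨ ∑<-shift (X ∸ j₀) (suc X) (width X) (λ j → ∑< (width X) (λ i → hit (coord X i) (coord X j) t)) (fits j₀) ⟩
      hitCount X t ∎)
    where
    open ≤-Reasoning
    -- The coordinate i - k has index (X - k) + i, so the translated interval is a window of X + 1
    -- indices.
    fits : ∀ k → X ∸ k + suc X ≤ width X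
    fits k = ≤-trans (+-monoˡ-≤ (suc X) (m∸n≤m X k)) (≤-reflexive (+-suc X X))
    coord-shift : ∀ k i → k ≤ X → coord X ((X ∸ k) + i) ≡ ℤ.+ i ℤ.- ℤ.+ k
    coord-shift k i k≤X = trans (lem (ℤ.+ (X ∸ k)) (ℤ.+ i) (ℤ.+ X) (ℤ.+ k))
      (trans (cong (λ u → ℤ.+ i ℤ.- ℤ.+ k ℤ.+ (u ℤ.- ℤ.+ X)) (cong ℤ.+_ (m∸n+n≡m k≤X))) (lem′ (ℤ.+ i ℤ.- ℤ.+ k) (ℤ.+ X)))
      where
      lem : ∀ d i x k → d ℤ.+ i ℤ.- x ≡ i ℤ.- k ℤ.+ (d ℤ.+ k ℤ.- x)
      lem = ℤ-Solver.solve-∀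
      lem′ : ∀ u x → u ℤ.+ (x ℤ.- x) ≡ u
      lem′ = ℤ-Solver.solve-∀
    difference : ∀ j i → ℤ.+ p ℤ.∣ ℤ.+ i ℤ.- arg t ℤ.* ℤ.+ j ℤ.- ℤ.+ s →
      ℤ.+ p ℤ.∣ coord X ((X ∸ i₀) + i) ℤ.- arg t ℤ.* coord X ((X ∸ j₀) + j)
    difference j i d = subst (ℤ.+ p ℤ.∣_)
      (trans (lem (ℤ.+ i) (ℤ.+ j) (ℤ.+ i₀) (ℤ.+ j₀) (arg t) (ℤ.+ s))
        (cong₂ (λ a b → a ℤ.- arg t ℤ.* b) (sym (coord-shift i₀ i (s≤s⁻¹ i₀≤X))) (sym (coord-shift j₀ j (s≤s⁻¹ j₀≤X)))))
      (ℤ.∣m∣n⇒∣m-n d (𝟙-pos _ hit₀))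
      where
      lem : ∀ i j i₀ j₀ t s → (i ℤ.- t ℤ.* j ℤ.- s) ℤ.- (i₀ ℤ.- t ℤ.* j₀ ℤ.- s) ≡ (i ℤ.- i₀) ℤ.- t ℤ.* (j ℤ.- j₀)
      lem = ℤ-Solver.solve-∀

-- The prime-by-prime comparison

n≤2^n : ∀ n → n ≤ 2 ^ n
n≤2^n n = <⇒≤ (n<2^n n)

dyadic : ∀ n .{{_ : NonZero n}} → ∃[ j ] (2 ^ j ≤ n × n < 2 ^ suc j)
dyadic (suc zero)    = 0 , ≤-refl , ≤-refl
dyadic (suc (suc n)) with dyadic (suc n)
... | j , lower , upper with suc (suc n) <? 2 ^ suc j
...   | yes lt = j , ≤-trans lower (n≤1+n _) , lt
...   | no  ≮  = suc j , ≮⇒≥ ≮ , ≤-<-trans upper (^-monoʳ-< 2 ≤-refl (n<1+n (suc j)))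

n!≤n^n : ∀ n → n ! ≤ n ^ n
n!≤n^n zero    = ≤-refl
n!≤n^n (suc n) = *-monoʳ-≤ (suc n) (≤-trans (n!≤n^n n) (^-monoˡ-≤ n (n≤1+n n)))

n∣n! : ∀ n .{{_ : NonZero n}} → n ∣ n !
n∣n! (suc n) = m∣m*n (n !)

^-monoˡ-∣ : ∀ {m n} k → m ∣ n → m ^ k ∣ n ^ k
^-monoˡ-∣ zero    m∣n = ∣-reflexive refl
^-monoˡ-∣ (suc k) m∣n = *-pres-∣ m∣n (^-monoˡ-∣ k m∣n)

m!*m^n≤[m+n]! : ∀ m n → m ! * m ^ n ≤ (m + n) !
m!*m^n≤[m+n]! m zero    = ≤-reflexive (trans (*-identityʳ (m !)) (cong _! (sym (+-identityʳ m))))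
m!*m^n≤[m+n]! m (suc n) = begin
  m ! * (m * m ^ n)    ≡⟨ lem (m !) m (m ^ n) ⟩
  m * (m ! * m ^ n)    ≤⟨ *-mono-≤ (≤-trans (m≤m+n m n) (n≤1+n (m + n))) (m!*m^n≤[m+n]! m n) ⟩
  suc (m + n) !        ≡⟨ cong _! (+-suc m n) ⟨
  (m + suc n) !        ∎
  where
  open ≤-Reasoning
  lem : ∀ a b c → a * (b * c) ≡ b * (a * c)
  lem = solve-∀

-- A substitute for Stirling's formula, A! ≥ (A / 4)^A for A = 2^y, obtained by doubling with (2A)!
-- ≥ A! A^A.
[2^y]!-lower : ∀ y → 2 ^ (y * 2 ^ y) ≤ (2 ^ y) ! * 2 ^ (2 * 2 ^ y)
[2^y]!-lower zero    = s≤s z≤n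
[2^y]!-lower (suc y) = begin
  2 ^ (suc y * 2 ^ suc y)                             ≡⟨ cong (2 ^_) (lem₁ y A) ⟩
  2 ^ (y * A + y * A + 2 * A)                         ≡⟨ trans (^-distribˡ-+-* 2 (y * A + y * A) (2 * A)) (cong (_* 2 ^ (2 * A)) (^-distribˡ-+-* 2 (y * A) (y * A))) ⟩
  2 ^ (y * A) * 2 ^ (y * A) * 2 ^ (2 * A)             ≤⟨ *-monoˡ-≤ (2 ^ (2 * A)) (*-monoˡ-≤ (2 ^ (y * A)) ([2^y]!-lower y)) ⟩
  A ! * 2 ^ (2 * A) * 2 ^ (y * A) * 2 ^ (2 * A)       ≡⟨ cong (λ u → A ! * 2 ^ (2 * A) * u * 2 ^ (2 * A)) (sym (^-*-assoc 2 y A)) ⟩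
  A ! * 2 ^ (2 * A) * A ^ A * 2 ^ (2 * A)             ≡⟨ lem₂ (A !) (2 ^ (2 * A)) (A ^ A) ⟩
  A ! * A ^ A * (2 ^ (2 * A) * 2 ^ (2 * A))           ≤⟨ *-monoˡ-≤ _ (m!*m^n≤[m+n]! A A) ⟩
  (A + A) ! * (2 ^ (2 * A) * 2 ^ (2 * A))             ≡⟨ cong₂ _*_ (cong _! (lem₃ A)) (trans (sym (^-distribˡ-+-* 2 (2 * A) (2 * A))) (cong (2 ^_) (lem₄ A))) ⟩
  (2 * A) ! * 2 ^ (2 * (2 * A))                       ∎
  where
  open ≤-Reasoning
  A = 2 ^ y
  lem₁ : ∀ y A → suc y * (2 * A) ≡ y * A + y * A + 2 * A
  lem₁ = solve-∀
  lem₂ : ∀ a b c → a * b * c * b ≡ a * c * (b * b)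
  lem₂ = solve-∀
  lem₃ : ∀ A → A + A ≡ 2 * A
  lem₃ = solve-∀
  lem₄ : ∀ A → 2 * A + 2 * A ≡ 2 * (2 * A)
  lem₄ = solve-∀

∏<-≤ : ∀ n w c → (∀ i → i < n → w i ≤ c) → ∏< n w ≤ c ^ n
∏<-≤ zero    w c le = ≤-refl
∏<-≤ (suc n) w c le = ≤-trans (*-mono-≤ (∏<-≤ n w c λ i i<n → le i (m<n⇒m<1+n i<n)) (le n ≤-refl)) (≤-reflexive (*-comm (c ^ n) c))

∏<-2^ : ∀ n w e → (∀ i → i < n → w i ≤ 2 ^ e i) → ∏< n w ≤ 2 ^ ∑< n e
∏<-2^ zero    w e le = ≤-refl
∏<-2^ (suc n) w e le = ≤-trans (*-mono-≤ (∏<-2^ n w e λ i i<n → le i (m<n⇒m<1+n i<n)) (le n ≤-refl))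
  (≤-reflexive (sym (^-distribˡ-+-* 2 (∑< n e) (e n))))

-- The quotient is a multinomial coefficient.
[Y!]^k∣[kY]! : ∀ Y k → (Y !) ^ k ∣ (k * Y) !
[Y!]^k∣[kY]! Y zero    = ∣-reflexive refl
[Y!]^k∣[kY]! Y (suc k) = ∣-trans (*-monoʳ-∣ (Y !) ([Y!]^k∣[kY]! Y k))
  (subst (λ u → Y ! * u ! ∣ (Y + k * Y) !) (m+n∸m≡n Y (k * Y)) (k![n∸k]!∣n! (m≤m+n Y (k * Y))))

-- The infinite sum of (c + j) / 2^j is 2c + 2. The induction needs c to vary: dropping the first
-- term turns c into c + 1 and N into N / 2.
weighted-halves : ∀ J c N → ∑< J (λ j → (c + j) * _/_ N (2 ^ j) {{m^n≢0 2 j}}) ≤ (2 * c + 2) * N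
weighted-halves zero    c N = z≤n
weighted-halves (suc J) c N = begin
  ∑< (suc J) (λ j → (c + j) * _/_ N (2 ^ j) {{m^n≢0 2 j}})
    ≡⟨ ∑<-split 1 J _ ⟩
  (c + 0) * (N / 1) + ∑< J (λ j → (c + suc j) * _/_ N (2 ^ suc j) {{m^n≢0 2 (suc j)}})
    ≡⟨ cong₂ _+_ (cong₂ _*_ (+-identityʳ c) (n/1≡n N)) (∑<-cong J (λ j _ → cong₂ _*_ (+-suc c j)
         (sym (m/n/o≡m/[n*o] N 2 (2 ^ j) {{_}} {{m^n≢0 2 j}} {{m^n≢0 2 (suc j)}})))) ⟩
  c * N + ∑< J (λ j → (suc c + j) * _/_ (N / 2) (2 ^ j) {{m^n≢0 2 j}})
    ≤⟨ +-monoʳ-≤ (c * N) (weighted-halves J (suc c) (N / 2)) ⟩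
  c * N + (2 * suc c + 2) * (N / 2)
    ≡⟨ lem₁ c N (N / 2) ⟩
  c * N + (c + 2) * (N / 2 * 2)
    ≤⟨ +-monoʳ-≤ (c * N) (*-monoʳ-≤ (c + 2) (m/n*n≤m N 2)) ⟩
  c * N + (c + 2) * N
    ≡⟨ lem₂ c N ⟩
  (2 * c + 2) * N ∎
  where
  open ≤-Reasoning
  lem₁ : ∀ c N h → c * N + (2 * suc c + 2) * h ≡ c * N + (c + 2) * (h * 2)
  lem₁ = solve-∀
  lem₂ : ∀ c N → c * N + (c + 2) * N ≡ (2 * c + 2) * N
  lem₂ = solve-∀

-- Its valuation at p ∈ [2^j, 2^(j+1)) is at least 2⌊N/4^j⌋ and so dominates v(N!) - ⌊N/p⌋.
correction : ℕ → ℕ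
correction N = ∏< N λ j → ((2 ^ suc j) !) ^ (2 * _/_ N (2 ^ j * 2 ^ j) {{m*n≢0 _ _ {{m^n≢0 2 j}} {{m^n≢0 2 j}}}})

correction-factor≢0 : ∀ N j → NonZero (((2 ^ suc j) !) ^ (2 * _/_ N (2 ^ j * 2 ^ j) {{m*n≢0 _ _ {{m^n≢0 2 j}} {{m^n≢0 2 j}}}}))
correction-factor≢0 N j = m^n≢0 ((2 ^ suc j) !) (2 * _/_ N (2 ^ j * 2 ^ j) {{m*n≢0 _ _ {{m^n≢0 2 j}} {{m^n≢0 2 j}}}}) {{(2 ^ suc j) !≢0}}

correction≢0 : ∀ N → NonZero (correction N)
correction≢0 N = ∏<≢0 N (correction-factor≢0 N)

-- By B! ≤ B^B the factor with index j is at most 2^(4 (j + 1) N / 2^j), and the sum of (j + 1) /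
-- 2^j is 4. An exponent linear in N is negligible beside N log N.
correction≤ : ∀ N → correction N ≤ 2 ^ (16 * N)
correction≤ N = begin
  correction N
    ≤⟨ ∏<-2^ N _ (λ j → 4 * ((1 + j) * _/_ N (2 ^ j) {{m^n≢0 2 j}})) (λ j _ → factor j) ⟩
  2 ^ ∑< N (λ j → 4 * ((1 + j) * _/_ N (2 ^ j) {{m^n≢0 2 j}}))
    ≡⟨ cong (2 ^_) (∑<-*ˡ N 4 _) ⟩
  2 ^ (4 * ∑< N (λ j → (1 + j) * _/_ N (2 ^ j) {{m^n≢0 2 j}}))
    ≤⟨ ^-monoʳ-≤ 2 (*-monoʳ-≤ 4 (weighted-halves N 1 N)) ⟩
  2 ^ (4 * (4 * N))
    ≡⟨ cong (2 ^_) (sym (*-assoc 4 4 N)) ⟩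
  2 ^ (16 * N) ∎
  where
  open ≤-Reasoning
  ∑<-*ˡ : ∀ n c w → ∑< n (λ i → c * w i) ≡ c * ∑< n w
  ∑<-*ˡ zero    c w = sym (*-zeroʳ c)
  ∑<-*ˡ (suc n) c w = trans (cong (_+ c * w n) (∑<-*ˡ n c w)) (sym (*-distribˡ-+ c (∑< n w) (w n)))
  factor : ∀ j → ((2 ^ suc j) !) ^ (2 * _/_ N (2 ^ j * 2 ^ j) {{m*n≢0 _ _ {{m^n≢0 2 j}} {{m^n≢0 2 j}}}})
    ≤ 2 ^ (4 * ((1 + j) * _/_ N (2 ^ j) {{m^n≢0 2 j}}))
  factor j = begin
    (B !) ^ (2 * q)                 ≤⟨ ^-monoˡ-≤ (2 * q) (n!≤n^n B) ⟩
    (B ^ B) ^ (2 * q)               ≡⟨ trans (^-*-assoc B B (2 * q)) (^-*-assoc 2 (suc j) (B * (2 * q))) ⟩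
    2 ^ (suc j * (B * (2 * q)))     ≤⟨ ^-monoʳ-≤ 2 (begin
      suc j * (B * (2 * q))             ≡⟨ lem j (2 ^ j) q ⟩
      4 * (suc j * (q * 2 ^ j))         ≡⟨ cong (λ u → 4 * (suc j * (u * 2 ^ j))) (sym (m/n/o≡m/[n*o] N (2 ^ j) (2 ^ j))) ⟩
      4 * (suc j * (N / 2 ^ j / 2 ^ j * 2 ^ j)) ≤⟨ *-monoʳ-≤ 4 (*-monoʳ-≤ (suc j) (m/n*n≤m (N / 2 ^ j) (2 ^ j))) ⟩
      4 * (suc j * (N / 2 ^ j))         ∎) ⟩
    2 ^ (4 * (suc j * (N / 2 ^ j))) ∎
    where
    instance
      2^j≢0 : NonZero (2 ^ j)
      2^j≢0 = m^n≢0 2 j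
      4^j≢0 : NonZero (2 ^ j * 2 ^ j)
      4^j≢0 = m*n≢0 _ _ {{m^n≢0 2 j}} {{m^n≢0 2 j}}
    B = 2 ^ suc j
    q = N / (2 ^ j * 2 ^ j)
    lem : ∀ j b q → suc j * (2 * b * (2 * q)) ≡ 4 * (suc j * (q * b))
    lem = solve-∀

valueProduct : Poly → ℕ → ℕ
valueProduct g N = ∏< N λ i → ∣ eval g (arg i) ∣

module PrimeBounds (p : ℕ) (p-prime : Prime p) where
  open Valuation p p-prime
  open Greedy p p-prime
  open BoxCount p p-prime

  -- Two steps of `legendre` and `v[n!]≤n` leave 2⌊N/p²⌋ ≤ 2⌊N/4^j⌋ for 2^j ≤ p < 2^(j+1), and such
  -- a p divides (2^(j+1))!. The product stops at j < N because j ≥ N would mean p > N.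
  v[N!]≤N/p+v[correction] : ∀ N → v (N !) ≤ N / p + v (correction N)
  v[N!]≤N/p+v[correction] N with dyadic p
  ... | j , 2^j≤p , p<2^[j+1] with j <? N
  ...   | no j≮N  = subst (_≤ N / p + v (correction N))
            (sym (p≰n⇒v[n!]≡0 N (<-≤-trans (n<2^n N) (≤-trans (^-monoʳ-≤ 2 (≮⇒≥ j≮N)) 2^j≤p)))) z≤n
  ...   | yes j<N = begin
    v (N !)                                ≤⟨ legendre N ⟩
    N / p + v ((N / p) !)                  ≤⟨ +-monoʳ-≤ (N / p) (legendre (N / p)) ⟩
    N / p + (N / p / p + v ((N / p / p) !)) ≤⟨ +-monoʳ-≤ (N / p) (+-monoʳ-≤ (N / p / p) (v[n!]≤n (N / p / p))) ⟩
    N / p + (N / p / p + N / p / p)        ≡⟨ cong (N / p +_) (cong (N / p / p +_) (sym (+-identityʳ _))) ⟩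
    N / p + 2 * (N / p / p)                ≤⟨ +-monoʳ-≤ (N / p) (*-monoʳ-≤ 2 quotient≤) ⟩
    N / p + 2 * (N / (2 ^ j * 2 ^ j))      ≡⟨ cong (N / p +_) (sym (*-identityʳ _)) ⟩
    N / p + 2 * (N / (2 ^ j * 2 ^ j)) * 1  ≤⟨ +-monoʳ-≤ (N / p) (*-monoʳ-≤ (2 * (N / (2 ^ j * 2 ^ j))) 1≤v) ⟩
    N / p + 2 * (N / (2 ^ j * 2 ^ j)) * v ((2 ^ suc j) !)
                                           ≡⟨ cong (N / p +_) (sym (v-^ ((2 ^ suc j) !) (2 * (N / (2 ^ j * 2 ^ j))) {{(2 ^ suc j) !≢0}})) ⟩
    N / p + v (((2 ^ suc j) !) ^ (2 * (N / (2 ^ j * 2 ^ j))))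
                                           ≤⟨ +-monoʳ-≤ (N / p) (∑<-term N _ j j<N) ⟩
    N / p + ∑< N _                         ≡⟨ cong (N / p +_) (sym (v-∏< N _ (correction-factor≢0 N))) ⟩
    N / p + v (correction N)               ∎
    where
    open ≤-Reasoning
    instance
      4^j≢0 : NonZero (2 ^ j * 2 ^ j)
      4^j≢0 = m*n≢0 _ _ {{m^n≢0 2 j}} {{m^n≢0 2 j}}
      p*p≢0 : NonZero (p * p)
      p*p≢0 = m*n≢0 p p
    quotient≤ : N / p / p ≤ N / (2 ^ j * 2 ^ j)
    quotient≤ = ≤-trans (≤-reflexive (m/n/o≡m/[n*o] N p p)) (/-monoʳ-≤ N (*-mono-≤ 2^j≤p 2^j≤p))
    1≤v : 1 ≤ v ((2 ^ suc j) !)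
    1≤v = p∣⇒1≤v {{(2 ^ suc j) !≢0}} (∣-trans (n∣n! p) (m≤n⇒m!∣n! (<⇒≤ p<2^[j+1])))

  -- The selection starts from all arguments and truncates at K = L, which loses nothing because
  -- every value divides L and v(L) ≤ L. Each selected value costs at most v(L).
  valueProduct-bound : ∀ ℓ g N L → length g ≡ suc ℓ → .{{_ : NonZero L}} → coeff g ℓ ≢ ℤ.+ 0 →
    (∀ i → NonZero ∣ eval g (arg i) ∣) → (∀ i → i < N → ∣ eval g (arg i) ∣ ∣ L) →
    ∃[ T ] (length T ≤ ℓ × Roots g T × (Separable g → Distinct T) ×
      v (valueProduct g N) ≤ length T * v L + length T * v (N !) + N * v ∣ coeff g ℓ ∣)
  valueProduct-bound ℓ g N L len top nz u∣L with select L N ℓ g (λ _ → true) len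
  ... | T , χ′ , T≤ℓ , T<N , roots , distinct , _ , sums , rest = T , T≤ℓ , roots , distinct , (begin
    v (valueProduct g N)
      ≡⟨ v-∏< N _ nz ⟩
    ∑< N (λ i → v (u i))
      ≤⟨ ∑<-mono N (λ i i<N → v≤vₖ L (u i) (≤-trans (v-mono (u∣L i i<N)) (v≤n L))) ⟩
    ∑< N (w L N g)
      ≤⟨ sums (w L N g) ⟩
    sum (map (w L N g) T) + ∑< N (mask χ′ (w L N g))
      ≤⟨ +-mono-≤ (sum-≤ T _ (v L) (All.map (λ {t} t<N → ≤-trans (vₖ≤v L (u t) {{nz t}}) (v-mono (u∣L t t<N))) T<N)) rest ⟩
    length T * v L + (length T * v (N !) + N * vₖ L ∣ coeff g ℓ ∣)
      ≤⟨ +-monoʳ-≤ (length T * v L) (+-monoʳ-≤ (length T * v (N !)) (*-monoʳ-≤ N (vₖ≤v L ∣ coeff g ℓ ∣ {{≢-nonZero (top ∘ ℤ.∣i∣≡0⇒i≡0)}}))) ⟩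
    length T * v L + (length T * v (N !) + N * v ∣ coeff g ℓ ∣)
      ≡⟨ +-assoc (length T * v L) _ _ ⟨
    length T * v L + length T * v (N !) + N * v ∣ coeff g ℓ ∣ ∎)
    where
    open ≤-Reasoning
    u : ℕ → ℕ
    u i = ∣ eval g (arg i) ∣

  module _ (ℓ X Y k M : ℕ) (g : Poly) (1≤X : 1 ≤ X)
    (M≡ : (X * X) ! ≡ M * (Y !) ^ k)
    (len : length g ≡ suc ℓ)
    (nonzero : ∀ a b → a ≢ ℤ.+ 0 ⊎ b ≢ ℤ.+ 0 → form g a b ≢ ℤ.+ 0)
    (T : List ℕ) (T≤ℓ : length T ≤ ℓ) (roots : Roots g T) (distinct : Distinct T) where

    private
      N = X * X

    -- Here Y! works as an indicator of the primes up to Y: its valuation is at least 1 for p ≤ Y,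
    -- which pays the rounding in the row count, and 0 for p > Y, where M therefore keeps the whole
    -- valuation of N!.
    4*T*N/p≤ : 4 * (length T * (N / p)) ≤ v (boxProduct g X) + 3 * ℓ * v M + (4 * X * ℓ) * v (Y !)
    4*T*N/p≤ with p ≤? Y
    ... | yes p≤Y = begin
      4 * (length T * (N / p))
        ≡⟨ lem (length T) (N / p) ⟩
      length T * (4 * (N / p))
        ≤⟨ scaled-hitCounts≤ ℓ g X T (4 * (N / p)) (4 * X) len T≤ℓ roots distinct nonzero many ⟩
      v (boxProduct g X) + length T * (4 * X)
        ≤⟨ +-monoʳ-≤ (v (boxProduct g X)) (≤-trans (*-monoˡ-≤ (4 * X) T≤ℓ) (≤-reflexive (*-comm ℓ (4 * X)))) ⟩
      v (boxProduct g X) + 4 * X * ℓ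
        ≤⟨ +-mono-≤ (m≤m+n (v (boxProduct g X)) (3 * ℓ * v M)) (m≤m*n (4 * X * ℓ) (v (Y !)) {{>-nonZero 1≤v}}) ⟩
      v (boxProduct g X) + 3 * ℓ * v M + 4 * X * ℓ * v (Y !) ∎
      where
      open ≤-Reasoning
      lem : ∀ a b → 4 * (a * b) ≡ a * (4 * b)
      lem = solve-∀
      1≤v : 1 ≤ v (Y !)
      1≤v = p∣⇒1≤v {{Y !≢0}} (∣-trans (n∣n! p) (m≤n⇒m!∣n! p≤Y))
      W = width X
      -- Multiplying by p removes both floors: 4 X² ≤ W² and W < p (⌊W/p⌋ + 1).
      scaled : p * (4 * (N / p)) ≤ p * (W * suc (W / p))
      scaled = begin
        p * (4 * (N / p))        ≡⟨ lem₁ p (N / p) ⟩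
        4 * (N / p * p)          ≤⟨ *-monoʳ-≤ 4 (m/n*n≤m N p) ⟩
        4 * (X * X)              ≡⟨ lem₂ X ⟩
        (X + X) * (X + X)        ≤⟨ *-mono-≤ (n≤1+n (X + X)) (n≤1+n (X + X)) ⟩
        W * W                    ≤⟨ *-monoʳ-≤ W (<⇒≤ (m<n+m*[1+] W)) ⟩
        W * (p * suc (W / p))    ≡⟨ lem₃ W p (suc (W / p)) ⟩
        p * (W * suc (W / p))    ∎
        where
        lem₁ : ∀ p q → p * (4 * q) ≡ 4 * (q * p)
        lem₁ = solve-∀
        lem₂ : ∀ X → 4 * (X * X) ≡ (X + X) * (X + X)
        lem₂ = solve-∀
        lem₃ : ∀ a b c → a * (b * c) ≡ b * (a * c)
        lem₃ = solve-∀
        m<n+m*[1+] : ∀ m → m < p * suc (m / p)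
        m<n+m*[1+] m = begin-strict
          m                      ≡⟨ m≡m%n+[m/n]*n m p ⟩
          m % p + m / p * p      <⟨ +-monoˡ-< (m / p * p) (m%n<n m p) ⟩
          p + m / p * p          ≡⟨ *-comm (suc (m / p)) p ⟩
          p * suc (m / p)        ∎
      -- One point is lost in each of the 2X + 1 rows and one more is wanted as surplus; 2X + 2 ≤ 4X
      -- since X ≥ 1.
      many : ∀ t → suc (4 * (N / p)) ≤ hitCount X t + 4 * X
      many t = begin
        suc (4 * (N / p))                  ≤⟨ s≤s (*-cancelˡ-≤ p scaled) ⟩
        suc (W * suc (W / p))              ≡⟨ lem₁ X (W / p) ⟩
        W * (W / p) + (2 + (X + X))        ≤⟨ +-mono-≤ (small-prime-count X t) (begin
          2 + (X + X)                        ≤⟨ +-monoˡ-≤ (X + X) (+-mono-≤ 1≤X 1≤X) ⟩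
          X + X + (X + X)                    ≡⟨ lem₂ X ⟩
          4 * X                              ∎) ⟩
        hitCount X t + 4 * X               ∎
        where
        lem₁ : ∀ X q → suc (suc (X + X) * suc q) ≡ suc (X + X) * q + (2 + (X + X))
        lem₁ = solve-∀
        lem₂ : ∀ X → X + X + (X + X) ≡ 4 * X
        lem₂ = solve-∀
    ... | no p≰Y = begin
      4 * (length T * (N / p))
        ≡⟨ lem (length T * (N / p)) ⟩
      length T * (N / p) + 3 * (length T * (N / p))
        ≤⟨ +-mono-≤ box (*-monoʳ-≤ 3 (*-mono-≤ T≤ℓ N/p≤v)) ⟩
      v (boxProduct g X) + 3 * (ℓ * v M)
        ≡⟨ cong (v (boxProduct g X) +_) (sym (*-assoc 3 ℓ (v M))) ⟩
      v (boxProduct g X) + 3 * ℓ * v M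
        ≤⟨ m≤m+n _ _ ⟩
      v (boxProduct g X) + 3 * ℓ * v M + 4 * X * ℓ * v (Y !) ∎
      where
      open ≤-Reasoning
      lem : ∀ a → 4 * a ≡ a + 3 * a
      lem = solve-∀
      box : length T * (N / p) ≤ v (boxProduct g X)
      box = ≤-trans (scaled-hitCounts≤ ℓ g X T (N / p) 0 len T≤ℓ roots distinct nonzero
              (λ t → ≤-trans (large-prime-count X t) (m≤m+n _ 0)))
            (≤-reflexive (trans (cong (v (boxProduct g X) +_) (*-zeroʳ (length T))) (+-identityʳ _)))
      M≢0 : NonZero M
      M≢0 = m*n≢0⇒m≢0 M {{subst NonZero M≡ (N !≢0)}}
      N/p≤v : N / p ≤ v M
      N/p≤v = begin
        N / p                    ≤⟨ N/p≤v[N!] ⟩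
        v (N !)                  ≡⟨ cong v M≡ ⟩
        v (M * (Y !) ^ k)        ≡⟨ v-* M ((Y !) ^ k) {{M≢0}} {{m^n≢0 (Y !) k {{Y !≢0}}}} ⟩
        v M + v ((Y !) ^ k)      ≡⟨ cong (v M +_) (trans (v-^ (Y !) k {{Y !≢0}}) (cong (k *_) (p≰n⇒v[n!]≡0 Y (≰⇒> p≰Y)))) ⟩
        v M + k * 0              ≡⟨ trans (cong (v M +_) (*-zeroʳ k)) (+-identityʳ (v M)) ⟩
        v M                      ∎
        where
        -- The lower half of Legendre's formula: p divides p!, and (p!)^⌊N/p⌋ divides (⌊N/p⌋ p)!.
        N/p≤v[N!] : N / p ≤ v (N !)
        N/p≤v[N!] = v-max {{N !≢0}} (∣-trans (^-monoˡ-∣ (N / p) (n∣n! p))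
          (∣-trans ([Y!]^k∣[kY]! p (N / p)) (m≤n⇒m!∣n! (m/n*n≤m N p))))

-- Kept as a list of bases and exponents so that its valuation is visibly a linear form in the
-- valuations of the bases.
powerProduct : List (ℕ × ℕ) → ℕ
powerProduct []             = 1
powerProduct ((b , e) ∷ bs) = b ^ e * powerProduct bs

powerProduct≢0 : ∀ {bs} → All (NonZero ∘ proj₁) bs → NonZero (powerProduct bs)
powerProduct≢0 []                       = _
powerProduct≢0 {(b , e) ∷ bs} (nz ∷ nzs) = m*n≢0 (b ^ e) (powerProduct bs) {{m^n≢0 b e {{nz}}}} {{powerProduct≢0 nzs}}

v-powerProduct : ∀ p (pr : Prime p) {bs} → All (NonZero ∘ proj₁) bs →
  Valuation.v p pr (powerProduct bs) ≡ sum (map (λ (b , e) → e * Valuation.v p pr b) bs)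
v-powerProduct p pr []                        = Valuation.v1≡0 p pr
v-powerProduct p pr {(b , e) ∷ bs} (nz ∷ nzs) = trans
  (Valuation.v-* p pr (b ^ e) (powerProduct bs) {{m^n≢0 b e {{nz}}}} {{powerProduct≢0 nzs}})
  (cong₂ _+_ (Valuation.v-^ p pr b e {{nz}}) (v-powerProduct p pr nzs))

-- The factors of a multiple of valueProduct g (X²) ^ 4; in its use M = (X²)! / Y!^k.
factors : (ℓ X Y M L a D : ℕ) → Poly → List (ℕ × ℕ)
factors ℓ X Y M L a D g =
  (L , 4 * ℓ) ∷ (boxProduct g X , 1) ∷ (M , 3 * ℓ) ∷ (correction (X * X) , 4 * ℓ) ∷
  (Y ! , 4 * X * ℓ) ∷ (a , 4 * (X * X)) ∷ (D , 4 * ℓ * (X * X)) ∷ []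

∣z∣≢0 : ∀ {z} → z ≢ ℤ.+ 0 → NonZero ∣ z ∣
∣z∣≢0 z≢0 = ≢-nonZero (z≢0 ∘ ℤ.∣i∣≡0⇒i≡0)

factors≢0 : ∀ ℓ X Y k M L D g → (X * X) ! ≡ M * (Y !) ^ k → length g ≡ suc ℓ → coeff g ℓ ≢ ℤ.+ 0 → D ≢ ℤ.+ 0 →
  .{{_ : NonZero L}} → All (NonZero ∘ proj₁) (factors ℓ X Y M L ∣ coeff g ℓ ∣ ∣ D ∣ g)
factors≢0 ℓ X Y k M L D g M≡ len top D≢0 =
  >-nonZero (>-nonZero⁻¹ L) ∷ ∏<≢0 (width X) (λ j → ∏<≢0 (width X) λ i → ⊔1≢0 _) ∷
  m*n≢0⇒m≢0 M {{subst NonZero M≡ ((X * X) !≢0)}} ∷ correction≢0 (X * X) ∷ (Y !≢0) ∷ ∣z∣≢0 top ∷ ∣z∣≢0 D≢0 ∷ []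

valueProduct^4∣ : ∀ ℓ X Y k M L D g → 1 ≤ X → (X * X) ! ≡ M * (Y !) ^ k →
  length g ≡ suc ℓ → coeff g ℓ ≢ ℤ.+ 0 →
  (∀ a b → a ≢ ℤ.+ 0 ⊎ b ≢ ℤ.+ 0 → form g a b ≢ ℤ.+ 0) →
  (∀ m r → m ℤ.∣ eval g r → m ℤ.∣ eval (derivative g) r → m ℤ.∣ D) → D ≢ ℤ.+ 0 →
  .{{_ : NonZero L}} → (∀ i → i < X * X → ∣ eval g (arg i) ∣ ∣ L) →
  valueProduct g (X * X) ^ 4 ∣ powerProduct (factors ℓ X Y M L ∣ coeff g ℓ ∣ ∣ D ∣ g)
valueProduct^4∣ ℓ X Y k M L D g 1≤X M≡ len top nonzero res D≢0 {{L≢0}} u∣L =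
  all-v≤⇒∣ (Q ^ 4) (powerProduct fs) {{m^n≢0 Q 4 {{Q≢0}}}} {{powerProduct≢0 fs≢0}} λ p pr →
    subst₂ _≤_ (sym (Valuation.v-^ p pr Q 4 {{Q≢0}})) (sym (v-powerProduct p pr fs≢0)) (bound p pr)
  where
  N = X * X
  Q = valueProduct g N
  A = ∣ coeff g ℓ ∣
  fs = factors ℓ X Y M L A ∣ D ∣ g
  u≢0 : ∀ i → NonZero ∣ eval g (arg i) ∣
  u≢0 i = ≢-nonZero λ eq → nonzero (arg i) (ℤ.+ 1) (inj₂ λ ()) (trans (form-eval g (arg i)) (ℤ.∣i∣≡0⇒i≡0 eq))
  Q≢0 : NonZero Q
  Q≢0 = ∏<≢0 N u≢0
  fs≢0 : All (NonZero ∘ proj₁) fs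
  fs≢0 = factors≢0 ℓ X Y k M L D g M≡ len top D≢0
  module _ (p : ℕ) (pr : Prime p) where
    open Valuation p pr
    open Greedy p pr
    open PrimeBounds p pr
    open ≤-Reasoning
    R = boxProduct g X
    E = correction N
    rearrange : ∀ L R M E F A D ℓ N X → 4 * (ℓ * L) + (R + 3 * ℓ * M + 4 * X * ℓ * F + 4 * ℓ * E + 4 * ℓ * N * D) + 4 * (N * A) ≡
      4 * ℓ * L + (1 * R + (3 * ℓ * M + (4 * ℓ * E + (4 * X * ℓ * F + (4 * N * A + (4 * ℓ * N * D + 0))))))
    rearrange = solve-∀
    from-factorial : ∀ T → length T ≤ ℓ → v Q ≤ length T * v L + length T * v (N !) + N * v A →
      4 * (length T * v (N !)) ≤ v R + 3 * ℓ * v M + 4 * X * ℓ * v (Y !) + 4 * ℓ * v E + 4 * ℓ * N * v ∣ D ∣ →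
      4 * v Q ≤ sum (map (λ (b , e) → e * v b) fs)
    from-factorial T T≤ℓ vQ≤ le = begin
      4 * v Q
        ≤⟨ *-monoʳ-≤ 4 vQ≤ ⟩
      4 * (length T * v L + length T * v (N !) + N * v A)
        ≡⟨ lem (length T * v L) (length T * v (N !)) (N * v A) ⟩
      4 * (length T * v L) + 4 * (length T * v (N !)) + 4 * (N * v A)
        ≤⟨ +-monoˡ-≤ _ (+-mono-≤ (*-monoʳ-≤ 4 (*-monoˡ-≤ (v L) T≤ℓ)) le) ⟩
      4 * (ℓ * v L) + (v R + 3 * ℓ * v M + 4 * X * ℓ * v (Y !) + 4 * ℓ * v E + 4 * ℓ * N * v ∣ D ∣) + 4 * (N * v A)
        ≡⟨ rearrange (v L) (v R) (v M) (v E) (v (Y !)) (v A) (v ∣ D ∣) ℓ N X ⟩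
      _ ∎
      where
      lem : ∀ a b c → 4 * (a + b + c) ≡ 4 * a + 4 * b + 4 * c
      lem = solve-∀
    bound : 4 * v Q ≤ sum (map (λ (b , e) → e * v b) fs)
    bound with valueProduct-bound ℓ g N L len top u≢0 u∣L
    ... | T , T≤ℓ , roots , distinct , vQ≤ with p ∣? ∣ D ∣
    -- At the primes where roots may coincide the crude bound v(N!) ≤ N is enough: the power of D
    -- has exponent 4 ℓ N.
    ...   | yes p∣D = from-factorial T T≤ℓ vQ≤ (begin
      4 * (length T * v (N !))       ≤⟨ *-monoʳ-≤ 4 (*-mono-≤ T≤ℓ (v[n!]≤n N)) ⟩
      4 * (ℓ * N)                    ≡⟨ *-assoc 4 ℓ N ⟨
      4 * ℓ * N                      ≤⟨ m≤m*n (4 * ℓ * N) (v ∣ D ∣) {{>-nonZero (p∣⇒1≤v {{∣z∣≢0 D≢0}} p∣D)}} ⟩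
      4 * ℓ * N * v ∣ D ∣            ≤⟨ m≤n+m _ _ ⟩
      _                              ∎)
    ...   | no p∤D = from-factorial T T≤ℓ vQ≤ (begin
      4 * (length T * v (N !))
        ≤⟨ *-monoʳ-≤ 4 (*-monoʳ-≤ (length T) (v[N!]≤N/p+v[correction] N)) ⟩
      4 * (length T * (N / p + v E))
        ≡⟨ lem (length T) (N / p) (v E) ⟩
      4 * (length T * (N / p)) + 4 * length T * v E
        ≤⟨ +-mono-≤ (4*T*N/p≤ ℓ X Y k M g 1≤X M≡ len nonzero T T≤ℓ roots (distinct separable))
                    (*-monoˡ-≤ (v E) (*-monoʳ-≤ 4 T≤ℓ)) ⟩
      v R + 3 * ℓ * v M + 4 * X * ℓ * v (Y !) + 4 * ℓ * v E
        ≤⟨ m≤m+n _ _ ⟩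
      v R + 3 * ℓ * v M + 4 * X * ℓ * v (Y !) + 4 * ℓ * v E + 4 * ℓ * N * v ∣ D ∣ ∎)
      where
      separable : Separable g
      separable r d d′ = p∤D (ℤ.∣⇒∣ᵤ (res (ℤ.+ p) r d d′))
      lem : ∀ a b c → 4 * (a * (b + c)) ≡ 4 * (a * b) + 4 * a * c
      lem = solve-∀

-- Archimedean sizes

-- A record, so that unification can recover the exponent.
record _≤2^_ (n s : ℕ) : Set where
  constructor bound
  field
    inequality : n ≤ 2 ^ s
open _≤2^_

^-≤2^ : ∀ {b s} e → b ≤2^ s → (b ^ e) ≤2^ (s * e)
^-≤2^ {b} {s} e (bound b≤) = bound (≤-trans (^-monoˡ-≤ e b≤) (≤-reflexive (^-*-assoc 2 s e)))

*-≤2^ : ∀ {a b s t} → a ≤2^ s → b ≤2^ t → (a * b) ≤2^ (s + t)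
*-≤2^ {s = s} {t} (bound a≤) (bound b≤) = bound (≤-trans (*-mono-≤ a≤ b≤) (≤-reflexive (sym (^-distribˡ-+-* 2 s t))))

n≤2^ⁿ : ∀ n → n ≤2^ n
n≤2^ⁿ n = bound (n≤2^n n)

^-distribʳ-* : ∀ k m n → (m * n) ^ k ≡ m ^ k * n ^ k
^-distribʳ-* zero    m n = refl
^-distribʳ-* (suc k) m n = trans (cong (m * n *_) (^-distribʳ-* k m n)) ([m*n]*[o*p]≡[m*o]*[n*p] m n (m ^ k) (n ^ k))

[2^s]^2 : ∀ s → 2 ^ s * 2 ^ s ≡ 2 ^ (2 * s)
[2^s]^2 s = trans (sym (^-distribˡ-+-* 2 s s)) (cong (λ u → 2 ^ (s + u)) (sym (+-identityʳ s)))

boxProduct≤ : ∀ ℓ g s → length g ≡ suc ℓ →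
  boxProduct g (2 ^ s) ≤ 2 ^ ((height g + s * ℓ) * (width (2 ^ s) * width (2 ^ s)))
boxProduct≤ ℓ g s len = begin
  boxProduct g X      ≤⟨ ∏<-≤ W _ (c ^ W) (λ j j<W → ∏<-≤ W _ c (λ i i<W → cell i j i<W j<W)) ⟩
  (c ^ W) ^ W         ≡⟨ trans (^-*-assoc c W W) (^-*-assoc 2 (height g + s * ℓ) (W * W)) ⟩
  2 ^ ((height g + s * ℓ) * (W * W)) ∎
  where
  open ≤-Reasoning
  X = 2 ^ s
  W = width X
  c = 2 ^ (height g + s * ℓ)
  ∣coord∣≤ : ∀ i → i < W → ∣ coord X i ∣ ≤ X
  ∣coord∣≤ i i<W with i ≤? X
  ... | yes i≤X = ≤-trans (≤-reflexive (trans (cong ∣_∣ (ℤ.m-n≡m⊖n i X)) (ℤ.∣⊖∣-≤ i≤X))) (m∸n≤m X i)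
  ... | no  i≰X = ≤-trans (≤-reflexive (trans (cong ∣_∣ (ℤ.m-n≡m⊖n i X)) (trans (ℤ.∣m⊖n∣≡∣n⊖m∣ i X) (ℤ.∣⊖∣-≤ (<⇒≤ (≰⇒> i≰X))))))
        (m≤n+o⇒m∸n≤o i X (s≤s⁻¹ i<W))
  cell : ∀ i j → i < W → j < W → ∣ form g (coord X i) (coord X j) ∣ ⊔ 1 ≤ c
  cell i j i<W j<W = ⊔-lub (begin
    ∣ form g (coord X i) (coord X j) ∣ ≤⟨ ∣form∣≤ ℓ g _ _ X len (∣coord∣≤ i i<W) (∣coord∣≤ j j<W) ⟩
    height g * X ^ ℓ                   ≤⟨ inequality (*-≤2^ (n≤2^ⁿ (height g)) (bound {s = s * ℓ} (≤-reflexive (^-*-assoc 2 s ℓ)))) ⟩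
    c                                  ∎) (m^n>0 2 (height g + s * ℓ))

-- With N = 2^b and Y = 2^a this is M ≤ (4 N / Y)^N: the numerator is at most N^N, and the k-th
-- power of Y! ≥ (Y / 4)^Y is at least (Y / 4)^N.
factorial-quotient≤ : ∀ a b k M → (2 ^ a * k) ≡ 2 ^ b → (2 ^ b) ! ≡ M * ((2 ^ a) !) ^ k →
  M * 2 ^ (a * 2 ^ b) ≤ 2 ^ (b * 2 ^ b) * 2 ^ (2 * 2 ^ b)
factorial-quotient≤ a b k M split M≡ = begin
  M * 2 ^ (a * N)                       ≡⟨ cong (λ u → M * 2 ^ u) (trans (cong (a *_) (sym split)) (sym (*-assoc a Y k))) ⟩
  M * 2 ^ (a * Y * k)                   ≡⟨ cong (M *_) (^-*-assoc 2 (a * Y) k) ⟨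
  M * (2 ^ (a * Y)) ^ k                 ≤⟨ *-monoʳ-≤ M (^-monoˡ-≤ k ([2^y]!-lower a)) ⟩
  M * (Y ! * 2 ^ (2 * Y)) ^ k           ≡⟨ cong (M *_) (^-distribʳ-* k (Y !) _) ⟩
  M * ((Y !) ^ k * (2 ^ (2 * Y)) ^ k)   ≡⟨ *-assoc M _ _ ⟨
  M * (Y !) ^ k * (2 ^ (2 * Y)) ^ k     ≡⟨ cong₂ _*_ (sym M≡) (trans (^-*-assoc 2 (2 * Y) k) (cong (2 ^_) (trans (*-assoc 2 Y k) (cong (2 *_) split)))) ⟩
  N ! * 2 ^ (2 * N)                     ≤⟨ *-monoˡ-≤ _ (≤-trans (n!≤n^n N) (≤-reflexive (^-*-assoc 2 b N))) ⟩
  2 ^ (b * N) * 2 ^ (2 * N)             ∎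
  where
  open ≤-Reasoning
  N = 2 ^ b
  Y = 2 ^ a

valueProduct≥ : ∀ ℓ g K → (∀ n → suc n ^ ℓ ≤ K * ∣ eval g (ℤ.+ suc n) ∣) → ∀ N →
  (N !) ^ ℓ ≤ K ^ N * valueProduct g N
valueProduct≥ ℓ g K grow zero    = ≤-reflexive (^-zeroˡ ℓ)
valueProduct≥ ℓ g K grow (suc N) = begin
  (suc N * N !) ^ ℓ                            ≡⟨ ^-distribʳ-* ℓ (suc N) (N !) ⟩
  suc N ^ ℓ * (N !) ^ ℓ                        ≤⟨ *-mono-≤ (grow N) (valueProduct≥ ℓ g K grow N) ⟩
  K * u * (K ^ N * valueProduct g N)           ≡⟨ lem K u (K ^ N) (valueProduct g N) ⟩
  K * K ^ N * (valueProduct g N * u)           ∎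
  where
  open ≤-Reasoning
  u = ∣ eval g (arg N) ∣
  lem : ∀ a b c d → a * b * (c * d) ≡ a * c * (d * b)
  lem = solve-∀

-- The left side collects the binary logarithms of the factors other than L. Only the box product
-- and M contribute terms in z N, giving 38 = 20 + 18; elsewhere z X ≤ N and z Y X ≤ N leave
-- multiples of N. The 111 is made of 6 from M, 64 from the correction, 16 from Y! and 25 from the
-- margin of the box.
exponent-sum : ∀ z h ℓ X Y A D → 1 ≤ X → z * X ≤ X * X → z * (Y * X) ≤ X * X → let N = X * X in
  (h + 5 * z * ℓ) * (width X * width X) + ((6 * z * N + 2 * N) * (3 * ℓ) + (16 * N * (4 * ℓ) +
    (4 * z * Y * (4 * X * ℓ) + (A * (4 * N) + D * (4 * ℓ * N)))))
  ≤ 38 * z * ℓ * N + (9 * h + 111 * ℓ + 4 * A + 4 * D * ℓ) * N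
exponent-sum z h ℓ X Y A D 1≤X zX≤N zYX≤N = begin
  (h + 5 * z * ℓ) * (width X * width X) + rest
    ≡⟨ lem₀ z h ℓ X Y A D ⟩
  (h + 5 * z * ℓ) * (4 * N + 4 * X + 1) + rest′ (z * (Y * X))
    ≤⟨ +-mono-≤ (*-monoʳ-≤ (h + 5 * z * ℓ) (+-monoʳ-≤ (4 * N + 4 * X) 1≤X)) (+-monoʳ-≤ S (*-monoʳ-≤ (16 * ℓ) zYX≤N)) ⟩
  (h + 5 * z * ℓ) * (4 * N + 4 * X + X) + rest′ N
    ≡⟨ lem₁ z h ℓ X N A D ⟩
  5 * h * X + 25 * ℓ * (z * X) + T
    ≤⟨ +-monoˡ-≤ T (+-mono-≤ (*-monoʳ-≤ (5 * h) (m≤m*n X X {{>-nonZero 1≤X}})) (*-monoʳ-≤ (25 * ℓ) zX≤N)) ⟩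
  5 * h * N + 25 * ℓ * N + T
    ≡⟨ lem₂ z h ℓ N A D ⟩
  38 * z * ℓ * N + (9 * h + 111 * ℓ + 4 * A + 4 * D * ℓ) * N ∎
  where
  open ≤-Reasoning
  N = X * X
  rest = (6 * z * N + 2 * N) * (3 * ℓ) + (16 * N * (4 * ℓ) +
    (4 * z * Y * (4 * X * ℓ) + (A * (4 * N) + D * (4 * ℓ * N))))
  S = (18 * z + 70) * ℓ * N + 4 * A * N + 4 * D * ℓ * N
  rest′ : ℕ → ℕ
  rest′ u = S + 16 * ℓ * u
  T = (4 * h + 20 * z * ℓ) * N + (S + 16 * ℓ * N)
  lem₀ : ∀ z h ℓ X Y A D → (h + 5 * z * ℓ) * (suc (X + X) * suc (X + X)) +
    ((6 * z * (X * X) + 2 * (X * X)) * (3 * ℓ) + (16 * (X * X) * (4 * ℓ) +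
    (4 * z * Y * (4 * X * ℓ) + (A * (4 * (X * X)) + D * (4 * ℓ * (X * X)))))) ≡
    (h + 5 * z * ℓ) * (4 * (X * X) + 4 * X + 1) +
    ((18 * z + 70) * ℓ * (X * X) + 4 * A * (X * X) + 4 * D * ℓ * (X * X) + 16 * ℓ * (z * (Y * X)))
  lem₀ = solve-∀
  lem₁ : ∀ z h ℓ X N A D → (h + 5 * z * ℓ) * (4 * N + 4 * X + X) +
    ((18 * z + 70) * ℓ * N + 4 * A * N + 4 * D * ℓ * N + 16 * ℓ * N) ≡
    5 * h * X + 25 * ℓ * (z * X) +
    ((4 * h + 20 * z * ℓ) * N + ((18 * z + 70) * ℓ * N + 4 * A * N + 4 * D * ℓ * N + 16 * ℓ * N))
  lem₁ = solve-∀
  lem₂ : ∀ z h ℓ N A D → 5 * h * N + 25 * ℓ * N +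
    ((4 * h + 20 * z * ℓ) * N + ((18 * z + 70) * ℓ * N + 4 * A * N + 4 * D * ℓ * N + 16 * ℓ * N)) ≡
    38 * z * ℓ * N + (9 * h + 111 * ℓ + 4 * A + 4 * D * ℓ) * N
  lem₂ = solve-∀

-- N is a power of 2^10 so that X = N^(1/2), Y = N^(2/5) and k = N^(3/5) are powers of 2. Of the
-- gain of 40 - 38 = 2 units z ℓ N in the exponent, one absorbs all terms linear in N once z ≥ C,
-- and the other is left for L^(4ℓ).
lcm-lower-bound : ∀ ℓ D g K → 1 ≤ ℓ → length g ≡ suc ℓ → coeff g ℓ ≢ ℤ.+ 0 →
  (∀ a b → a ≢ ℤ.+ 0 ⊎ b ≢ ℤ.+ 0 → form g a b ≢ ℤ.+ 0) →
  (∀ m r → m ℤ.∣ eval g r → m ℤ.∣ eval (derivative g) r → m ℤ.∣ D) → D ≢ ℤ.+ 0 →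
  (∀ n → suc n ^ ℓ ≤ K * ∣ eval g (ℤ.+ suc n) ∣) →
  ∃[ C ] (∀ z → C ≤ z → ∀ L .{{_ : NonZero L}} → (∀ i → i < 2 ^ (10 * z) → ∣ eval g (arg i) ∣ ∣ L) →
    2 ^ (z * 2 ^ (10 * z)) ≤ L ^ (4 * ℓ))
lcm-lower-bound ℓ D g K 1≤ℓ len top nonzero res D≢0 grow = C , large
  where
  A = ∣ coeff g ℓ ∣
  h = height g
  C₀ = 9 * h + 111 * ℓ + 4 * A + 4 * ∣ D ∣ * ℓ
  -- The first summand is lost in the lower bound for Q⁴, through K^N and the factor 4^N in the
  -- bound for N!; `C₀` is lost in the upper bounds for the factors.
  C = 4 * (K + 2 * ℓ) + C₀
  large : ∀ z → C ≤ z → ∀ L .{{_ : NonZero L}} → (∀ i → i < 2 ^ (10 * z) → ∣ eval g (arg i) ∣ ∣ L) →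
    2 ^ (z * 2 ^ (10 * z)) ≤ L ^ (4 * ℓ)
  large z C≤z L u∣L = subst (λ N → 2 ^ (z * N) ≤ L ^ (4 * ℓ)) X²≡ (≤-trans
    (^-monoʳ-≤ 2 (*-monoˡ-≤ N (m≤m*n z ℓ {{>-nonZero 1≤ℓ}})))
    (*-cancelʳ-≤ (2 ^ (z * ℓ * N)) (L ^ (4 * ℓ)) (2 ^ (39 * z * ℓ * N)) {{m^n≢0 2 (39 * z * ℓ * N)}} final))
    where
    open ≤-Reasoning
    -- With N = 2^(10z), the exponents of 2^(zℓN) are 40 in Q⁴, 20 in the box product and 18 in
    -- M^(3ℓ); any Y between N^(1/3) and N^(1/2) would leave a positive difference.
    X = 2 ^ (5 * z)
    Y = 2 ^ (4 * z)
    k = 2 ^ (6 * z)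
    N = X * X
    X²≡ : N ≡ 2 ^ (10 * z)
    X²≡ = trans ([2^s]^2 (5 * z)) (cong (2 ^_) (sym (*-assoc 2 5 z)))
    1≤X : 1 ≤ X
    1≤X = m^n>0 2 (5 * z)
    Yk≡ : Y * k ≡ 2 ^ (10 * z)
    Yk≡ = trans (sym (^-distribˡ-+-* 2 (4 * z) (6 * z))) (cong (2 ^_) (sym (*-distribʳ-+ z 4 6)))
    zY≤X : z * Y ≤ X
    zY≤X = ≤-trans (*-monoˡ-≤ Y (n≤2^n z)) (≤-reflexive (sym (^-distribˡ-+-* 2 z (4 * z))))
    zX≤N : z * X ≤ N
    zX≤N = *-monoˡ-≤ X (≤-trans (m≤m*n z Y {{m^n≢0 2 (4 * z)}}) zY≤X)
    zYX≤N : z * (Y * X) ≤ N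
    zYX≤N = ≤-trans (≤-reflexive (sym (*-assoc z Y X))) (*-monoˡ-≤ X zY≤X)
    Y!^k∣ : (Y !) ^ k ∣ N !
    Y!^k∣ = subst (λ u → (Y !) ^ k ∣ u !) (trans (*-comm k Y) (trans Yk≡ (sym X²≡))) ([Y!]^k∣[kY]! Y k)
    M = _∣_.quotient Y!^k∣
    M≡ : N ! ≡ M * (Y !) ^ k
    M≡ = _∣_.equality Y!^k∣
    Q = valueProduct g N
    Q^4≤ : Q ^ 4 ≤ powerProduct (factors ℓ X Y M L A ∣ D ∣ g)
    Q^4≤ = ∣⇒≤ {{powerProduct≢0 (factors≢0 ℓ X Y k M L D g M≡ len top D≢0)}}
      (valueProduct^4∣ ℓ X Y k M L D g 1≤X M≡ len top nonzero res D≢0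
        λ i i<N → u∣L i (subst (i <_) X²≡ i<N))
    M≤ : M ≤ 2 ^ (6 * z * N + 2 * N)
    M≤ = *-cancelʳ-≤ M _ (2 ^ (4 * z * N)) {{m^n≢0 2 (4 * z * N)}} (begin
      M * 2 ^ (4 * z * N)                      ≡⟨ cong (λ N → M * 2 ^ (4 * z * N)) X²≡ ⟩
      M * 2 ^ (4 * z * 2 ^ (10 * z))           ≤⟨ factorial-quotient≤ (4 * z) (10 * z) k M Yk≡ (trans (cong _! (sym X²≡)) M≡) ⟩
      2 ^ (10 * z * 2 ^ (10 * z)) * 2 ^ (2 * 2 ^ (10 * z))
                                               ≡⟨ cong (λ N → 2 ^ (10 * z * N) * 2 ^ (2 * N)) X²≡ ⟨
      2 ^ (10 * z * N) * 2 ^ (2 * N)           ≡⟨ ^-distribˡ-+-* 2 (10 * z * N) (2 * N) ⟨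
      2 ^ (10 * z * N + 2 * N)                 ≡⟨ cong (2 ^_) (lem z N) ⟩
      2 ^ (6 * z * N + 2 * N + 4 * z * N)      ≡⟨ ^-distribˡ-+-* 2 (6 * z * N + 2 * N) (4 * z * N) ⟩
      2 ^ (6 * z * N + 2 * N) * 2 ^ (4 * z * N) ∎)
      where
      lem : ∀ z N → 10 * z * N + 2 * N ≡ 6 * z * N + 2 * N + 4 * z * N
      lem = solve-∀
    R≤ : boxProduct g X ^ 1 ≤ 2 ^ ((h + 5 * z * ℓ) * (width X * width X))
    R≤ = ≤-trans (≤-reflexive (^-identityʳ _)) (boxProduct≤ ℓ g (5 * z) len)
    Y!≤ : Y ! ≤ 2 ^ (4 * z * Y)
    Y!≤ = ≤-trans (n!≤n^n Y) (≤-reflexive (^-*-assoc 2 (4 * z) Y))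
    factors≤ : powerProduct (factors ℓ X Y M L A ∣ D ∣ g) ≤ L ^ (4 * ℓ) * 2 ^ (38 * z * ℓ * N + C₀ * N)
    factors≤ = *-monoʳ-≤ (L ^ (4 * ℓ)) (≤-trans
      (inequality (*-≤2^ (bound {s = (h + 5 * z * ℓ) * (width X * width X)} R≤) (*-≤2^ (^-≤2^ (3 * ℓ) (bound {s = 6 * z * N + 2 * N} M≤))
        (*-≤2^ (^-≤2^ (4 * ℓ) (bound {s = 16 * N} (correction≤ N))) (*-≤2^ (^-≤2^ (4 * X * ℓ) (bound {s = 4 * z * Y} Y!≤))
        (*-≤2^ (^-≤2^ (4 * N) (n≤2^ⁿ A)) (bound (≤-trans (≤-reflexive (*-identityʳ _)) (inequality (^-≤2^ (4 * ℓ * N) (n≤2^ⁿ ∣ D ∣)))))))))))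
      (^-monoʳ-≤ 2 (exponent-sum z h ℓ X Y A ∣ D ∣ 1≤X zX≤N zYX≤N)))
    N!≥ : 2 ^ (10 * z * N) ≤ N ! * 2 ^ (2 * N)
    N!≥ = subst (λ N → 2 ^ (10 * z * N) ≤ N ! * 2 ^ (2 * N)) (sym X²≡) ([2^y]!-lower (10 * z))
    Q≥ : 2 ^ (10 * z * N * ℓ) ≤ 2 ^ ((K + 2 * ℓ) * N) * Q
    Q≥ = begin
      2 ^ (10 * z * N * ℓ)                        ≡⟨ ^-*-assoc 2 (10 * z * N) ℓ ⟨
      (2 ^ (10 * z * N)) ^ ℓ                      ≤⟨ ^-monoˡ-≤ ℓ N!≥ ⟩
      (N ! * 2 ^ (2 * N)) ^ ℓ                     ≡⟨ ^-distribʳ-* ℓ (N !) (2 ^ (2 * N)) ⟩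
      (N !) ^ ℓ * (2 ^ (2 * N)) ^ ℓ               ≤⟨ *-mono-≤ (valueProduct≥ ℓ g K grow N) (≤-reflexive (^-*-assoc 2 (2 * N) ℓ)) ⟩
      K ^ N * Q * 2 ^ (2 * N * ℓ)                 ≤⟨ *-monoˡ-≤ (2 ^ (2 * N * ℓ)) (*-monoˡ-≤ Q (inequality (^-≤2^ N (n≤2^ⁿ K)))) ⟩
      2 ^ (K * N) * Q * 2 ^ (2 * N * ℓ)           ≡⟨ lem₁ (2 ^ (K * N)) Q (2 ^ (2 * N * ℓ)) ⟩
      2 ^ (K * N) * 2 ^ (2 * N * ℓ) * Q           ≡⟨ cong (_* Q) (trans (sym (^-distribˡ-+-* 2 (K * N) (2 * N * ℓ))) (cong (2 ^_) (lem₂ K N ℓ))) ⟩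
      2 ^ ((K + 2 * ℓ) * N) * Q                   ∎
      where
      lem₁ : ∀ a b c → a * b * c ≡ a * c * b
      lem₁ = solve-∀
      lem₂ : ∀ K N ℓ → K * N + 2 * N * ℓ ≡ (K + 2 * ℓ) * N
      lem₂ = solve-∀
    final : 2 ^ (z * ℓ * N) * 2 ^ (39 * z * ℓ * N) ≤ L ^ (4 * ℓ) * 2 ^ (39 * z * ℓ * N)
    final = begin
      2 ^ (z * ℓ * N) * 2 ^ (39 * z * ℓ * N)        ≡⟨ trans (sym (^-distribˡ-+-* 2 (z * ℓ * N) (39 * z * ℓ * N))) (cong (2 ^_) (lem₁ z ℓ N)) ⟩
      2 ^ (10 * z * N * ℓ * 4)                      ≡⟨ ^-*-assoc 2 (10 * z * N * ℓ) 4 ⟨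
      (2 ^ (10 * z * N * ℓ)) ^ 4                    ≤⟨ ^-monoˡ-≤ 4 Q≥ ⟩
      (2 ^ ((K + 2 * ℓ) * N) * Q) ^ 4               ≡⟨ ^-distribʳ-* 4 (2 ^ ((K + 2 * ℓ) * N)) Q ⟩
      (2 ^ ((K + 2 * ℓ) * N)) ^ 4 * Q ^ 4           ≤⟨ *-mono-≤ (≤-reflexive (^-*-assoc 2 ((K + 2 * ℓ) * N) 4)) (≤-trans Q^4≤ factors≤) ⟩
      2 ^ ((K + 2 * ℓ) * N * 4) * (L ^ (4 * ℓ) * 2 ^ (38 * z * ℓ * N + C₀ * N))
                                                    ≡⟨ lem₂ (2 ^ ((K + 2 * ℓ) * N * 4)) (L ^ (4 * ℓ)) _ ⟩
      L ^ (4 * ℓ) * (2 ^ ((K + 2 * ℓ) * N * 4) * 2 ^ (38 * z * ℓ * N + C₀ * N))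
                                                    ≡⟨ cong (L ^ (4 * ℓ) *_) (sym (^-distribˡ-+-* 2 ((K + 2 * ℓ) * N * 4) _)) ⟩
      L ^ (4 * ℓ) * 2 ^ ((K + 2 * ℓ) * N * 4 + (38 * z * ℓ * N + C₀ * N))
                                                    ≤⟨ *-monoʳ-≤ (L ^ (4 * ℓ)) (^-monoʳ-≤ 2 exponent≤) ⟩
      L ^ (4 * ℓ) * 2 ^ (39 * z * ℓ * N)            ∎
      where
      lem₁ : ∀ z ℓ N → z * ℓ * N + 39 * z * ℓ * N ≡ 10 * z * N * ℓ * 4
      lem₁ = solve-∀
      lem₂ : ∀ a b c → a * (b * c) ≡ b * (a * c)
      lem₂ = solve-∀
      lem₃ : ∀ K z ℓ N C₀ → (K + 2 * ℓ) * N * 4 + (38 * z * ℓ * N + C₀ * N) ≡ (4 * (K + 2 * ℓ) + C₀) * N + 38 * z * ℓ * N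
      lem₃ = solve-∀
      lem₄ : ∀ z ℓ N → z * ℓ * N + 38 * z * ℓ * N ≡ 39 * z * ℓ * N
      lem₄ = solve-∀
      exponent≤ : (K + 2 * ℓ) * N * 4 + (38 * z * ℓ * N + C₀ * N) ≤ 39 * z * ℓ * N
      exponent≤ = begin
        (K + 2 * ℓ) * N * 4 + (38 * z * ℓ * N + C₀ * N)   ≡⟨ lem₃ K z ℓ N C₀ ⟩
        C * N + 38 * z * ℓ * N                            ≤⟨ +-monoˡ-≤ (38 * z * ℓ * N) (*-monoˡ-≤ N (≤-trans C≤z (m≤m*n z ℓ {{>-nonZero 1≤ℓ}}))) ⟩
        z * ℓ * N + 38 * z * ℓ * N                        ≡⟨ lem₄ z ℓ N ⟩
        39 * z * ℓ * N                                    ∎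

-- The least common multiple and the logarithmic bound for all N

∣-foldr-lcm : ∀ h n i → i < n → h i ∣ foldr lcm 1 (applyUpTo h n)
∣-foldr-lcm h (suc n) zero    _         = m∣lcm[m,n] (h 0) _
∣-foldr-lcm h (suc n) (suc i) (s≤s i<n) = ∣-trans (∣-foldr-lcm (h ∘ suc) n i i<n) (n∣lcm[m,n] (h 0) _)

foldr-lcm≢0 : ∀ h n → (∀ i → NonZero (h i)) → NonZero (foldr lcm 1 (applyUpTo h n))
foldr-lcm≢0 h zero    nz = _
foldr-lcm≢0 h (suc n) nz = ≢-nonZero λ eq → ≢-nonZero⁻¹ (h 0 * l) {{m*n≢0 (h 0) l {{nz 0}} {{foldr-lcm≢0 (h ∘ suc) n (nz ∘ suc)}}}}
  (trans (sym (gcd*lcm (h 0) l)) (trans (cong (gcd (h 0) l *_) eq) (*-zeroʳ (gcd (h 0) l))))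
  where
  l = foldr lcm 1 (applyUpTo (h ∘ suc) n)

2^-cancel-< : ∀ {a b} → 2 ^ a < 2 ^ b → a < b
2^-cancel-< lt = ≰⇒> λ b≤a → <⇒≱ lt (^-monoʳ-≤ 2 b≤a)

≤2^-+ : ∀ k {a j N} → N < 2 ^ j → j ≤ k + a → N ≤ 2 ^ k * 2 ^ a
≤2^-+ k {a} N<2^j j≤k+a = ≤-trans (<⇒≤ N<2^j) (≤-trans (^-monoʳ-≤ 2 j≤k+a) (≤-reflexive (^-distribˡ-+-* 2 k a)))

-- Rounding N down to n = 2^(10 z) costs less than the factor `B` = 2^10, which goes into c. The
-- exponent s for `log-comparison` is taken from 2^s ≤ L < 2^(s+1).
N-log-N-bound : ∀ B → 2 ^ 10 ≡ B →
  ∀ (L : ℕ → ℕ) A C → 1 ≤ A → (∀ N → NonZero (L N)) →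
  (∀ z → C ≤ z → ∀ N → 2 ^ (10 * z) ≤ N → 2 ^ (z * 2 ^ (10 * z)) ≤ L N ^ A) →
  ∃[ c ] (0ℝ <ℝ c × (∃[ N₀ ] (∀ N → N₀ ≤ N → c *ℝ fromℕ N *ℝ log N ≤ℝ log (L N))))
N-log-N-bound B 2^10≡B L A C 1≤A L≢0 lower =
  unitFraction P , 0<reciprocal P , 2 ^ (10 * z₀) , λ N N₀≤N → large N N₀≤N (dyadic N {{>-nonZero (≤-trans (m^n>0 2 (10 * z₀)) N₀≤N)}}) (dyadic (L N) {{L≢0 N}})
  where
  open ≤-Reasoning
  -- The reciprocal of c is 80 B A: `B` from rounding N, 20 from the bound 20 z for the binary
  -- logarithm of N, a 2 from log L ≥ s / 2, another 2 from s + 1 ≤ 2 s, and `A` from the power of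
  -- L.
  P = pred (80 * B * A)
  -- `C` is what `lower` asks for. The term `suc A` gives z n > A, which forces s ≥ 1, as s + 1 ≤ 2
  -- s requires.
  z₀ = C + suc A
  scale : ∀ B z t s n N → N ≤ B * n → t ≤ 20 * z → z * n ≤ 2 * s * A → 1 ≤ B → N * t * 2 ≤ suc (pred (80 * B * A)) * s
  scale B z t s n N N≤ t≤ zn≤ 1≤B = begin
    N * t * 2                   ≤⟨ *-monoˡ-≤ 2 (*-mono-≤ N≤ t≤) ⟩
    B * n * (20 * z) * 2        ≡⟨ lem₁ B n z ⟩
    40 * B * (z * n)            ≤⟨ *-monoʳ-≤ (40 * B) zn≤ ⟩
    40 * B * (2 * s * A)        ≡⟨ lem₂ B s A ⟩
    80 * B * A * s              ≡⟨ cong (_* s) (sym (suc-pred (80 * B * A) {{m*n≢0 (80 * B) A {{m*n≢0 80 B {{_}} {{>-nonZero 1≤B}}}} {{>-nonZero 1≤A}}}})) ⟩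
    suc (pred (80 * B * A)) * s ∎
    where
    lem₁ : ∀ B n z → B * n * (20 * z) * 2 ≡ 40 * B * (z * n)
    lem₁ = solve-∀
    lem₂ : ∀ B s A → 40 * B * (2 * s * A) ≡ 80 * B * A * s
    lem₂ = solve-∀
  large : ∀ N → 2 ^ (10 * z₀) ≤ N → ∃[ j ] (2 ^ j ≤ N × N < 2 ^ suc j) → ∃[ s ] (2 ^ s ≤ L N × L N < 2 ^ suc s) →
    unitFraction P *ℝ fromℕ N *ℝ log N ≤ℝ log (L N)
  large N N₀≤N (j , 2^j≤N , N<2^[j+1]) (s , 2^s≤L , L<2^[s+1]) =
    log-comparison P N (L N) s (suc j) 2^s≤L (<⇒≤ N<2^[j+1])
      (scale B z (suc j) s n N N≤Bn t≤20z zn≤2sA (subst (1 ≤_) 2^10≡B (m^n>0 2 10)))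
    where
    z = j / 10
    n = 2 ^ (10 * z)
    10z≤j : 10 * z ≤ j
    10z≤j = ≤-trans (≤-reflexive (*-comm 10 z)) (m/n*n≤m j 10)
    j<10[z+1] : suc j ≤ 10 + 10 * z
    j<10[z+1] = begin
      suc j                ≡⟨ cong suc (m≡m%n+[m/n]*n j 10) ⟩
      suc (j % 10) + z * 10 ≤⟨ +-mono-≤ (m%n<n j 10) (≤-reflexive (*-comm z 10)) ⟩
      10 + 10 * z          ∎
    z₀≤z : z₀ ≤ z
    z₀≤z = s≤s⁻¹ (*-cancelˡ-< 10 z₀ (suc z) (<-≤-trans (2^-cancel-< (≤-<-trans N₀≤N N<2^[j+1])) (≤-trans j<10[z+1] (≤-reflexive (sym (*-suc 10 z))))))
    A<z : A < z
    A<z = ≤-trans (m≤n+m (suc A) C) z₀≤z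
    N≤Bn : N ≤ B * n
    N≤Bn = subst (λ B → N ≤ B * n) 2^10≡B (≤2^-+ 10 N<2^[j+1] j<10[z+1])
    t≤20z : suc j ≤ 20 * z
    t≤20z = begin
      suc j                ≤⟨ j<10[z+1] ⟩
      10 + 10 * z          ≤⟨ +-monoˡ-≤ (10 * z) (m≤m*n 10 z {{>-nonZero (≤-trans (s≤s z≤n) A<z)}}) ⟩
      10 * z + 10 * z      ≡⟨ *-distribʳ-+ z 10 10 ⟨
      20 * z               ∎
    zn≤[s+1]A : z * n ≤ suc s * A
    zn≤[s+1]A = ≮⇒≥ λ lt → <⇒≱ (^-monoʳ-< 2 ≤-refl lt) (begin
      2 ^ (z * n)          ≤⟨ lower z (≤-trans (m≤m+n C (suc A)) z₀≤z) N (≤-trans (^-monoʳ-≤ 2 10z≤j) 2^j≤N) ⟩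
      L N ^ A              ≤⟨ ^-monoˡ-≤ A (<⇒≤ L<2^[s+1]) ⟩
      (2 ^ suc s) ^ A      ≡⟨ ^-*-assoc 2 (suc s) A ⟩
      2 ^ (suc s * A)      ∎)
    1≤s : 1 ≤ s
    1≤s = n≢0⇒n>0 λ s≡0 → <⇒≱ A<z (begin
      z                    ≤⟨ m≤m*n z n {{m^n≢0 2 (10 * z)}} ⟩
      z * n                ≤⟨ zn≤[s+1]A ⟩
      suc s * A            ≡⟨ cong (λ s → suc s * A) s≡0 ⟩
      1 * A                ≡⟨ *-identityˡ A ⟩
      A                    ∎)
    zn≤2sA : z * n ≤ 2 * s * A
    zn≤2sA = ≤-trans zn≤[s+1]A (*-monoˡ-≤ A (≤-trans (+-monoˡ-≤ s 1≤s) (≤-reflexive (cong (s +_) (sym (+-identityʳ s))))))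

theorem1p2 : ∀ (f : ℤ[x].Poly) (d : ℕ) → ℤ[x].HasDegree f d → 2 ≤ d → IrreducibleOverℚ f →
    ∃[ c ] (0ℝ <ℝ c × (∃[ N₀ ] (∀ (N : ℕ) → N₀ ≤ N →
    c *ℝ fromℕ N *ℝ log N ≤ℝ log (L f N))))
theorem1p2 f d (top , high) 2≤d irreducible =
  N-log-N-bound _ refl (L f) (4 * d) (proj₁ lower) (≤-trans (<⇒≤ 2≤d) (m≤n*m d 4)) L≢0 λ z C≤z N 2^10z≤N →
    proj₂ lower z C≤z (L f N) {{L≢0 N}} λ i i<2^10z →
      subst (λ u → ∣ u ∣ ∣ L f N) (f≡g (arg i)) (∣-foldr-lcm _ N i (<-≤-trans i<2^10z 2^10z≤N))
  where
  -- The list f may carry trailing zeros, which would change its binary form; g has the same values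
  -- and exactly d + 1 coefficients.
  g = truncate (suc d) f
  f≈g : f ℤ[x].≈ g
  f≈g = truncate-≈ (suc d) f high
  f≡g : ∀ x → ℤ[x].eval f x ≡ ℤ[x].eval g x
  f≡g x = eval-≈ f g x f≈g
  g-degree : ℤ[x].HasDegree g d
  g-degree = (λ eq → top (trans (f≈g d) eq)) , λ i d<i → trans (sym (f≈g i)) (high i d<i)
  g-length : length g ≡ suc d
  g-length = length-truncate (suc d) f
  g-splits : SplitsTrivially g
  g-splits g≈xy = RawSemiringDefinitions.Irreducible.split-∣1 irreducible λ i →
    trans (coeff-ι f i) (trans (cong ι (f≈g i)) (trans (sym (coeff-ι g i)) (g≈xy i)))
  nonzero : ∀ a b → a ≢ ℤ.+ 0 ⊎ b ≢ ℤ.+ 0 → form g a b ≢ ℤ.+ 0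
  nonzero = form-nonzero g d g-degree 2≤d g-splits g-length
  g≢0 : ∀ n → ℤ[x].eval g (ℤ.+ suc n) ≢ ℤ.+ 0
  g≢0 n eq = nonzero (ℤ.+ suc n) (ℤ.+ 1) (inj₂ λ ()) (trans (form-eval g (ℤ.+ suc n)) eq)
  L≢0 : ∀ N → NonZero (L f N)
  L≢0 N = foldr-lcm≢0 _ N λ i → ≢-nonZero λ eq → g≢0 i (trans (sym (f≡g (ℤ.+ suc i))) (ℤ.∣i∣≡0⇒i≡0 eq))
  sep = separability g d g-degree (<⇒≤ 2≤d) g-splits
  lower = lcm-lower-bound d (proj₁ sep) g (proj₁ (growth d g g-length (proj₁ g-degree) g≢0)) (<⇒≤ 2≤d) g-length
    (proj₁ g-degree) nonzero (proj₂ (proj₂ sep)) (proj₁ (proj₂ sep)) (proj₂ (growth d g g-length (proj₁ g-degree) g≢0))
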